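{- Let $k$ be a finite field with $\mathrm{char}(k)\neq 2$ and let $m\ge 1$. Every double coset in $\mathrm{GL}_m(k[[z]])\backslash \mathrm{GL}_m(k((z)))/\mathrm{GL}_m(k((z^2)))$ contains a block diagonal matrix each of whose diagonal blocks is one of the $1\times 1$ blocks $(1)$, $(z)$, or a $2\times 2$ block $\begin{pmatrix}1& z\\ 0 & z^i\end{pmatrix}$ with $i>1$ an integer; and this representative is unique up to reordering of the diagonal blocks.
   Context: $k[[z]]$ is the ring of formal power series, $k((z))$ its fraction field, and $k((z^2))\subset k((z))$ the subfield of Laurent series in $z^2$. -}

module Defs where

open import Algebra.Bundles using (CommutativeRing; RawRing)
import Algebra.Definitions.RawMonoid as RawMonoidDefs
import Algebra.Definitions.RawSemiring as RawSemiringDefs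
open import Data.Bool.Base using (if_then_else_)
open import Data.Fin.Base as Fin using (Fin; toℕ; splitAt)
import Data.Fin.Properties as Fin
open import Data.List.Base as List using (List)
open import Data.Nat.Base as ℕ using (ℕ; zero; suc; _∸_; _<_)
open import Data.Nat.Divisibility using (_∣_)
open import Data.Product.Base using (∃-syntax; Σ-syntax)
open import Data.Sum.Base using (inj₁; inj₂)
open import Function.Bundles using (Inverse; _⇔_)
open import Level using (Level; _⊔_)
open import Relation.Binary.PropositionalEquality.Core using (_≡_)
open import Relation.Binary.PropositionalEquality.Properties using (setoid)
open import Relation.Nullary.Decidable.Core using (does)
open import Relation.Nullary.Negation.Core using (¬_)

private
  variable
    c ℓ : Level

------------------------------------------------------------------------
-- Finite fields

record IsField (R : CommutativeRing c ℓ) : Set (c ⊔ ℓ) where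
  open CommutativeRing R
  field
    1≉0     : ¬ 1# ≈ 0#
    inverse : ∀ x → ¬ x ≈ 0# → ∃[ y ] x * y ≈ 1#

IsFinite : CommutativeRing c ℓ → Set (c ⊔ ℓ)
IsFinite R = ∃[ n ] Inverse (CommutativeRing.setoid R) (setoid (Fin n))

HasCharacteristic : CommutativeRing c ℓ → ℕ → Set ℓ
HasCharacteristic R p = ∀ n → n × 1# ≈ 0# ⇔ p ∣ n
  where
  open CommutativeRing R using (_≈_; 0#; 1#; +-rawMonoid)
  open RawMonoidDefs +-rawMonoid using (_×_)

------------------------------------------------------------------------
-- Square matrices and the general linear group

Matrix : Set c → ℕ → Set c
Matrix A m = Fin m → Fin m → A

mapᴹ : ∀ {a b} {A : Set a} {B : Set b} {m} → (A → B) → Matrix A m → Matrix B m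
mapᴹ f M i j = f (M i j)

module _ (R : RawRing c ℓ) where
  open RawRing R
  open RawMonoidDefs +-rawMonoid using (sum)

  infix 4 _≈ᴹ_
  _≈ᴹ_ : ∀ {m} → Matrix Carrier m → Matrix Carrier m → Set ℓ
  M ≈ᴹ N = ∀ i j → M i j ≈ N i j

  infixl 7 _*ᴹ_
  _*ᴹ_ : ∀ {m} → Matrix Carrier m → Matrix Carrier m → Matrix Carrier m
  (M *ᴹ N) i j = sum (λ l → M i l * N l j)

  1ᴹ : ∀ {m} → Matrix Carrier m
  1ᴹ i j = if does (i Fin.≟ j) then 1# else 0#

  infixr 6 _⊕_
  _⊕_ : ∀ {m n} → Matrix Carrier m → Matrix Carrier n → Matrix Carrier (m ℕ.+ n)
  _⊕_ {m} M N i j with splitAt m i | splitAt m j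
  ... | inj₁ i′ | inj₁ j′ = M i′ j′
  ... | inj₂ i′ | inj₂ j′ = N i′ j′
  ... | inj₁ _  | inj₂ _  = 0#
  ... | inj₂ _  | inj₁ _  = 0#

  record GL (m : ℕ) : Set (c ⊔ ℓ) where
    field
      matrix   : Matrix Carrier m
      inverse  : Matrix Carrier m
      inverseˡ : inverse *ᴹ matrix ≈ᴹ 1ᴹ
      inverseʳ : matrix *ᴹ inverse ≈ᴹ 1ᴹ

------------------------------------------------------------------------
-- Formal power series k⟦z⟧, as coefficient sequences

module PowerSeries (k : CommutativeRing c ℓ) where
  open CommutativeRing k hiding (zero)
  open RawMonoidDefs +-rawMonoid using (sum)

  k⟦z⟧ : RawRing c ℓ
  k⟦z⟧ = record
    { Carrier = ℕ → Carrier
    ; _≈_     = λ f g → ∀ n → f n ≈ g n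
    ; _+_     = λ f g n → f n + g n
    ; _*_     = λ f g n → sum {suc n} (λ i → f (toℕ i) * g (n ∸ toℕ i))
    ; -_      = λ f n → - f n
    ; 0#      = λ _ → 0#
    ; 1#      = λ { zero → 1# ; (suc _) → 0# }
    }

  -- shift d f = z^d f
  shift : ℕ → (ℕ → Carrier) → (ℕ → Carrier)
  shift zero    f n       = f n
  shift (suc d) f zero    = 0#
  shift (suc d) f (suc n) = shift d f n

  -- expand f = f(z²)
  expand : (ℕ → Carrier) → (ℕ → Carrier)
  expand f zero          = f zero
  expand f (suc zero)    = 0#
  expand f (suc (suc n)) = expand (λ i → f (suc i)) n

------------------------------------------------------------------------
-- Formal Laurent series k⸨z⸩

-- z^- d · f is the Laurent series z^{-d} f with f ∈ k⟦z⟧.  Over a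
-- field this is the fraction field of k⟦z⟧, every nonzero power series
-- being a power of z times a unit.  The same series has many such
-- presentations (f may be divisible by z), whence the equality below.
infix 5 z^-_·_
record LaurentSeries (A : Set c) : Set c where
  constructor z^-_·_
  field
    poleBound : ℕ
    series    : ℕ → A

module Laurent (k : CommutativeRing c ℓ) where
  open PowerSeries k
  private
    module k = CommutativeRing k
    module P = RawRing k⟦z⟧

  k⸨z⸩ : RawRing c ℓ
  k⸨z⸩ = record
    { Carrier = LaurentSeries k.Carrier
    ; _≈_     = λ { (z^- d · f) (z^- e · g) → shift e f P.≈ shift d g }
    ; _+_     = λ { (z^- d · f) (z^- e · g) → z^- d ℕ.+ e · shift e f P.+ shift d g }
    ; _*_     = λ { (z^- d · f) (z^- e · g) → z^- d ℕ.+ e · f P.* g }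
    ; -_      = λ { (z^- d · f) → z^- d · P.- f }
    ; 0#      = z^- 0 · P.0#
    ; 1#      = z^- 0 · P.1#
    }

  open RawRing k⸨z⸩ using (Carrier)

  -- the inclusion k⟦z⟧ ⊂ k⸨z⸩
  ι : (ℕ → k.Carrier) → Carrier
  ι f = z^- 0 · f

  -- The substitution z ↦ z².  It is injective, and its image is the
  -- subfield k⸨z²⸩ of k⸨z⸩.
  _[z²] : Carrier → Carrier
  (z^- d · f) [z²] = z^- 2 ℕ.* d · expand f

  z : Carrier
  z = ι (shift 1 P.1#)

  -- M ∈ GL_m(k⟦z⟧) g GL_m(k⸨z²⸩); an element of GL_m(k⸨z²⸩) is
  -- given as h(z²) with h ∈ GL_m(k⸨z⸩).
  InDoubleCoset : ∀ {m} → GL k⸨z⸩ m → Matrix Carrier m → Set (c ⊔ ℓ)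
  InDoubleCoset {m} g M =
    Σ[ a ∈ GL k⟦z⟧ m ] Σ[ h ∈ GL k⸨z⸩ m ]
      M ≈ mapᴹ ι (GL.matrix a) * GL.matrix g * mapᴹ _[z²] (GL.matrix h)
    where
    infix  4 _≈_
    infixl 7 _*_
    _≈_ : Matrix Carrier m → Matrix Carrier m → Set ℓ
    _≈_ = _≈ᴹ_ k⸨z⸩
    _*_ : Matrix Carrier m → Matrix Carrier m → Matrix Carrier m
    _*_ = _*ᴹ_ k⸨z⸩

------------------------------------------------------------------------
-- The block diagonal representatives

data Block : Set where
  ⟨1⟩   : Block
  ⟨z⟩   : Block
  upper : (i : ℕ) → 1 < i → Block

size : Block → ℕ
size ⟨1⟩         = 1
size ⟨z⟩         = 1
size (upper _ _) = 2

infixr 5 _∷_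
data Blocks : ℕ → Set where
  []  : Blocks 0
  _∷_ : ∀ {m} (b : Block) → Blocks m → Blocks (size b ℕ.+ m)

toList : ∀ {m} → Blocks m → List Block
toList []       = List.[]
toList (b ∷ bs) = b List.∷ toList bs

module BlockMatrices (k : CommutativeRing c ℓ) where
  open Laurent k
  open RawRing k⸨z⸩ using (Carrier; 0#; 1#; rawSemiring)
  open RawSemiringDefs rawSemiring using (_^_)

  block : (b : Block) → Matrix Carrier (size b)
  block ⟨1⟩         _            _            = 1#
  block ⟨z⟩         _            _            = z
  block (upper i _) Fin.zero     Fin.zero     = 1#
  block (upper i _) Fin.zero     (Fin.suc _)  = z
  block (upper i _) (Fin.suc _)  Fin.zero     = 0#
  block (upper i _) (Fin.suc _)  (Fin.suc _)  = z ^ i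

  blockDiagonal : ∀ {m} → Blocks m → Matrix Carrier m
  blockDiagonal []       ()
  blockDiagonal (b ∷ bs) = _⊕_ k⸨z⸩ (block b) (blockDiagonal bs)

{-# OPTIONS --safe #-}
module Submission where

-- A double coset is a lattice (the rows of g span it over k⟦z⟧) in a vector
-- space over k⸨z⸩ with a k⸨z²⸩-structure, that is, with a semilinear
-- involution σ extending z ↦ - z.
--
-- Existence.  Let T be the matrix of σ in a basis of the lattice.  If T is
-- integral, one of (e ± σ(e))/2 is part of a basis for each basis vector e,
-- and averaging a coordinate over σ splits it off; this gives the 1 × 1
-- blocks.  Otherwise let z^{-λ} be the worst pole of T: there is a basis
-- vector x such that x and y = z^λ σ(x) are part of a basis, and the span
-- of x and y, which is a block with i = λ + 1, splits off.
--
-- Uniqueness.  An isomorphism of block diagonal lattices with σ reduces,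
-- modulo z, to a matrix which is triangular with respect to the filtration
-- by the λ with z^λ σ(x) in the lattice, and which separates the signs of σ
-- in degree 0.  So its diagonal blocks are invertible, and their sizes, the
-- multiplicities of the blocks, agree.

open import Defs
open import Algebra.Bundles using (CommutativeRing; RawRing)
open import Algebra.Core using (Op₁; Op₂)
open import Algebra.Morphism.Structures using (module RingMorphisms)
open import Algebra.Structures using (IsCommutativeRing)
import Algebra.Definitions.RawMonoid
import Algebra.Properties.Ring
import Algebra.Properties.Semiring.Exp
import Algebra.Properties.Semiring.Mult
import Algebra.Properties.Semiring.Sum
import Algebra.Solver.Ring
import Algebra.Solver.Ring.AlmostCommutativeRing as ACR
open import Data.Bool.Base using (Bool; true; false; if_then_else_)
open import Data.Empty using (⊥; ⊥-elim)
open import Data.Fin.Base as Fin using (Fin; zero; suc; toℕ; _↑ˡ_; _↑ʳ_; splitAt; punchIn; punchOut)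
import Data.Fin.Properties as Fin
open import Data.Fin.Permutation as Perm using (Permutation; _⟨$⟩ʳ_; _⟨$⟩ˡ_)
open import Data.List.Base using (List; []; _∷_)
open import Data.List.Relation.Binary.Permutation.Propositional as ↭ using (_↭_)
open import Data.Maybe.Base using (Maybe; just; nothing; fromMaybe)
import Data.Maybe.Properties as Maybe
open import Data.Nat.Base as ℕ using (ℕ; zero; suc; _≤_; _<_; _≥_; z≤n; s≤s)
open import Data.Nat.Divisibility using (_∣_; divides)
import Data.Nat.Properties as ℕ
open import Data.Product.Base using (_×_; _,_; proj₁; proj₂; Σ-syntax; ∃-syntax)
open import Data.Sum.Base as Sum using (_⊎_; inj₁; inj₂; [_,_]′)
open import Function.Base using (_∘_)
open import Function.Bundles using (Inverse; mk⇔)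
open import Level using (Level; _⊔_) renaming (suc to lsuc)
open import Relation.Binary.Bundles using (Setoid)
open import Relation.Binary.Core using (Rel)
open import Relation.Binary.Definitions using (DecidableEquality; tri<; tri≈; tri>)
open import Relation.Binary.PropositionalEquality.Core as ≡ using (_≡_)
import Relation.Binary.Reasoning.Setoid
open import Relation.Nullary using (¬_; Dec; yes; no)
open import Relation.Nullary.Decidable using (does; dec-true; map′)

-- Put T = σ(g) g⁻¹. Right multiplication of g by a matrix over k((z²)) leaves T alone, left
-- multiplication by a turns it into σ(a) T a⁻¹, and two matrices with the same T differ by a right
-- factor fixed by σ. So double cosets become twisted conjugacy classes under GL(k[[z]]), and both
-- halves of the theorem are statements about T. Each normal form of T is produced together with an
-- explicit basis realising it, and this basis supplies the right factor h. The obstacle is that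
-- equality of power series is undecidable, so valuations cannot simply be computed. What can be
-- decided is whether a constant coefficient vanishes, that is, whether an integral element is a
-- unit. The worst pole is therefore reached by descent from some bound, and ranks are compared by
-- an elimination that tests entries modulo z.

private
  variable
    c ℓ : Level

-- Ring identities modulo hypotheses

-- The ring solver needs coefficients with decidable equality to see that
-- x - x vanishes; here the integers, as formal differences of naturals.
module IntegerSolver (R : CommutativeRing c ℓ) where
  open CommutativeRing R
  open Algebra.Properties.Ring ring
  open Algebra.Properties.Semiring.Mult semiring using (×-homo-+; ×1-homo-*) renaming (_×_ to _×#_)
  open Relation.Binary.Reasoning.Setoid setoid

  private
    reduce : ℕ × ℕ → ℕ × ℕ
    reduce (suc a , suc b) = reduce (a , b)
    reduce x               = x

    differences : RawRing _ _
    differences = record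
      { Carrier = ℕ × ℕ
      ; _≈_ = _≡_
      ; _+_ = λ (a , b) (c , d) → reduce (a ℕ.+ c , b ℕ.+ d)
      ; _*_ = λ (a , b) (c , d) → reduce (a ℕ.* c ℕ.+ b ℕ.* d , a ℕ.* d ℕ.+ b ℕ.* c)
      ; -_ = λ (a , b) → b , a
      ; 0# = 0 , 0
      ; 1# = 1 , 0
      }

    value : ℕ × ℕ → Carrier
    value (a , b) = a ×# 1# - b ×# 1#

    -- The separate clauses make con (0 , 0) and con (1 , 0) evaluate to 0#
    -- and 1# definitionally.
    ⟦_⟧ : ℕ × ℕ → Carrier
    ⟦ 0 , 0 ⟧ = 0#
    ⟦ 1 , 0 ⟧ = 1#
    ⟦ x ⟧     = value x

    ⟦⟧≈value : ∀ x → ⟦ x ⟧ ≈ value x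
    ⟦⟧≈value (0 , 0)           = sym (-‿inverseʳ 0#)
    ⟦⟧≈value (0 , suc b)       = refl
    ⟦⟧≈value (1 , 0)           = sym (trans (+-cong (+-identityʳ 1#) -0#≈0#) (+-identityʳ 1#))
    ⟦⟧≈value (1 , suc b)       = refl
    ⟦⟧≈value (suc (suc a) , b) = refl

    interchange : ∀ a b c d → (a + b) + (c + d) ≈ (a + c) + (b + d)
    interchange a b c d = begin
      (a + b) + (c + d)  ≈⟨ +-assoc _ _ _ ⟩
      a + (b + (c + d))  ≈⟨ +-congˡ (+-assoc _ _ _) ⟨
      a + ((b + c) + d)  ≈⟨ +-congˡ (+-congʳ (+-comm b c)) ⟩
      a + ((c + b) + d)  ≈⟨ +-congˡ (+-assoc _ _ _) ⟩
      a + (c + (b + d))  ≈⟨ +-assoc _ _ _ ⟨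
      (a + c) + (b + d)  ∎

    neg-+ : ∀ x y → - x + - y ≈ - (x + y)
    neg-+ x y = trans (+-comm _ _) (sym (-‿anti-homo-+ x y))

    value-reduce : ∀ x → value (reduce x) ≈ value x
    value-reduce (0 , b)         = refl
    value-reduce (suc a , 0)     = refl
    value-reduce (suc a , suc b) = begin
      value (reduce (a , b))                ≈⟨ value-reduce (a , b) ⟩
      a ×# 1# - b ×# 1#                     ≈⟨ +-identityˡ _ ⟨
      0# + (a ×# 1# - b ×# 1#)              ≈⟨ +-congʳ (-‿inverseʳ 1#) ⟨
      (1# - 1#) + (a ×# 1# - b ×# 1#)       ≈⟨ interchange _ _ _ _ ⟩
      (1# + a ×# 1#) + (- 1# - b ×# 1#)     ≈⟨ +-congˡ (neg-+ _ _) ⟩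
      (1# + a ×# 1#) - (1# + b ×# 1#)       ∎

    +-homo : ∀ x y → value (RawRing._+_ differences x y) ≈ value x + value y
    +-homo (a , b) (c , d) = begin
      value (reduce (a ℕ.+ c , b ℕ.+ d))
        ≈⟨ value-reduce (a ℕ.+ c , b ℕ.+ d) ⟩
      (a ℕ.+ c) ×# 1# - (b ℕ.+ d) ×# 1#
        ≈⟨ +-cong (×-homo-+ 1# a c) (-‿cong (×-homo-+ 1# b d)) ⟩
      (a ×# 1# + c ×# 1#) - (b ×# 1# + d ×# 1#)
        ≈⟨ +-congˡ (neg-+ _ _) ⟨
      (a ×# 1# + c ×# 1#) + (- (b ×# 1#) + - (d ×# 1#))
        ≈⟨ interchange _ _ _ _ ⟩
      value (a , b) + value (c , d) ∎

    *-homo : ∀ x y → value (RawRing._*_ differences x y) ≈ value x * value y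
    *-homo (a , b) (c , d) = begin
      value (reduce (a ℕ.* c ℕ.+ b ℕ.* d , a ℕ.* d ℕ.+ b ℕ.* c))
        ≈⟨ value-reduce (a ℕ.* c ℕ.+ b ℕ.* d , a ℕ.* d ℕ.+ b ℕ.* c) ⟩
      (a ℕ.* c ℕ.+ b ℕ.* d) ×# 1# - (a ℕ.* d ℕ.+ b ℕ.* c) ×# 1#
        ≈⟨ +-cong (×-homo-+ 1# (a ℕ.* c) _) (-‿cong (×-homo-+ 1# (a ℕ.* d) _)) ⟩
      ((a ℕ.* c) ×# 1# + (b ℕ.* d) ×# 1#) - ((a ℕ.* d) ×# 1# + (b ℕ.* c) ×# 1#)
        ≈⟨ +-cong (+-cong (×1-homo-* a c) (×1-homo-* b d))
                  (-‿cong (+-cong (×1-homo-* a d) (×1-homo-* b c))) ⟩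
      (A * C + B * D) - (A * D + B * C)
        ≈⟨ +-congˡ (trans (-‿cong (+-comm _ _)) (sym (neg-+ _ _))) ⟩
      (A * C + B * D) + (- (B * C) + - (A * D))
        ≈⟨ interchange _ _ _ _ ⟩
      (A * C + - (B * C)) + (B * D + - (A * D))
        ≈⟨ +-cong (+-congˡ (-‿distribˡ-* B C))
                  (trans (+-comm _ _) (+-cong (-‿distribʳ-* A D) (sym (neg*neg B D)))) ⟩
      (A * C + - B * C) + (A * - D + - B * - D)
        ≈⟨ +-cong (distribʳ _ _ _) (distribʳ _ _ _) ⟨
      (A - B) * C + (A - B) * - D
        ≈⟨ distribˡ _ _ _ ⟨
      (A - B) * (C - D) ∎
      where
      A = a ×# 1#
      B = b ×# 1#
      C = c ×# 1#
      D = d ×# 1#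
      neg*neg : ∀ x y → - x * - y ≈ x * y
      neg*neg x y = begin
        - x * - y     ≈⟨ -‿distribˡ-* x (- y) ⟨
        - (x * - y)   ≈⟨ -‿cong (-‿distribʳ-* x y) ⟨
        - (- (x * y)) ≈⟨ -‿involutive _ ⟩
        x * y         ∎

    almostRing : ACR.AlmostCommutativeRing c ℓ
    almostRing = record
      { isAlmostCommutativeRing = record
        { isCommutativeSemiring = isCommutativeSemiring
        ; -‿cong = -‿cong
        ; -‿*-distribˡ = λ x y → sym (-‿distribˡ-* x y)
        ; -‿+-comm = neg-+
        }
      }

    morphism : differences ACR.-Raw-AlmostCommutative⟶ almostRing
    morphism = record
      { ⟦_⟧ = ⟦_⟧
      ; +-homo = λ x y → begin
          ⟦ RawRing._+_ differences x y ⟧      ≈⟨ ⟦⟧≈value (RawRing._+_ differences x y) ⟩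
          value (RawRing._+_ differences x y)  ≈⟨ +-homo x y ⟩
          value x + value y                    ≈⟨ +-cong (⟦⟧≈value x) (⟦⟧≈value y) ⟨
          ⟦ x ⟧ + ⟦ y ⟧                        ∎
      ; *-homo = λ x y → begin
          ⟦ RawRing._*_ differences x y ⟧      ≈⟨ ⟦⟧≈value (RawRing._*_ differences x y) ⟩
          value (RawRing._*_ differences x y)  ≈⟨ *-homo x y ⟩
          value x * value y                    ≈⟨ *-cong (⟦⟧≈value x) (⟦⟧≈value y) ⟨
          ⟦ x ⟧ * ⟦ y ⟧                        ∎
      ; -‿homo = λ x@(a , b) → begin
          ⟦ b , a ⟧                  ≈⟨ ⟦⟧≈value (b , a) ⟩
          b ×# 1# - a ×# 1#          ≈⟨ +-congʳ (-‿involutive _) ⟨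
          - - (b ×# 1#) - a ×# 1#    ≈⟨ -‿anti-homo-+ _ _ ⟨
          - (a ×# 1# - b ×# 1#)      ≈⟨ -‿cong (⟦⟧≈value x) ⟨
          - ⟦ x ⟧                    ∎
      ; 0-homo = refl
      ; 1-homo = refl
      }

    _≟_ : ∀ x y → Maybe (⟦ x ⟧ ≈ ⟦ y ⟧)
    x@(a , b) ≟ y@(c , d) with a ℕ.+ d ℕ.≟ c ℕ.+ b
    ... | no _ = nothing
    ... | yes a+d≡c+b = just (begin
      ⟦ x ⟧                  ≈⟨ ⟦⟧≈value x ⟩
      A - B                  ≈⟨ +-identityʳ _ ⟨
      (A - B) + 0#           ≈⟨ +-congˡ (-‿inverseʳ D) ⟨
      (A - B) + (D - D)      ≈⟨ interchange _ _ _ _ ⟩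
      (A + D) + (- B - D)    ≈⟨ +-cong A+D≈C+B (+-comm _ _) ⟩
      (C + B) + (- D - B)    ≈⟨ interchange _ _ _ _ ⟩
      (C - D) + (B - B)      ≈⟨ +-congˡ (-‿inverseʳ B) ⟩
      (C - D) + 0#           ≈⟨ +-identityʳ _ ⟩
      C - D                  ≈⟨ ⟦⟧≈value y ⟨
      ⟦ y ⟧                  ∎)
      where
      A = a ×# 1#
      B = b ×# 1#
      C = c ×# 1#
      D = d ×# 1#
      A+D≈C+B : A + D ≈ C + B
      A+D≈C+B = trans (sym (×-homo-+ 1# a d))
        (trans (reflexive (≡.cong (_×# 1#) a+d≡c+b)) (×-homo-+ 1# c b))

  open Algebra.Solver.Ring differences almostRing morphism _≟_ public
    using (solve; _:=_; _:+_; _:*_; _:-_; :-_; con)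

  -- The solver proves identities only; an equation such as z z⁻¹ = 1 enters through a cofactor `k`,
  -- which exhibits x - y as a member of the ideal generated by the differences of the hypotheses.
  linear₁ : ∀ {x y a b} k → a ≈ b → x ≈ y + k * (a - b) → x ≈ y
  linear₁ {x} {y} {a} {b} k a≈b e = begin
    x                ≈⟨ e ⟩
    y + k * (a - b)  ≈⟨ +-congˡ (*-congˡ (trans (+-congʳ a≈b) (-‿inverseʳ b))) ⟩
    y + k * 0#       ≈⟨ +-congˡ (zeroʳ k) ⟩
    y + 0#           ≈⟨ +-identityʳ y ⟩
    y                ∎

  linear₂ : ∀ {x y a b a′ b′} k k′ → a ≈ b → a′ ≈ b′ → x ≈ y + k * (a - b) + k′ * (a′ - b′) → x ≈ y
  linear₂ k k′ p q e = linear₁ k p (linear₁ k′ q e)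

  linear₃ : ∀ {x y a b a′ b′ a″ b″} k k′ k″ → a ≈ b → a′ ≈ b′ → a″ ≈ b″ →
            x ≈ y + k * (a - b) + k′ * (a′ - b′) + k″ * (a″ - b″) → x ≈ y
  linear₃ k k′ k″ p q r e = linear₂ k k′ p q (linear₁ k″ r e)

-- Matrices, shears and block sums

module Matrices (R : CommutativeRing c ℓ) where
  open CommutativeRing R hiding (zero)
  open Algebra.Properties.Semiring.Sum semiring public
    using (sum; sum-cong-≋; ∑-distrib-+; ∑-comm; *-distribˡ-sum; *-distribʳ-sum;
           sum-replicate-zero; sum-remove; sum-permute)
  open IntegerSolver R

  Vector : ℕ → Set c
  Vector n = Fin n → Carrier

  Mat : ℕ → ℕ → Set c
  Mat m n = Fin m → Fin n → Carrier

  infix 4 _≋_ _≈ₘ_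
  _≋_ : ∀ {n} → Vector n → Vector n → Set ℓ
  u ≋ v = ∀ i → u i ≈ v i

  _≈ₘ_ : ∀ {m n} → Mat m n → Mat m n → Set ℓ
  M ≈ₘ N = ∀ i j → M i j ≈ N i j

  vectorSetoid : ℕ → Setoid c ℓ
  vectorSetoid n = record
    { Carrier = Vector n
    ; _≈_ = _≋_
    ; isEquivalence = record
      { refl = λ _ → refl ; sym = λ p i → sym (p i) ; trans = λ p q i → trans (p i) (q i) }
    }

  matSetoid : ℕ → ℕ → Setoid c ℓ
  matSetoid m n = record
    { Carrier = Mat m n
    ; _≈_ = _≈ₘ_
    ; isEquivalence = record
      { refl = λ _ _ → refl
      ; sym = λ p i j → sym (p i j)
      ; trans = λ p q i j → trans (p i j) (q i j)
      }
    }

  module ≋ {n} = Setoid (vectorSetoid n)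
  module ≈ₘ {m n} = Setoid (matSetoid m n)

  1ₘ : ∀ {n} → Mat n n
  1ₘ = 1ᴹ rawRing

  infixl 7 _∙_ _⋆_
  -- Lattices are spanned by rows, so matrices act on row vectors from the right, and a statement
  -- about a product is proved one row at a time.
  _∙_ : ∀ {m n} → Vector m → Mat m n → Vector n
  (v ∙ M) j = sum (λ l → v l * M l j)

  _⋆_ : ∀ {m n p} → Mat m n → Mat n p → Mat m p
  (M ⋆ N) i = M i ∙ N

  sum-cong : ∀ {n} {u v : Vector n} → u ≋ v → sum u ≈ sum v
  sum-cong p = sum-cong-≋ p

  sum-zero : ∀ {n} {u : Vector n} → (∀ i → u i ≈ 0#) → sum u ≈ 0#
  sum-zero {n} p = trans (sum-cong p) (sum-replicate-zero n)

  ∙-cong : ∀ {m n} {u v : Vector m} {M N : Mat m n} → u ≋ v → M ≈ₘ N → u ∙ M ≋ v ∙ N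
  ∙-cong p q j = sum-cong (λ l → *-cong (p l) (q l j))

  ⋆-cong : ∀ {m n p} {M M′ : Mat m n} {N N′ : Mat n p} → M ≈ₘ M′ → N ≈ₘ N′ → M ⋆ N ≈ₘ M′ ⋆ N′
  ⋆-cong p q i = ∙-cong (p i) q

  ∙-assoc : ∀ {m n p} (v : Vector m) (M : Mat m n) (N : Mat n p) → (v ∙ M) ∙ N ≋ v ∙ (M ⋆ N)
  ∙-assoc v M N j = begin
    sum (λ l → sum (λ i → v i * M i l) * N l j)
      ≈⟨ sum-cong (λ l → *-distribʳ-sum (N l j) (λ i → v i * M i l)) ⟩
    sum (λ l → sum (λ i → v i * M i l * N l j))
      ≈⟨ ∑-comm (λ l i → v i * M i l * N l j) ⟩
    sum (λ i → sum (λ l → v i * M i l * N l j))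
      ≈⟨ sum-cong (λ i → trans (sum-cong (λ l → *-assoc (v i) (M i l) (N l j)))
                               (sym (*-distribˡ-sum (v i) (λ l → M i l * N l j)))) ⟩
    sum (λ i → v i * sum (λ l → M i l * N l j)) ∎
    where open Relation.Binary.Reasoning.Setoid setoid

  ⋆-assoc : ∀ {m n p q} (M : Mat m n) (N : Mat n p) (P : Mat p q) → (M ⋆ N) ⋆ P ≈ₘ M ⋆ (N ⋆ P)
  ⋆-assoc M N P i = ∙-assoc (M i) N P

  1ₘ-∙ : ∀ {m n} (i : Fin m) (M : Mat m n) → 1ₘ i ∙ M ≋ M i
  1ₘ-∙ zero    M j = trans (+-cong (*-identityˡ _) (sum-zero (λ l → zeroˡ (M (suc l) j)))) (+-identityʳ _)
  1ₘ-∙ (suc i) M j = trans (+-cong (zeroˡ _) (1ₘ-∙ i (M ∘ suc) j)) (+-identityˡ _)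

  ∙-1ₘ : ∀ {n} (v : Vector n) → v ∙ 1ₘ ≋ v
  ∙-1ₘ v zero    = trans (+-cong (*-identityʳ _) (sum-zero (λ l → zeroʳ (v (suc l))))) (+-identityʳ _)
  ∙-1ₘ v (suc j) = trans (+-cong (zeroʳ _) (∙-1ₘ (v ∘ suc) j)) (+-identityˡ _)

  ⋆-identityˡ : ∀ {m n} (M : Mat m n) → 1ₘ ⋆ M ≈ₘ M
  ⋆-identityˡ M i = 1ₘ-∙ i M

  ⋆-identityʳ : ∀ {m n} (M : Mat m n) → M ⋆ 1ₘ ≈ₘ M
  ⋆-identityʳ M i = ∙-1ₘ (M i)

  ∙-distribʳ : ∀ {m n} (u v : Vector m) (M : Mat m n) → (λ l → u l + v l) ∙ M ≋ λ j → (u ∙ M) j + (v ∙ M) j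
  ∙-distribʳ u v M j = trans (sum-cong (λ l → distribʳ (M l j) (u l) (v l)))
    (∑-distrib-+ (λ l → u l * M l j) (λ l → v l * M l j))

  ∙-scale : ∀ {m n} x (v : Vector m) (M : Mat m n) → (λ l → x * v l) ∙ M ≋ λ j → x * (v ∙ M) j
  ∙-scale x v M j = trans (sum-cong (λ l → *-assoc x (v l) (M l j))) (sym (*-distribˡ-sum x (λ l → v l * M l j)))

  module ⋆-Reasoning {m n} = Relation.Binary.Reasoning.Setoid (matSetoid m n)

  ⋆-cancelˡ : ∀ {m n} {A B : Mat m m} (M : Mat m n) → A ⋆ B ≈ₘ 1ₘ → A ⋆ (B ⋆ M) ≈ₘ M
  ⋆-cancelˡ {A = A} {B} M p = begin
    A ⋆ (B ⋆ M) ≈⟨ ⋆-assoc A B M ⟨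
    A ⋆ B ⋆ M   ≈⟨ ⋆-cong p ≈ₘ.refl ⟩
    1ₘ ⋆ M      ≈⟨ ⋆-identityˡ M ⟩
    M           ∎
    where open ⋆-Reasoning

  ⋆-cancelʳ : ∀ {m n} {A B : Mat n n} (M : Mat m n) → A ⋆ B ≈ₘ 1ₘ → (M ⋆ A) ⋆ B ≈ₘ M
  ⋆-cancelʳ {A = A} {B} M p = begin
    M ⋆ A ⋆ B   ≈⟨ ⋆-assoc M A B ⟩
    M ⋆ (A ⋆ B) ≈⟨ ⋆-cong (≈ₘ.refl {x = M}) p ⟩
    M ⋆ 1ₘ      ≈⟨ ⋆-identityʳ M ⟩
    M           ∎
    where open ⋆-Reasoning

  inverse-⋆ : ∀ {n} {A A′ B B′ : Mat n n} → A ⋆ A′ ≈ₘ 1ₘ → B ⋆ B′ ≈ₘ 1ₘ → (A ⋆ B) ⋆ (B′ ⋆ A′) ≈ₘ 1ₘ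
  inverse-⋆ {A = A} {A′} {B} {B′} p q = begin
    A ⋆ B ⋆ (B′ ⋆ A′)  ≈⟨ ⋆-assoc (A ⋆ B) B′ A′ ⟨
    A ⋆ B ⋆ B′ ⋆ A′    ≈⟨ ⋆-cong (⋆-cancelʳ A q) ≈ₘ.refl ⟩
    A ⋆ A′             ≈⟨ p ⟩
    1ₘ                 ∎
    where open ⋆-Reasoning

  -- A rank one change of the identity. Transvections and the replacement of one basis vector are
  -- both of this form, so a single formula inverts them.
  shear : ∀ {n} → Vector n → Vector n → Mat n n
  shear w u i j = 1ₘ i j + w i * u j

  _·_ : ∀ {n} → Vector n → Vector n → Carrier
  u · v = sum (λ l → u l * v l)

  ∙-shear : ∀ {n} (v w u : Vector n) → v ∙ shear w u ≋ λ j → v j + (v · w) * u j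
  ∙-shear {n} v w u j = begin
    sum (λ l → v l * (1ₘ l j + w l * u j))
      ≈⟨ sum-cong {n} (λ l → trans (distribˡ (v l) (1ₘ l j) (w l * u j)) (+-congˡ (sym (*-assoc (v l) (w l)
          (u j))))) ⟩
    sum (λ l → v l * 1ₘ l j + v l * w l * u j)
      ≈⟨ ∑-distrib-+ (λ l → v l * 1ₘ l j) (λ l → v l * w l * u j) ⟩
    (v ∙ 1ₘ) j + sum (λ l → v l * w l * u j)
      ≈⟨ +-cong (∙-1ₘ v j) (sym (*-distribʳ-sum (u j) (λ l → v l * w l))) ⟩
    v j + (v · w) * u j ∎
    where open Relation.Binary.Reasoning.Setoid setoid

  -- (1 + w ⊗ u)(1 + w ⊗ u′) = 1 + w ⊗ (u + u′ + (u · w) u′), where shear w u = 1 + w ⊗ u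
  shear-inverse : ∀ {n} (w u u′ : Vector n) → (∀ j → u j + u′ j + (u · w) * u′ j ≈ 0#) →
                  shear w u ⋆ shear w u′ ≈ₘ 1ₘ
  shear-inverse w u u′ p i j = begin
    (shear w u i ∙ shear w u′) j
      ≈⟨ ∙-distribʳ (1ₘ i) (λ l → w i * u l) (shear w u′) j ⟩
    (1ₘ i ∙ shear w u′) j + ((λ l → w i * u l) ∙ shear w u′) j
      ≈⟨ +-cong (1ₘ-∙ i (shear w u′) j) (∙-scale (w i) u (shear w u′) j) ⟩
    1ₘ i j + w i * u′ j + w i * (u ∙ shear w u′) j
      ≈⟨ +-congˡ (*-congˡ (∙-shear u w u′ j)) ⟩
    1ₘ i j + w i * u′ j + w i * (u j + (u · w) * u′ j)
      ≈⟨ solve 5 (λ d w u′ u c → d :+ w :* u′ :+ w :* (u :+ c :* u′)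
           := d :+ w :* (u :+ u′ :+ c :* u′)) refl (1ₘ i j) (w i) (u′ j) (u j) (u · w) ⟩
    1ₘ i j + w i * (u j + u′ j + (u · w) * u′ j)
      ≈⟨ +-congˡ (trans (*-congˡ (p j)) (zeroʳ _)) ⟩
    1ₘ i j + 0#
      ≈⟨ +-identityʳ _ ⟩
    1ₘ i j ∎
    where open Relation.Binary.Reasoning.Setoid setoid

  ·-scale : ∀ {n} x (u w : Vector n) → (λ l → x * u l) · w ≈ x * (u · w)
  ·-scale x u w = trans (sum-cong (λ l → *-assoc x (u l) (w l))) (sym (*-distribˡ-sum x (λ l → u l * w l)))

  infixr 6 _⊞_
  _⊞_ : ∀ {p q} → Mat p p → Mat q q → Mat (p ℕ.+ q) (p ℕ.+ q)
  _⊞_ = _⊕_ rawRing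

  module _ {p q} (M : Mat p p) (N : Mat q q) where

    ⊞-ˡˡ : ∀ i j → (M ⊞ N) (i ↑ˡ q) (j ↑ˡ q) ≡ M i j
    ⊞-ˡˡ i j rewrite Fin.splitAt-↑ˡ p i q | Fin.splitAt-↑ˡ p j q = ≡.refl

    ⊞-ˡʳ : ∀ i j → (M ⊞ N) (i ↑ˡ q) (p ↑ʳ j) ≡ 0#
    ⊞-ˡʳ i j rewrite Fin.splitAt-↑ˡ p i q | Fin.splitAt-↑ʳ p q j = ≡.refl

    ⊞-ʳˡ : ∀ i j → (M ⊞ N) (p ↑ʳ i) (j ↑ˡ q) ≡ 0#
    ⊞-ʳˡ i j rewrite Fin.splitAt-↑ʳ p q i | Fin.splitAt-↑ˡ p j q = ≡.refl

    ⊞-ʳʳ : ∀ i j → (M ⊞ N) (p ↑ʳ i) (p ↑ʳ j) ≡ N i j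
    ⊞-ʳʳ i j rewrite Fin.splitAt-↑ʳ p q i | Fin.splitAt-↑ʳ p q j = ≡.refl

  split : ∀ {a} {p q} (P : Fin (p ℕ.+ q) → Set a) →
          (∀ i → P (i ↑ˡ q)) → (∀ i → P (p ↑ʳ i)) → ∀ i → P i
  split {p = zero}  P l r i       = r i
  split {p = suc p} P l r zero    = l zero
  split {p = suc p} P l r (suc i) = split {p = p} (P ∘ suc) (l ∘ suc) r i

  ⊞-elim : ∀ {a p q} (P : Fin (p ℕ.+ q) → Fin (p ℕ.+ q) → Set a) →
           (∀ i j → P (i ↑ˡ q) (j ↑ˡ q)) → (∀ i j → P (i ↑ˡ q) (p ↑ʳ j)) →
           (∀ i j → P (p ↑ʳ i) (j ↑ˡ q)) → (∀ i j → P (p ↑ʳ i) (p ↑ʳ j)) → ∀ i j → P i j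
  ⊞-elim {p = p} P ll lr rl rr =
    split {p = p} _ (λ i → split {p = p} _ (ll i) (lr i)) (λ i → split {p = p} _ (rl i) (rr i))

  sum-split : ∀ p {q} (f : Vector (p ℕ.+ q)) → sum f ≈ sum (λ i → f (i ↑ˡ q)) + sum (λ i → f (p ↑ʳ i))
  sum-split zero    f = sym (+-identityˡ _)
  sum-split (suc p) f = trans (+-congˡ (sum-split p (f ∘ suc))) (sym (+-assoc _ _ _))

  module _ {p q} (M : Mat p p) (N : Mat q q) where

    ∙-⊞ˡ : ∀ (v : Vector (p ℕ.+ q)) j → (v ∙ (M ⊞ N)) (j ↑ˡ q) ≈ ((λ i → v (i ↑ˡ q)) ∙ M) j
    ∙-⊞ˡ v j = trans (sum-split p _) (trans (+-cong
      (sum-cong (λ l → *-congˡ (reflexive (⊞-ˡˡ M N l j))))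
      (sum-zero (λ l → trans (*-congˡ (reflexive (⊞-ʳˡ M N l j))) (zeroʳ _)))) (+-identityʳ _))

    ∙-⊞ʳ : ∀ (v : Vector (p ℕ.+ q)) j → (v ∙ (M ⊞ N)) (p ↑ʳ j) ≈ ((λ i → v (p ↑ʳ i)) ∙ N) j
    ∙-⊞ʳ v j = trans (sum-split p _) (trans (+-cong
      (sum-zero (λ l → trans (*-congˡ (reflexive (⊞-ˡʳ M N l j))) (zeroʳ _)))
      (sum-cong (λ l → *-congˡ (reflexive (⊞-ʳʳ M N l j))))) (+-identityˡ _))

    ⊞-∙ˡ : ∀ {n} i (X : Mat (p ℕ.+ q) n) → (M ⊞ N) (i ↑ˡ q) ∙ X ≋ M i ∙ (λ l → X (l ↑ˡ q))
    ⊞-∙ˡ i X j = trans (sum-split p _) (trans (+-cong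
      (sum-cong (λ l → *-congʳ (reflexive (⊞-ˡˡ M N i l))))
      (sum-zero (λ l → trans (*-congʳ (reflexive (⊞-ˡʳ M N i l))) (zeroˡ _)))) (+-identityʳ _))

    ⊞-∙ʳ : ∀ {n} i (X : Mat (p ℕ.+ q) n) → (M ⊞ N) (p ↑ʳ i) ∙ X ≋ N i ∙ (λ l → X (p ↑ʳ l))
    ⊞-∙ʳ i X j = trans (sum-split p _) (trans (+-cong
      (sum-zero (λ l → trans (*-congʳ (reflexive (⊞-ʳˡ M N i l))) (zeroˡ _)))
      (sum-cong (λ l → *-congʳ (reflexive (⊞-ʳʳ M N i l))))) (+-identityˡ _))

  ⊞-unique : ∀ {p q} (X : Mat (p ℕ.+ q) (p ℕ.+ q)) (M : Mat p p) (N : Mat q q) →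
    (∀ i j → X (i ↑ˡ q) (j ↑ˡ q) ≈ M i j) → (∀ i j → X (i ↑ˡ q) (p ↑ʳ j) ≈ 0#) →
    (∀ i j → X (p ↑ʳ i) (j ↑ˡ q) ≈ 0#) → (∀ i j → X (p ↑ʳ i) (p ↑ʳ j) ≈ N i j) → X ≈ₘ M ⊞ N
  ⊞-unique {p} X M N ll lr rl rr = ⊞-elim {p = p} (λ i j → X i j ≈ (M ⊞ N) i j)
    (λ i j → trans (ll i j) (reflexive (≡.sym (⊞-ˡˡ M N i j))))
    (λ i j → trans (lr i j) (reflexive (≡.sym (⊞-ˡʳ M N i j))))
    (λ i j → trans (rl i j) (reflexive (≡.sym (⊞-ʳˡ M N i j))))
    (λ i j → trans (rr i j) (reflexive (≡.sym (⊞-ʳʳ M N i j))))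

  ⊞-cong : ∀ {p q} {M M′ : Mat p p} {N N′ : Mat q q} → M ≈ₘ M′ → N ≈ₘ N′ → M ⊞ N ≈ₘ M′ ⊞ N′
  ⊞-cong {M = M} {M′} {N} {N′} e f = ⊞-unique (M ⊞ N) M′ N′
    (λ i j → trans (reflexive (⊞-ˡˡ M N i j)) (e i j))
    (λ i j → reflexive (⊞-ˡʳ M N i j))
    (λ i j → reflexive (⊞-ʳˡ M N i j))
    (λ i j → trans (reflexive (⊞-ʳʳ M N i j)) (f i j))

  ⊞-⋆ : ∀ {p q} (M M′ : Mat p p) (N N′ : Mat q q) → (M ⊞ N) ⋆ (M′ ⊞ N′) ≈ₘ (M ⋆ M′) ⊞ (N ⋆ N′)
  ⊞-⋆ {p} {q} M M′ N N′ = ⊞-unique _ _ _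
    (λ i j → trans (⊞-∙ˡ M N i (M′ ⊞ N′) (j ↑ˡ q)) (sum-cong λ l → *-congˡ (reflexive (⊞-ˡˡ M′ N′ l j))))
    (λ i j → trans (⊞-∙ˡ M N i (M′ ⊞ N′) (p ↑ʳ j)) (sum-zero λ l → trans (*-congˡ (reflexive
        (⊞-ˡʳ M′ N′ l j))) (zeroʳ _)))
    (λ i j → trans (⊞-∙ʳ M N i (M′ ⊞ N′) (j ↑ˡ q)) (sum-zero λ l → trans (*-congˡ (reflexive
        (⊞-ʳˡ M′ N′ l j))) (zeroʳ _)))
    (λ i j → trans (⊞-∙ʳ M N i (M′ ⊞ N′) (p ↑ʳ j)) (sum-cong λ l → *-congˡ (reflexive (⊞-ʳʳ M′ N′ l j))))

  1ₘ-injective : ∀ {m n} (f : Fin m → Fin n) → (∀ {i j} → f i ≡ f j → i ≡ j) →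
               ∀ i j → 1ₘ (f i) (f j) ≈ 1ₘ i j
  1ₘ-injective f inj i j with i Fin.≟ j | f i Fin.≟ f j
  ... | yes _  | yes _ = refl
  ... | no _   | no _  = refl
  ... | yes e  | no ¬e with () ← ¬e (≡.cong f e)
  ... | no ¬e  | yes e with () ← ¬e (inj e)

  1ₘ-⊞ : ∀ p q → 1ₘ {p} ⊞ 1ₘ {q} ≈ₘ 1ₘ
  1ₘ-⊞ p q i j = sym (⊞-unique {p} {q} 1ₘ 1ₘ 1ₘ
    (1ₘ-injective (_↑ˡ q) (Fin.↑ˡ-injective q _ _))
    (λ i j → off-diagonal (i ↑ˡ q) (p ↑ʳ j) (λ e → contra i j (≡.trans (≡.sym (Fin.splitAt-↑ˡ p i q))
        (≡.trans (≡.cong (splitAt p) e) (Fin.splitAt-↑ʳ p q j)))))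
    (λ i j → off-diagonal (p ↑ʳ i) (j ↑ˡ q) (λ e → contra j i (≡.trans (≡.sym (Fin.splitAt-↑ˡ p j q))
        (≡.trans (≡.cong (splitAt p) (≡.sym e)) (Fin.splitAt-↑ʳ p q i)))))
    (1ₘ-injective (p ↑ʳ_) (Fin.↑ʳ-injective p _ _)) i j)
    where
    contra : ∀ {n m} (i : Fin n) (j : Fin m) → ¬ inj₁ i ≡ inj₂ j
    contra i j ()
    off-diagonal : ∀ {n} (i j : Fin n) → ¬ i ≡ j → 1ₘ i j ≈ 0#
    off-diagonal i j i≢j with i Fin.≟ j
    ... | yes e with () ← i≢j e
    ... | no _ = refl

-- Matrices under a ring homomorphism

module MatrixMap {c′ ℓ′} (R : CommutativeRing c ℓ) (R′ : CommutativeRing c′ ℓ′)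
  {φ : CommutativeRing.Carrier R → CommutativeRing.Carrier R′}
  (φ-homo : RingMorphisms.IsRingHomomorphism (CommutativeRing.rawRing R) (CommutativeRing.rawRing R′) φ) where
  open RingMorphisms.IsRingHomomorphism φ-homo
  private
    module R = CommutativeRing R
    module R′ = CommutativeRing R′
    module M = Matrices R
  open Matrices R′

  mapₘ : ∀ {m n} → M.Mat m n → Mat m n
  mapₘ M i j = φ (M i j)

  map-sum : ∀ {n} (f : M.Vector n) → φ (M.sum f) R′.≈ sum (λ i → φ (f i))
  map-sum {zero}  f = 0#-homo
  map-sum {suc n} f = R′.trans (+-homo _ _) (R′.+-congˡ (map-sum (f ∘ suc)))

  map-⋆ : ∀ {m n p} (M : M.Mat m n) (N : M.Mat n p) → mapₘ (M M.⋆ N) ≈ₘ mapₘ M ⋆ mapₘ N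
  map-⋆ M N i j = R′.trans (map-sum (λ l → M i l R.* N l j)) (sum-cong (λ l → *-homo (M i l) (N l j)))

  map-cong : ∀ {m n} {M N : M.Mat m n} → M M.≈ₘ N → mapₘ M ≈ₘ mapₘ N
  map-cong p i j = ⟦⟧-cong (p i j)

  map-1ₘ : ∀ {n} → mapₘ (M.1ₘ {n}) ≈ₘ 1ₘ
  map-1ₘ i j with i Fin.≟ j
  ... | yes _ = 1#-homo
  ... | no _  = 0#-homo

  map-inverse : ∀ {n} {A B : M.Mat n n} → A M.⋆ B M.≈ₘ M.1ₘ → mapₘ A ⋆ mapₘ B ≈ₘ 1ₘ
  map-inverse {A = A} {B} p = begin
    mapₘ A ⋆ mapₘ B    ≈⟨ map-⋆ A B ⟨
    mapₘ (A M.⋆ B)     ≈⟨ map-cong p ⟩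
    mapₘ M.1ₘ          ≈⟨ map-1ₘ ⟩
    1ₘ                 ∎
    where open ⋆-Reasoning

  -- This is how invertible matrices over k[[z]] and over k((z²)) are recovered from matrices over
  -- k((z)): the product of the preimages is compared with the identity after applying the injective
  -- φ.
  reflect-inverse : (∀ {x y} → φ x R′.≈ φ y → x R.≈ y) → ∀ {n} (A B : M.Mat n n) {A′ B′ : Mat n n} →
                    A′ ≈ₘ mapₘ A → B′ ≈ₘ mapₘ B → A′ ⋆ B′ ≈ₘ 1ₘ → A M.⋆ B M.≈ₘ M.1ₘ
  reflect-inverse injective A B {A′} {B′} p q r i j = injective (eq i j)
    where
    open ⋆-Reasoning
    eq : mapₘ (A M.⋆ B) ≈ₘ mapₘ M.1ₘ
    eq = begin
      mapₘ (A M.⋆ B)     ≈⟨ map-⋆ A B ⟩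
      mapₘ A ⋆ mapₘ B    ≈⟨ ⋆-cong p q ⟨
      A′ ⋆ B′            ≈⟨ r ⟩
      1ₘ                 ≈⟨ map-1ₘ ⟨
      mapₘ M.1ₘ          ∎

-- The valuation ring and the involution

-- What is needed of k⸨z⸩: the automorphism σ : z ↦ - z, whose fixed
-- field is k⸨z²⸩, and k⟦z⟧, as the predicate Integral.
record Conjugation (K : CommutativeRing c ℓ) i : Set (c ⊔ ℓ ⊔ lsuc i) where
  open CommutativeRing K
  open RingMorphisms rawRing rawRing using (IsRingHomomorphism)
  open Algebra.Properties.Semiring.Exp semiring using (_^_)
  field
    σ          : Carrier → Carrier
    σ-homo     : IsRingHomomorphism σ
    σ-involutive : ∀ x → σ (σ x) ≈ x
    z z⁻¹      : Carrier
    z*z⁻¹≈1    : z * z⁻¹ ≈ 1#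
    σz≈-z      : σ z ≈ - z
    ½          : Carrier
    ½+½≈1      : ½ + ½ ≈ 1#
    Integral   : Carrier → Set i
    int-resp   : ∀ {x y} → x ≈ y → Integral x → Integral y
    int-+      : ∀ {x y} → Integral x → Integral y → Integral (x + y)
    int-*      : ∀ {x y} → Integral x → Integral y → Integral (x * y)
    int-neg    : ∀ {x} → Integral x → Integral (- x)
    int-0      : Integral 0#
    int-1      : Integral 1#
    int-σ      : ∀ {x} → Integral x → Integral (σ x)
    int-z      : Integral z
    int-½      : Integral ½
    -- The valuation ring is local with maximal ideal (z); this is the one question about series
    -- that is ever decided.
    int-dichotomy   : ∀ {x} → Integral x →
                      Integral (z⁻¹ * x) ⊎ ∃[ u ] Integral u × x * u ≈ 1#
    z⁻¹-nonintegral : ¬ Integral z⁻¹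
    -- σ is trivial on the residue field.
    σ-residual      : ∀ {x} → Integral x → Integral (z⁻¹ * (x - σ x))
    int-bounded     : ∀ x → ∃[ d ] Integral (z ^ d * x)

-- Units and nonunits of the valuation ring

module Lattices {i} (K : CommutativeRing c ℓ) (conjugation : Conjugation K i) where
  open CommutativeRing K hiding (zero)
  open Conjugation conjugation
  open RingMorphisms.IsRingHomomorphism σ-homo
    using () renaming (⟦⟧-cong to σ-cong; +-homo to σ-+; *-homo to σ-*; 1#-homo to σ-1)
  open Algebra.Properties.Semiring.Exp semiring using (_^_)
  open Algebra.Properties.Ring ring
  open IntegerSolver K
  open Matrices K
  open Relation.Binary.Reasoning.Setoid setoid

  σ½≈½ : σ ½ ≈ ½
  σ½≈½ = linear₂ (- σ ½) ½ ½+½≈1 (trans (sym (σ-+ ½ ½)) (trans (σ-cong ½+½≈1) σ-1))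
    (solve 2 (λ s h → s := h :+ :- s :* (h :+ h :- con (1 , 0)) :+ h :* (s :+ s :- con (1 , 0))) refl (σ ½) ½)

  z^*z⁻¹^≈1 : ∀ d → z ^ d * z⁻¹ ^ d ≈ 1#
  z^*z⁻¹^≈1 zero    = *-identityˡ 1#
  z^*z⁻¹^≈1 (suc d) = begin
    z * z ^ d * (z⁻¹ * z⁻¹ ^ d)
      ≈⟨ solve 4 (λ a b c d → a :* b :* (c :* d) := a :* c :* (b :* d)) refl z (z ^ d) z⁻¹ (z⁻¹ ^ d) ⟩
    z * z⁻¹ * (z ^ d * z⁻¹ ^ d)  ≈⟨ *-cong z*z⁻¹≈1 (z^*z⁻¹^≈1 d) ⟩
    1# * 1#                      ≈⟨ *-identityˡ 1# ⟩
    1#                           ∎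

  int-^ : ∀ d → Integral (z ^ d)
  int-^ zero    = int-1
  int-^ (suc d) = int-* int-z (int-^ d)

  int-sum : ∀ {n} {f : Vector n} → (∀ l → Integral (f l)) → Integral (sum f)
  int-sum {zero}  p = int-0
  int-sum {suc n} p = int-+ (p zero) (int-sum (p ∘ suc))

  int-1ₘ : ∀ {n} (i j : Fin n) → Integral (1ₘ i j)
  int-1ₘ i j with i Fin.≟ j
  ... | yes _ = int-1
  ... | no _  = int-0

  Integralₘ : ∀ {m n} → Mat m n → Set i
  Integralₘ M = ∀ i j → Integral (M i j)

  int-⋆ : ∀ {m n p} {M : Mat m n} {N : Mat n p} → Integralₘ M → Integralₘ N → Integralₘ (M ⋆ N)
  int-⋆ p q i j = int-sum λ l → int-* (p i l) (q l j)

  int-⊞ : ∀ {p q} {M : Mat p p} {N : Mat q q} → Integralₘ M → Integralₘ N → Integralₘ (M ⊞ N)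
  int-⊞ {p} {M = M} {N} e f = ⊞-elim {p = p} (λ i j → Integral ((M ⊞ N) i j))
    (λ i j → int-resp (reflexive (≡.sym (⊞-ˡˡ M N i j))) (e i j))
    (λ i j → int-resp (reflexive (≡.sym (⊞-ˡʳ M N i j))) int-0)
    (λ i j → int-resp (reflexive (≡.sym (⊞-ʳˡ M N i j))) int-0)
    (λ i j → int-resp (reflexive (≡.sym (⊞-ʳʳ M N i j))) (f i j))

  -- `Nonunit` is membership in the maximal ideal (z), stated by an integral quotient and not as a
  -- negation, so that closure under sums and products is a direct computation. A congruence modulo
  -- z is written as `Nonunit` of a difference.
  Nonunit Unit : Carrier → Set _
  Nonunit x = Integral (z⁻¹ * x)
  Unit x = ∃[ u ] Integral u × x * u ≈ 1#

  nonunit-resp : ∀ {x y} → x ≈ y → Nonunit x → Nonunit y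
  nonunit-resp e = int-resp (*-congˡ e)

  nonunit-+ : ∀ {x y} → Nonunit x → Nonunit y → Nonunit (x + y)
  nonunit-+ p q = int-resp (sym (distribˡ _ _ _)) (int-+ p q)

  nonunit-* : ∀ {x y} → Nonunit x → Integral y → Nonunit (x * y)
  nonunit-* p q = int-resp (*-assoc _ _ _) (int-* p q)

  nonunit-*ˡ : ∀ {x y} → Integral x → Nonunit y → Nonunit (x * y)
  nonunit-*ˡ p q = nonunit-resp (*-comm _ _) (nonunit-* q p)

  nonunit-0 : Nonunit 0#
  nonunit-0 = int-resp (sym (zeroʳ _)) int-0

  nonunit-neg : ∀ {x} → Nonunit x → Nonunit (- x)
  nonunit-neg p = int-resp (-‿distribʳ-* _ _) (int-neg p)

  -- With y = z⁻¹ x, applying σ to z y = x gives - z σ(y) = σ(x), so the quotient of σ(x) by z is -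
  -- σ(y).
  nonunit-σ : ∀ {x} → Nonunit x → Nonunit (σ x)
  nonunit-σ {x} p = int-resp eq (int-neg (int-σ p))
    where
    eq : - σ (z⁻¹ * x) ≈ z⁻¹ * σ x
    eq = linear₃ (σ (z⁻¹ * x)) z⁻¹ (- (z⁻¹ * σ (z⁻¹ * x))) z*z⁻¹≈1
      (trans (sym (σ-* z (z⁻¹ * x))) (σ-cong (trans (sym (*-assoc z z⁻¹ x)) (trans (*-congʳ z*z⁻¹≈1)
          (*-identityˡ x)))))
      σz≈-z
      (solve 5 (λ z⁻¹ z σz y σx → :- y := z⁻¹ :* σx :+ y :* (z :* z⁻¹ :- con (1 , 0))
          :+ z⁻¹ :* (σz :* y :- σx) :+ :- (z⁻¹ :* y) :* (σz :- :- z))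
        refl z⁻¹ z (σ z) (σ (z⁻¹ * x)) (σ x))

  nonunit-z^ : ∀ d → Nonunit (z ^ suc d)
  nonunit-z^ d = int-resp eq (int-^ d)
    where
    eq : z ^ d ≈ z⁻¹ * (z * z ^ d)
    eq = linear₁ (- (z ^ d)) z*z⁻¹≈1
      (solve 3 (λ a b c → c := b :* (a :* c) :+ :- c :* (a :* b :- con (1 , 0))) refl z z⁻¹ (z ^ d))

  nonunit-unit : ∀ {x} → Nonunit x → Unit x → ⊥
  nonunit-unit p (u , u-int , xu≈1) =
    z⁻¹-nonintegral (int-resp (trans (*-assoc _ _ _) (trans (*-congˡ xu≈1) (*-identityʳ _))) (int-* p u-int))

  unit-1 : Unit 1#
  unit-1 = 1# , int-1 , *-identityˡ 1#

-- Cocycles, changes of basis, and the cocycles of the blocks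

module Reduction {i} (K : CommutativeRing c ℓ) (conjugation : Conjugation K i) where
  open CommutativeRing K hiding (zero)
  open Conjugation conjugation
  open RingMorphisms.IsRingHomomorphism σ-homo
    using () renaming (⟦⟧-cong to σ-cong; *-homo to σ-*; 0#-homo to σ-0; 1#-homo to σ-1; -‿homo to σ-neg)
  open Algebra.Properties.Semiring.Exp semiring using (_^_)
  open Algebra.Properties.Ring ring
  open IntegerSolver K
  open Matrices K
  open Lattices K conjugation

  σᵥ : ∀ {n} → Vector n → Vector n
  σᵥ v i = σ (v i)

  open MatrixMap K K σ-homo public
    renaming (mapₘ to σₘ; map-⋆ to σ-⋆; map-cong to σₘ-cong; map-1ₘ to σ-1ₘ; map-inverse to σ-inverse)
    using ()

  σₘ-involutive : ∀ {m n} (M : Mat m n) → σₘ (σₘ M) ≈ₘ M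
  σₘ-involutive M i j = σ-involutive (M i j)

  σ-⊞ : ∀ {p q} (M : Mat p p) (N : Mat q q) → σₘ (M ⊞ N) ≈ₘ σₘ M ⊞ σₘ N
  σ-⊞ M N = ⊞-unique _ _ _
    (λ i j → σ-cong (reflexive (⊞-ˡˡ M N i j)))
    (λ i j → trans (σ-cong (reflexive (⊞-ˡʳ M N i j))) σ-0)
    (λ i j → trans (σ-cong (reflexive (⊞-ʳˡ M N i j))) σ-0)
    (λ i j → σ-cong (reflexive (⊞-ʳʳ M N i j)))

  int-σₘ : ∀ {m n} {M : Mat m n} → Integralₘ M → Integralₘ (σₘ M)
  int-σₘ p i j = int-σ (p i j)

  -- T is the matrix of σ in a basis of a lattice: σ(g) = T g.
  IsCocycle : ∀ {n} → Mat n n → Set ℓ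
  IsCocycle T = σₘ T ⋆ T ≈ₘ 1ₘ

  cocycle-flip : ∀ {n} (T : Mat n n) → IsCocycle T → T ⋆ σₘ T ≈ₘ 1ₘ
  cocycle-flip T p = begin
    T ⋆ σₘ T             ≈⟨ ⋆-cong (σₘ-involutive T) ≈ₘ.refl ⟨
    σₘ (σₘ T) ⋆ σₘ T     ≈⟨ σ-inverse p ⟩
    1ₘ                   ∎
    where open ⋆-Reasoning

  record IntegralGL (n : ℕ) : Set (c ⊔ ℓ ⊔ i) where
    field
      matrix inverse : Mat n n
      matrix-int     : Integralₘ matrix
      inverse-int    : Integralₘ inverse
      inverseˡ       : inverse ⋆ matrix ≈ₘ 1ₘ
      inverseʳ       : matrix ⋆ inverse ≈ₘ 1ₘ
  open IntegralGL

  -- The matrix of σ in the basis α g: σ(α g) = σ(α) T g = (σ(α) T α⁻¹) α g.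
  conjugate : ∀ {n} → IntegralGL n → Mat n n → Mat n n
  conjugate α T = σₘ (matrix α) ⋆ T ⋆ inverse α

  conjugate-cocycle : ∀ {n} (α : IntegralGL n) (T : Mat n n) → IsCocycle T → IsCocycle (conjugate α T)
  conjugate-cocycle α T p = begin
    σₘ (σₘ a ⋆ T ⋆ a⁻¹) ⋆ (σₘ a ⋆ T ⋆ a⁻¹)
      ≈⟨ ⋆-cong (≈ₘ.trans (σ-⋆ (σₘ a ⋆ T) a⁻¹) (⋆-cong (≈ₘ.trans (σ-⋆ (σₘ a) T) (⋆-cong
          (σₘ-involutive a) ≈ₘ.refl)) ≈ₘ.refl))
                (⋆-assoc (σₘ a) T a⁻¹) ⟩
    a ⋆ σₘ T ⋆ σₘ a⁻¹ ⋆ (σₘ a ⋆ (T ⋆ a⁻¹))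
      ≈⟨ ⋆-assoc (a ⋆ σₘ T) (σₘ a⁻¹) _ ⟩
    a ⋆ σₘ T ⋆ (σₘ a⁻¹ ⋆ (σₘ a ⋆ (T ⋆ a⁻¹)))
      ≈⟨ ⋆-cong ≈ₘ.refl (⋆-cancelˡ (T ⋆ a⁻¹) (σ-inverse (inverseˡ α))) ⟩
    a ⋆ σₘ T ⋆ (T ⋆ a⁻¹)
      ≈⟨ inverse-⋆ {A = a} {a⁻¹} {σₘ T} {T} (inverseʳ α) p ⟩
    1ₘ ∎
    where
    open ⋆-Reasoning
    a = matrix α
    a⁻¹ = inverse α

  -- A further basis C of K^n, as good as g, in which σ has the same
  -- matrix, and whose lattice is spanned by the rows of B.
  record Solution {n} (B T : Mat n n) : Set (c ⊔ ℓ ⊔ i) where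
    field
      a       : IntegralGL n
      C C⁻¹   : Mat n n
      C⁻¹⋆C≈1 : C⁻¹ ⋆ C ≈ₘ 1ₘ
      C⋆C⁻¹≈1 : C ⋆ C⁻¹ ≈ₘ 1ₘ
      aC≈B    : matrix a ⋆ C ≈ₘ B
      σC≈TC   : σₘ C ≈ₘ T ⋆ C

  solution-resp : ∀ {n} {B T T′ : Mat n n} → T ≈ₘ T′ → Solution B T → Solution B T′
  solution-resp p s = record { Solution s ; σC≈TC = ≈ₘ.trans σC≈TC (⋆-cong p ≈ₘ.refl) }
    where open Solution s

  _∘GL_ : ∀ {n} → IntegralGL n → IntegralGL n → IntegralGL n
  α ∘GL β = record
    { matrix = matrix α ⋆ matrix β
    ; inverse = inverse β ⋆ inverse α
    ; matrix-int = int-⋆ (matrix-int α) (matrix-int β)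
    ; inverse-int = int-⋆ (inverse-int β) (inverse-int α)
    ; inverseˡ = inverse-⋆ (inverseˡ β) (inverseˡ α)
    ; inverseʳ = inverse-⋆ (inverseʳ α) (inverseʳ β)
    }

  -- A basis `C` found after the change of basis α is carried back by α⁻¹, and α is absorbed into
  -- the integral factor, so `B` stays the same.
  solution-conjugate : ∀ {n} {B T : Mat n n} (α : IntegralGL n) → Solution B (conjugate α T) → Solution B T
  solution-conjugate {n} {B} {T} α s = record
    { a = a ∘GL α
    ; C = inverse α ⋆ C
    ; C⁻¹ = C⁻¹ ⋆ matrix α
    ; C⁻¹⋆C≈1 = inverse-⋆ C⁻¹⋆C≈1 (inverseʳ α)
    ; C⋆C⁻¹≈1 = inverse-⋆ (inverseˡ α) C⋆C⁻¹≈1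
    ; aC≈B = begin
        matrix a ⋆ matrix α ⋆ (inverse α ⋆ C)   ≈⟨ ⋆-assoc (matrix a) (matrix α) _ ⟩
        matrix a ⋆ (matrix α ⋆ (inverse α ⋆ C)) ≈⟨ ⋆-cong ≈ₘ.refl (⋆-cancelˡ C (inverseʳ α)) ⟩
        matrix a ⋆ C                            ≈⟨ aC≈B ⟩
        B                                       ∎
    ; σC≈TC = begin
        σₘ (inverse α ⋆ C)
          ≈⟨ σ-⋆ (inverse α) C ⟩
        σₘ (inverse α) ⋆ σₘ C
          ≈⟨ ⋆-cong ≈ₘ.refl (≈ₘ.trans σC≈TC (≈ₘ.trans (⋆-assoc (σₘ (matrix α) ⋆ T) (inverse α) C) (⋆-assoc
              (σₘ (matrix α)) T _))) ⟩
        σₘ (inverse α) ⋆ (σₘ (matrix α) ⋆ (T ⋆ (inverse α ⋆ C)))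
          ≈⟨ ⋆-cancelˡ _ (σ-inverse (inverseˡ α)) ⟩
        T ⋆ (inverse α ⋆ C) ∎
    }
    where
    open Solution s
    open ⋆-Reasoning

  ⊞-inverse : ∀ {p q} {A A′ : Mat p p} {B B′ : Mat q q} → A ⋆ A′ ≈ₘ 1ₘ → B ⋆ B′ ≈ₘ 1ₘ → (A ⊞ B) ⋆ (A′ ⊞ B′) ≈ₘ 1ₘ
  ⊞-inverse {p} {q} {A} {A′} {B} {B′} e f = ≈ₘ.trans (⊞-⋆ A A′ B B′) (≈ₘ.trans (⊞-cong e f) (1ₘ-⊞ p q))

  _⊞GL_ : ∀ {p q} → IntegralGL p → IntegralGL q → IntegralGL (p ℕ.+ q)
  α ⊞GL β = record
    { matrix = matrix α ⊞ matrix β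
    ; inverse = inverse α ⊞ inverse β
    ; matrix-int = int-⊞ (matrix-int α) (matrix-int β)
    ; inverse-int = int-⊞ (inverse-int α) (inverse-int β)
    ; inverseˡ = ⊞-inverse (inverseˡ α) (inverseˡ β)
    ; inverseʳ = ⊞-inverse (inverseʳ α) (inverseʳ β)
    }

  solution-⊞ : ∀ {p q} {B P : Mat p p} {B′ R : Mat q q} → Solution B P → Solution B′ R → Solution (B ⊞ B′) (P ⊞ R)
  solution-⊞ {P = P} {R = R} s t = record
    { a = S.a ⊞GL T.a
    ; C = S.C ⊞ T.C
    ; C⁻¹ = S.C⁻¹ ⊞ T.C⁻¹
    ; C⁻¹⋆C≈1 = ⊞-inverse S.C⁻¹⋆C≈1 T.C⁻¹⋆C≈1
    ; C⋆C⁻¹≈1 = ⊞-inverse S.C⋆C⁻¹≈1 T.C⋆C⁻¹≈1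
    ; aC≈B = ≈ₘ.trans (⊞-⋆ (matrix S.a) S.C (matrix T.a) T.C) (⊞-cong S.aC≈B T.aC≈B)
    ; σC≈TC = ≈ₘ.trans (σ-⊞ S.C T.C) (≈ₘ.trans (⊞-cong S.σC≈TC T.σC≈TC) (≈ₘ.sym (⊞-⋆ P S.C R T.C)))
    }
    where
    module S = Solution s
    module T = Solution t

  matrix₂ : (x y z w : Carrier) → Mat 2 2
  matrix₂ x y z w zero    zero    = x
  matrix₂ x y z w zero    (suc _) = y
  matrix₂ x y z w (suc _) zero    = z
  matrix₂ x y z w (suc _) (suc _) = w

  block : (b : Block) → Mat (size b) (size b)
  block ⟨1⟩         = λ _ _ → 1#
  block ⟨z⟩         = λ _ _ → z
  block (upper n _) = matrix₂ 1# z 0# (z ^ n)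

  blockDiagonal : ∀ {n} → Blocks n → Mat n n
  blockDiagonal []       = λ ()
  blockDiagonal (b ∷ bs) = block b ⊞ blockDiagonal bs

  Solvable : ∀ {n} → Mat n n → Set _
  Solvable {n} T = Σ[ bs ∈ Blocks n ] Solution (blockDiagonal bs) T

  cocycle-⊞ʳ : ∀ {p q} (P : Mat p p) (R : Mat q q) → IsCocycle (P ⊞ R) → IsCocycle R
  cocycle-⊞ʳ {p} P R e i j = begin
    (σₘ R ⋆ R) i j
      ≈⟨ reflexive (≡.sym (⊞-ʳʳ (σₘ P ⋆ P) (σₘ R ⋆ R) i j)) ⟩
    ((σₘ P ⋆ P) ⊞ (σₘ R ⋆ R)) (p ↑ʳ i) (p ↑ʳ j)
      ≈⟨ ⊞-⋆ (σₘ P) P (σₘ R) R (p ↑ʳ i) (p ↑ʳ j) ⟨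
    ((σₘ P ⊞ σₘ R) ⋆ (P ⊞ R)) (p ↑ʳ i) (p ↑ʳ j)
      ≈⟨ ⋆-cong (≈ₘ.sym (σ-⊞ P R)) (≈ₘ.refl {x = P ⊞ R}) (p ↑ʳ i) (p ↑ʳ j) ⟩
    (σₘ (P ⊞ R) ⋆ (P ⊞ R)) (p ↑ʳ i) (p ↑ʳ j)
      ≈⟨ e (p ↑ʳ i) (p ↑ʳ j) ⟩
    1ₘ (p ↑ʳ i) (p ↑ʳ j)
      ≈⟨ 1ₘ-injective (p ↑ʳ_) (Fin.↑ʳ-injective p _ _) i j ⟩
    1ₘ i j ∎
    where open Relation.Binary.Reasoning.Setoid setoid

  -- One step of the induction on the dimension. The complement inherits the cocycle condition,
  -- because products of block sums are computed blockwise; so the induction hypothesis applies to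
  -- `R`.
  solve-⊞ : ∀ b {q} {P : Mat (size b) (size b)} {R : Mat q q} {T : Mat (size b ℕ.+ q) (size b ℕ.+ q)} →
            Solution (block b) P → T ≈ₘ P ⊞ R → IsCocycle T → (IsCocycle R → Solvable R) → Solvable T
  solve-⊞ b {P = P} {R} {T} s T≈P⊞R cocycle solve-R =
    let bs , t = solve-R (cocycle-⊞ʳ P R (≈ₘ.trans (⋆-cong (σₘ-cong (≈ₘ.sym T≈P⊞R)) (≈ₘ.sym T≈P⊞R)) cocycle))
    in b ∷ bs , solution-resp (≈ₘ.sym T≈P⊞R) (solution-⊞ s t)

  identityGL : ∀ {n} → IntegralGL n
  identityGL = record
    { matrix = 1ₘ ; inverse = 1ₘ ; matrix-int = int-1ₘ ; inverse-int = int-1ₘ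
    ; inverseˡ = ⋆-identityˡ 1ₘ ; inverseʳ = ⋆-identityˡ 1ₘ }

  -- Used with x = 1, ε = 1 for the block (1) and with x = z, ε = - 1 for the block (z), since σ(z)
  -- = - z.
  solution₁ : ∀ {x y ε} → x * y ≈ 1# → σ x ≈ ε * x → Solution {1} (λ _ _ → x) (λ _ _ → ε)
  solution₁ {x} {y} {ε} xy≈1 σx≈εx = record
    { a = identityGL
    ; C = λ _ _ → x
    ; C⁻¹ = λ _ _ → y
    ; C⁻¹⋆C≈1 = λ { zero zero → trans (+-identityʳ _) (trans (*-comm y x) xy≈1) }
    ; C⋆C⁻¹≈1 = λ { zero zero → trans (+-identityʳ _) xy≈1 }
    ; aC≈B = ⋆-identityˡ _
    ; σC≈TC = λ _ _ → trans σx≈εx (sym (+-identityʳ _))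
    }

  ≈-matrix₂ : ∀ {M N : Mat 2 2} → M zero zero ≈ N zero zero → M zero (suc zero) ≈ N zero (suc zero) →
              M (suc zero) zero ≈ N (suc zero) zero → M (suc zero) (suc zero) ≈ N (suc zero) (suc zero) → M ≈ₘ N
  ≈-matrix₂ p q r s zero       zero       = p
  ≈-matrix₂ p q r s zero       (suc zero) = q
  ≈-matrix₂ p q r s (suc zero) zero       = r
  ≈-matrix₂ p q r s (suc zero) (suc zero) = s

  -- The lattice spanned by u = (1, z) and z^λ σ(u), for λ = d + 1; the
  -- rows of the block are u and ½ (z^λ u - z^λ σ(u)).
  solution₂ : ∀ d → Solution (matrix₂ 1# z 0# (z ^ suc (suc d))) (matrix₂ 0# (z⁻¹ ^ suc d) (σ (z ^ suc d)) 0#)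
  solution₂ d = record
    { a = record
      { matrix = matrix₂ 1# 0# (½ * Z) (- ½)
      ; inverse = matrix₂ 1# 0# Z (- (1# + 1#))
      ; matrix-int = λ
        { zero zero → int-1 ; zero (suc _) → int-0
        ; (suc _) zero → int-* int-½ (int-^ (suc d)) ; (suc _) (suc _) → int-neg int-½ }
      ; inverse-int = λ
        { zero zero → int-1 ; zero (suc _) → int-0
        ; (suc _) zero → int-^ (suc d) ; (suc _) (suc _) → int-neg (int-+ int-1 int-1) }
      ; inverseˡ = ≈-matrix₂
          (solve 2 (λ h Z → con (1 , 0) :* con (1 , 0) :+ (con (0 , 0) :* (h :* Z) :+ con (0 , 0)) := con
              (1 , 0)) refl ½ Z)
          (solve 1 (λ h → con (1 , 0) :* con (0 , 0) :+ (con (0 , 0) :* (:- h) :+ con (0 , 0)) := con (0 , 0)) refl ½)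
          (linear₁ (- Z) ½+½≈1 (solve 2 (λ h Z → Z :* con (1 , 0) :+ (:- (con (1 , 0) :+ con (1 , 0)) :*
              (h :* Z) :+ con (0 , 0))
            := con (0 , 0) :+ :- Z :* (h :+ h :- con (1 , 0))) refl ½ Z))
          (linear₁ 1# ½+½≈1 (solve 2 (λ h Z → Z :* con (0 , 0) :+ (:- (con (1 , 0) :+ con (1 , 0)) :* (:- h)
              :+ con (0 , 0))
            := con (1 , 0) :+ con (1 , 0) :* (h :+ h :- con (1 , 0))) refl ½ Z))
      ; inverseʳ = ≈-matrix₂
          (solve 1 (λ Z → con (1 , 0) :* con (1 , 0) :+ (con (0 , 0) :* Z :+ con (0 , 0)) := con (1 , 0)) refl Z)
          (solve 0 (con (1 , 0) :* con (0 , 0) :+ (con (0 , 0) :* (:- (con (1 , 0) :+ con (1 , 0))) :+ con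
              (0 , 0)) := con (0 , 0)) refl)
          (solve 2 (λ h Z → (h :* Z) :* con (1 , 0) :+ ((:- h) :* Z :+ con (0 , 0)) := con (0 , 0)) refl ½ Z)
          (linear₁ 1# ½+½≈1 (solve 2 (λ h Z → (h :* Z) :* con (0 , 0) :+ ((:- h) :* (:- (con (1 , 0) :+ con
              (1 , 0))) :+ con (0 , 0))
            := con (1 , 0) :+ con (1 , 0) :* (h :+ h :- con (1 , 0))) refl ½ Z))
      }
    ; C = matrix₂ 1# z Z (- (z * Z))
    ; C⁻¹ = matrix₂ ½ (½ * Z⁻¹) (½ * z⁻¹) (- (½ * z⁻¹ * Z⁻¹))
    ; C⁻¹⋆C≈1 = ≈-matrix₂
        (linear₂ ½ 1# ZZ⁻¹≈1 ½+½≈1 (solve 3 (λ h Z Y → h :* con (1 , 0) :+ (h :* Y :* Z :+ con (0 , 0))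
          := con (1 , 0) :+ h :* (Z :* Y :- con (1 , 0)) :+ con (1 , 0) :* (h :+ h :- con (1 , 0))) refl ½ Z Z⁻¹))
        (linear₁ (- (½ * z)) ZZ⁻¹≈1 (solve 4 (λ h Z Y z → h :* z :+ (h :* Y :* (:- (z :* Z)) :+ con (0 , 0))
          := con (0 , 0) :+ (:- (h :* z)) :* (Z :* Y :- con (1 , 0))) refl ½ Z Z⁻¹ z))
        (linear₁ (- (½ * z⁻¹)) ZZ⁻¹≈1 (solve 4 (λ h Z Y y → h :* y :* con (1 , 0) :+ ((:-
            (h :* y :* Y)) :* Z :+ con (0 , 0))
          := con (0 , 0) :+ (:- (h :* y)) :* (Z :* Y :- con (1 , 0))) refl ½ Z Z⁻¹ z⁻¹))
        (linear₃ (½ * z * z⁻¹) (½ + ½) 1# ZZ⁻¹≈1 z*z⁻¹≈1 ½+½≈1 (solve 5 (λ h Z Y z y → h :* y :* z :+ ((:-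
            (h :* y :* Y)) :* (:- (z :* Z)) :+ con (0 , 0))
          := con (1 , 0) :+ (h :* z :* y) :* (Z :* Y :- con (1 , 0)) :+ (h :+ h) :* (z :* y :- con (1 , 0))
              :+ con (1 , 0) :* (h :+ h :- con (1 , 0))) refl ½ Z Z⁻¹ z z⁻¹))
    ; C⋆C⁻¹≈1 = ≈-matrix₂
        (linear₂ ½ 1# z*z⁻¹≈1 ½+½≈1 (solve 3 (λ h z y → con (1 , 0) :* h :+ (z :* (h :* y) :+ con (0 , 0))
          := con (1 , 0) :+ h :* (z :* y :- con (1 , 0)) :+ con (1 , 0) :* (h :+ h :- con (1 , 0))) refl ½ z z⁻¹))
        (linear₁ (- (½ * Z⁻¹)) z*z⁻¹≈1 (solve 4 (λ h Y z y → con (1 , 0) :* (h :* Y) :+ (z :* (:-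
            (h :* y :* Y)) :+ con (0 , 0))
          := con (0 , 0) :+ (:- (h :* Y)) :* (z :* y :- con (1 , 0))) refl ½ Z⁻¹ z z⁻¹))
        (linear₁ (- (½ * Z)) z*z⁻¹≈1 (solve 4 (λ h Z z y → Z :* h :+ (:- (z :* Z) :* (h :* y) :+ con (0 , 0))
          := con (0 , 0) :+ (:- (h :* Z)) :* (z :* y :- con (1 , 0))) refl ½ Z z z⁻¹))
        (linear₃ (½ * Z * Z⁻¹) (½ + ½) 1# z*z⁻¹≈1 ZZ⁻¹≈1 ½+½≈1 (solve 5 (λ h Z Y z y → Z :* (h :* Y) :+ (:-
            (z :* Z) :* (:- (h :* y :* Y)) :+ con (0 , 0))
          := con (1 , 0) :+ (h :* Z :* Y) :* (z :* y :- con (1 , 0)) :+ (h :+ h) :* (Z :* Y :- con (1 , 0))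
              :+ con (1 , 0) :* (h :+ h :- con (1 , 0))) refl ½ Z Z⁻¹ z z⁻¹))
    ; aC≈B = ≈-matrix₂
        (solve 1 (λ Z → con (1 , 0) :* con (1 , 0) :+ (con (0 , 0) :* Z :+ con (0 , 0)) := con (1 , 0)) refl Z)
        (solve 2 (λ Z z → con (1 , 0) :* z :+ (con (0 , 0) :* (:- (z :* Z)) :+ con (0 , 0)) := z) refl Z z)
        (solve 2 (λ h Z → h :* Z :* con (1 , 0) :+ (:- h :* Z :+ con (0 , 0)) := con (0 , 0)) refl ½ Z)
        (linear₁ (z * Z) ½+½≈1 (solve 3 (λ h Z z → h :* Z :* z :+ (:- h :* (:- (z :* Z)) :+ con (0 , 0))
          := z :* Z :+ z :* Z :* (h :+ h :- con (1 , 0))) refl ½ Z z))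
    ; σC≈TC = ≈-matrix₂
        (trans σ-1 (linear₁ (- 1#) ZZ⁻¹≈1 (solve 2 (λ Z Y → con (1 , 0) := con (0 , 0) :* con (1 , 0) :+
            (Y :* Z :+ con (0 , 0))
          :+ :- con (1 , 0) :* (Z :* Y :- con (1 , 0))) refl Z Z⁻¹)))
        (trans σz≈-z (linear₁ z ZZ⁻¹≈1 (solve 3 (λ Z Y z → :- z := con (0 , 0) :* z :+ (Y :* (:- (z :* Z))
            :+ con (0 , 0))
          :+ z :* (Z :* Y :- con (1 , 0))) refl Z Z⁻¹ z)))
        (solve 2 (λ s Z → s := s :* con (1 , 0) :+ (con (0 , 0) :* Z :+ con (0 , 0))) refl (σ Z) Z)
        (trans (trans (σ-neg _) (-‿cong (trans (σ-* z Z) (*-congʳ σz≈-z))))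
          (solve 3 (λ s Z z → :- (:- z :* s) := s :* z :+ (con (0 , 0) :* (:- (z :* Z)) :+ con (0 , 0)))
              refl (σ Z) Z z))
    }
    where
    Z = z ^ suc d
    Z⁻¹ = z⁻¹ ^ suc d
    ZZ⁻¹≈1 = z^*z⁻¹^≈1 (suc d)

-- Existence: splitting off blocks

module Existence {i} (K : CommutativeRing c ℓ) (conjugation : Conjugation K i) where
  open CommutativeRing K hiding (zero)
  open Conjugation conjugation
  open RingMorphisms.IsRingHomomorphism σ-homo
    using () renaming (⟦⟧-cong to σ-cong; +-homo to σ-+; *-homo to σ-*; 0#-homo to σ-0; 1#-homo to σ-1; -‿homo to σ-neg)
  open Algebra.Properties.Semiring.Exp semiring using (_^_)
  open Algebra.Properties.Ring ring
  open IntegerSolver K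
  open Matrices K
  open Lattices K conjugation
  open Reduction K conjugation
  open IntegralGL
  open Relation.Binary.Reasoning.Setoid setoid

  1ₘ-diagonal : ∀ {n} (k : Fin n) → 1ₘ k k ≈ 1#
  1ₘ-diagonal k with k Fin.≟ k
  ... | yes _ = refl
  ... | no k≢k = ⊥-elim (k≢k ≡.refl)

  -- The basis vector `k` becomes `y` and the others stay. Here u · w = y k - 1, so the
  -- Sherman-Morrison formula for the inverse divides by 1 + u · w = y k; this is why that
  -- coordinate has to be a unit.
  replaceRow : ∀ {n} k (y : Vector n) → (∀ j → Integral (y j)) → Unit (y k) → IntegralGL n
  replaceRow {n} k y y-int (r , r-int , yr≈1) = record
    { matrix = shear w u
    ; inverse = shear w u′
    ; matrix-int = λ i j → int-+ (int-1ₘ i j) (int-* (int-1ₘ i k) (u-int j))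
    ; inverse-int = λ i j → int-+ (int-1ₘ i j) (int-* (int-1ₘ i k) (int-neg (int-* r-int (u-int j))))
    ; inverseˡ = shear-inverse w u′ u λ j → linear₃ (u j) (- u j) (r * u j) (∙-1ₘ u′ k) yr≈1 (1ₘ-diagonal k)
        (solve 5 (λ u r c y d → :- (r :* u) :+ u :+ c :* u :=
          con (0 , 0) :+ u :* (c :- :- (r :* (y :- d))) :+ :- u :* (y :* r :- con (1 , 0)) :+ r :* u :*
              (d :- con (1 , 0)))
          refl (u j) r (u′ · w) (y k) (1ₘ k k))
    ; inverseʳ = shear-inverse w u u′ λ j → linear₃ (- (r * u j)) (- u j) (r * u j) (∙-1ₘ u k) yr≈1 (1ₘ-diagonal k)
        (solve 5 (λ u r c y d → u :+ :- (r :* u) :+ c :* (:- (r :* u)) :=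
          con (0 , 0) :+ (:- (r :* u)) :* (c :- (y :- d)) :+ :- u :* (y :* r :- con (1 , 0)) :+ r :* u :*
              (d :- con (1 , 0)))
          refl (u j) r (u · w) (y k) (1ₘ k k))
    }
    where
    w u u′ : Vector n
    w l = 1ₘ l k
    u j = y j - 1ₘ k j
    u′ j = - (r * u j)
    u-int : ∀ j → Integral (u j)
    u-int j = int-+ (y-int j) (int-neg (int-1ₘ k j))

  replaceRow-row : ∀ {n} k (y : Vector n) p q → matrix (replaceRow k y p q) k ≋ y
  replaceRow-row k y p q j = linear₁ (y j - 1ₘ k j) (1ₘ-diagonal k)
    (solve 3 (λ e d y → e :+ d :* (y :- e) := y :+ (y :- e) :* (d :- con (1 , 0))) refl (1ₘ k j) (1ₘ k k) (y j))

  -- The condition `w k ≈ 0#` makes the rank one part square to zero, so changing its sign inverts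
  -- the matrix. In terms of bases, `w i` times vector `k` is added to vector `i`.
  transvection : ∀ {n} k (w : Vector n) → (∀ l → Integral (w l)) → w k ≈ 0# → IntegralGL n
  transvection {n} k w w-int wₖ≈0 = record
    { matrix = shear w (1ₘ k)
    ; inverse = shear w -1ₘk
    ; matrix-int = λ i j → int-+ (int-1ₘ i j) (int-* (w-int i) (int-1ₘ k j))
    ; inverse-int = λ i j → int-+ (int-1ₘ i j) (int-* (w-int i) (int-* (int-neg int-1) (int-1ₘ k j)))
    ; inverseˡ = shear-inverse w -1ₘk (1ₘ k) λ j → linear₂ (1ₘ k j) (- 1ₘ k j) (·-scale (- 1#) (1ₘ k) w) 1ₘk·w≈0
        (solve 3 (λ e c c′ → :- con (1 , 0) :* e :+ e :+ c′ :* e :=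
           con (0 , 0) :+ e :* (c′ :- :- con (1 , 0) :* c) :+ (:- e) :* (c :- con (0 , 0))) refl (1ₘ k j)
               (1ₘ k · w) (-1ₘk · w))
    ; inverseʳ = shear-inverse w (1ₘ k) -1ₘk λ j → linear₁ (- 1ₘ k j) 1ₘk·w≈0
        (solve 2 (λ e c → e :+ :- con (1 , 0) :* e :+ c :* (:- con (1 , 0) :* e) :=
           con (0 , 0) :+ (:- e) :* (c :- con (0 , 0))) refl (1ₘ k j) (1ₘ k · w))
    }
    where
    -1ₘk : Vector n
    -1ₘk j = - 1# * 1ₘ k j
    1ₘk·w≈0 : 1ₘ k · w ≈ 0#
    1ₘk·w≈0 = trans (1ₘ-∙ {n = 1} k (λ l _ → w l) zero) wₖ≈0

  -- The row operation adds σ(w i) times row k to row i, and the inverse column operation changes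
  -- column k only. Hence another column can be cleared by row operations alone.
  conjugate-transvection : ∀ {n} k w p q (T : Mat n n) i →
    let v = λ j → T i j + σ (w i) * T k j in
    conjugate (transvection k w p q) T i ≋ λ j → v j + (v · w) * (- 1# * 1ₘ k j)
  conjugate-transvection {n} k w p q T i j =
    trans (∙-cong {N = shear w (λ j → - 1# * 1ₘ k j)} row ≈ₘ.refl j) (∙-shear v w (λ j → - 1# * 1ₘ k j) j)
    where
    v : Vector n
    v j = T i j + σ (w i) * T k j
    row : σᵥ (shear w (1ₘ k) i) ∙ T ≋ v
    row j = begin
      (σᵥ (shear w (1ₘ k) i) ∙ T) j
        ≈⟨ ∙-cong {N = T} (λ l → trans (σ-+ _ _) (+-cong (σ-1ₘ i l) (trans (σ-* _ _) (*-congˡ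
            (σ-1ₘ k l))))) ≈ₘ.refl j ⟩
      ((λ l → 1ₘ i l + σ (w i) * 1ₘ k l) ∙ T) j
        ≈⟨ ∙-distribʳ (1ₘ i) (λ l → σ (w i) * 1ₘ k l) T j ⟩
      (1ₘ i ∙ T) j + ((λ l → σ (w i) * 1ₘ k l) ∙ T) j
        ≈⟨ +-cong (1ₘ-∙ i T j) (trans (∙-scale (σ (w i)) (1ₘ k) T j) (*-congˡ (1ₘ-∙ k T j))) ⟩
      v j ∎

  -- The hypothesis, written in the old coordinates, is that σ sends the new basis vector i to x
  -- times the new basis vector j.
  conjugate-row : ∀ {n} (α : IntegralGL n) (T : Mat n n) i j x →
    σᵥ (matrix α i) ∙ T ≋ (λ l → x * matrix α j l) → conjugate α T i ≋ λ l → x * 1ₘ j l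
  conjugate-row α T i j x p l = begin
    ((σᵥ (matrix α i) ∙ T) ∙ inverse α) l       ≈⟨ ∙-cong {N = inverse α} p ≈ₘ.refl l ⟩
    ((λ l → x * matrix α j l) ∙ inverse α) l    ≈⟨ ∙-scale x (matrix α j) (inverse α) l ⟩
    x * (matrix α j ∙ inverse α) l              ≈⟨ *-congˡ (inverseʳ α j l) ⟩
    x * 1ₘ j l                                  ∎

  int-scaledˡ : ∀ {m n} x (v : Vector m) (M : Mat m n) → (∀ l → Integral (x * v l)) → Integralₘ M → ∀ j →
      Integral (x * (v ∙ M) j)
  int-scaledˡ x v M p q j = int-resp (∙-scale x v M j) (int-sum λ l → int-* (p l) (q l j))

  int-scaledʳ : ∀ {m n} x (v : Vector m) (M : Mat m n) → (∀ l → Integral (v l)) → (∀ l j → Integral (x * M l j)) →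
                ∀ j → Integral (x * (v ∙ M) j)
  int-scaledʳ x v M p q j = int-resp (sym (*-distribˡ-sum x (λ l → v l * M l j))) (int-sum λ l → int-resp
    (solve 3 (λ x v m → v :* (x :* m) := x :* (v :* m)) refl x (v l) (M l j)) (int-* (p l) (q l j)))

  -- Both outer factors of the conjugate are integral, so a bound for the poles of `T` belongs to
  -- the lattice and survives every change of basis.
  int-conjugate : ∀ {n} x (α : IntegralGL n) (T : Mat n n) → (∀ i j → Integral (x * T i j)) →
                  ∀ i j → Integral (x * conjugate α T i j)
  int-conjugate x α T p i = int-scaledˡ x (σᵥ (matrix α i) ∙ T) (inverse α)
    (int-scaledʳ x (σᵥ (matrix α i)) T (int-σₘ (matrix-int α) i) p) (inverse-int α)

  permutationGL : ∀ {n} → Permutation n n → IntegralGL n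
  permutationGL π = record
    { matrix = λ i j → 1ₘ (π ⟨$⟩ʳ i) j
    ; inverse = λ i j → 1ₘ i (π ⟨$⟩ʳ j)
    ; matrix-int = λ i j → int-1ₘ (π ⟨$⟩ʳ i) j
    ; inverse-int = λ i j → int-1ₘ i (π ⟨$⟩ʳ j)
    ; inverseˡ = λ i j → trans (sym (sum-permute (λ l → 1ₘ i l * 1ₘ l j) π)) (1ₘ-∙ i 1ₘ j)
    ; inverseʳ = λ i j → trans (1ₘ-∙ (π ⟨$⟩ʳ i) (λ i j → 1ₘ i (π ⟨$⟩ʳ j)) j) (1ₘ-injective (π ⟨$⟩ʳ_) injective i j)
    }
    where
    injective : ∀ {i j} → π ⟨$⟩ʳ i ≡ π ⟨$⟩ʳ j → i ≡ j
    injective e = ≡.trans (≡.sym (Perm.inverseˡ π)) (≡.trans (≡.cong (π ⟨$⟩ˡ_) e) (Perm.inverseˡ π))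

  conjugate-permutation : ∀ {n} (π : Permutation n n) (T : Mat n n) i j →
    conjugate (permutationGL π) T i j ≈ T (π ⟨$⟩ʳ i) (π ⟨$⟩ʳ j)
  conjugate-permutation π T i j = trans
    (∙-cong {N = inverse (permutationGL π)} (λ l → trans (∙-cong {N = T} (σ-1ₘ (π ⟨$⟩ʳ i)) ≈ₘ.refl l) (1ₘ-∙
        (π ⟨$⟩ʳ i) T l)) ≈ₘ.refl j)
    (∙-1ₘ (T (π ⟨$⟩ʳ i)) (π ⟨$⟩ʳ j))

  solvable-conjugate : ∀ {n} (α : IntegralGL n) (T : Mat n n) → Solvable (conjugate α T) → Solvable T
  solvable-conjugate α T (bs , s) = bs , solution-conjugate α s

  shear-row : ∀ {n} (w u : Vector n) i → w i ≈ 0# → shear w u i ≋ 1ₘ i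
  shear-row w u i wᵢ≈0 j = trans (+-congˡ (trans (*-congʳ wᵢ≈0) (zeroˡ (u j)))) (+-identityʳ (1ₘ i j))

  conjugate-unchanged : ∀ {n} (α : IntegralGL n) (T : Mat n n) i j x →
    matrix α i ≋ 1ₘ i → matrix α j ≋ 1ₘ j → T i ≋ (λ l → x * 1ₘ j l) → conjugate α T i ≋ λ l → x * 1ₘ j l
  conjugate-unchanged α T i j x p q r = conjugate-row α T i j x λ l → begin
    (σᵥ (matrix α i) ∙ T) l  ≈⟨ ∙-cong {N = T} (λ m → trans (σ-cong (p m)) (σ-1ₘ i m)) ≈ₘ.refl l ⟩
    (1ₘ i ∙ T) l             ≈⟨ trans (1ₘ-∙ i T l) (r l) ⟩
    x * 1ₘ j l               ≈⟨ *-congˡ (q l) ⟨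
    x * matrix α j l         ∎

  -- (1 + ε σ)/2 applied to the first basis vector
  eigenvector : ∀ {n} → Carrier → Mat (suc n) (suc n) → Vector (suc n)
  eigenvector ε T j = ½ * (1ₘ zero j + ε * T zero j)

  eigenvector-σ : ∀ {n} ε (T : Mat (suc n) (suc n)) → ε * ε ≈ 1# → σ ε ≈ ε → IsCocycle T →
                  σᵥ (eigenvector ε T) ∙ T ≋ λ j → ε * eigenvector ε T j
  eigenvector-σ ε T εε≈1 σε≈ε cocycle j = begin
    (σᵥ (eigenvector ε T) ∙ T) j
      ≈⟨ ∙-cong {N = T} (λ l → trans (σ-* _ _) (*-cong σ½≈½ (trans (σ-+ _ _)
           (+-cong (σ-1ₘ zero l) (trans (σ-* ε (T zero l)) (*-congʳ σε≈ε)))))) ≈ₘ.refl j ⟩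
    ((λ l → ½ * (1ₘ zero l + ε * σ (T zero l))) ∙ T) j
      ≈⟨ ∙-scale ½ (λ l → 1ₘ zero l + ε * σ (T zero l)) T j ⟩
    ½ * ((λ l → 1ₘ zero l + ε * σ (T zero l)) ∙ T) j
      ≈⟨ *-congˡ (trans (∙-distribʳ (1ₘ zero) (λ l → ε * σ (T zero l)) T j)
           (+-cong (1ₘ-∙ zero T j) (trans (∙-scale ε (σᵥ (T zero)) T j) (*-congˡ (cocycle zero j))))) ⟩
    ½ * (T zero j + ε * 1ₘ zero j)
      ≈⟨ linear₁ (- (½ * T zero j)) εε≈1 (solve 4 (λ h e t d → h :* (t :+ e :* d) :=
           e :* (h :* (d :+ e :* t)) :+ (:- (h :* t)) :* (e :* e :- con (1 , 0))) refl ½ ε (T zero j) (1ₘ zero j)) ⟩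
    ε * eigenvector ε T j ∎

  -- A vector x in the lattice with σ(x) = ε x has the complement spanned
  -- by the e - π(e) x, where π is a coordinate averaged over σ.
  peel₁ : ∀ {n} ε (T : Mat (suc n) (suc n)) → ε * ε ≈ 1# → σ ε ≈ ε → Integral ε →
          IsCocycle T → Integralₘ T → (∀ l → T zero l ≈ ε * 1ₘ zero l) →
          Σ[ β ∈ IntegralGL (suc n) ] Σ[ R ∈ Mat n n ] conjugate β T ≈ₘ (λ (_ _ : Fin 1) → ε) ⊞ R
  peel₁ {n} ε T εε≈1 σε≈ε ε-int cocycle T-int T₀≈ε = β , R , eq
    where
    w : Vector (suc n)
    w zero    = 0#
    -- On basis vector `suc s` the first coordinate is 0 and its twist by σ is ε σ(T (suc s) zero);
    -- this is minus their average.
    w (suc s) = - (ε * ½) * σ (T (suc s) zero)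
    w-int : ∀ l → Integral (w l)
    w-int zero    = int-0
    w-int (suc s) = int-* (int-neg (int-* ε-int int-½)) (int-σ (T-int (suc s) zero))
    β : IntegralGL (suc n)
    β = transvection zero w w-int refl
    R : Mat n n
    R i j = conjugate β T (suc i) (suc j)
    T₀₀ : T zero zero ≈ ε
    T₀₀ = trans (T₀≈ε zero) (*-identityʳ ε)
    row₀ : ∀ l → conjugate β T zero l ≈ ε * 1ₘ zero l
    row₀ = conjugate-unchanged β T zero zero ε (shear-row w (1ₘ zero) zero refl) (shear-row w
        (1ₘ zero) zero refl) T₀≈ε
    column₀ : ∀ s → conjugate β T (suc s) zero ≈ 0#
    column₀ s = begin
      conjugate β T (suc s) zero
        ≈⟨ conjugate-transvection zero w w-int refl T (suc s) zero ⟩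
      v zero + (v · w) * (- 1# * 1#)
        ≈⟨ linear₃ (σ w′) (- 1#) (- (½ * Q)) T₀₀ v·w≈½Q εε≈1
             (trans (solve 4 (λ q s t vw → q :+ s :* t :+ vw :* (:- con (1 , 0) :* con (1 , 0)) := q
                 :+ s :* t :- vw) refl Q (σ w′) (T zero zero) (v · w))
               (linear₂ ε (- Q) σw′ ½+½≈1 (solve 6 (λ q s t e h vw → q :+ s :* t :- vw :=
                 con (0 , 0) :+ s :* (t :- e) :+ (:- con (1 , 0)) :* (vw :- h :* q) :+ (:- (h :* q)) :*
                     (e :* e :- con (1 , 0))
                 :+ e :* (s :- (:- (e :* h :* q))) :+ :- q :* (h :+ h :- con (1 , 0))) refl Q (σ w′)
                     (T zero zero) ε ½ (v · w)))) ⟩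
      0# ∎
      where
      Q = T (suc s) zero
      w′ = w (suc s)
      v : Vector (suc n)
      v j = T (suc s) j + σ w′ * T zero j
      σw′ : σ w′ ≈ - (ε * ½ * Q)
      σw′ = begin
        σ (- (ε * ½) * σ Q)       ≈⟨ σ-* _ _ ⟩
        σ (- (ε * ½)) * σ (σ Q)   ≈⟨ *-cong (trans (σ-neg _) (-‿cong (trans (σ-* _ _) (*-cong σε≈ε σ½≈½))))
            (σ-involutive Q) ⟩
        - (ε * ½) * Q             ≈⟨ -‿distribˡ-* _ _ ⟨
        - (ε * ½ * Q)             ∎
      -- An off-diagonal entry of T σ(T) = 1, solved for the part of the sum that occurs in `v · w`.
      tail-sum : sum (λ l → T (suc s) (suc l) * σ (T (suc l) zero)) ≈ - (Q * σ (T zero zero))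
      tail-sum = linear₁ 1# (cocycle-flip T cocycle (suc s) zero)
        (solve 2 (λ x y → y := :- x :+ con (1 , 0) :* (x :+ y :- con (0 , 0))) refl
          (Q * σ (T zero zero)) (sum (λ l → T (suc s) (suc l) * σ (T (suc l) zero))))
      v·w≈½Q : v · w ≈ ½ * Q
      v·w≈½Q = begin
        v zero * 0# + sum (λ l → v (suc l) * w (suc l))
          ≈⟨ +-cong (zeroʳ _) (sum-cong λ l → trans (*-congʳ (trans (+-congˡ (trans (*-congˡ (trans (T₀≈ε
              (suc l)) (zeroʳ ε))) (zeroʳ _))) (+-identityʳ _)))
               (solve 3 (λ a b d → a :* (b :* d) := b :* (a :* d)) refl (T (suc s) (suc l)) (- (ε * ½)) (σ
                   (T (suc l) zero)))) ⟩
        0# + sum (λ l → - (ε * ½) * (T (suc s) (suc l) * σ (T (suc l) zero)))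
          ≈⟨ trans (+-identityˡ _) (sym (*-distribˡ-sum (- (ε * ½)) (λ l → T (suc s) (suc l) * σ (T (suc l) zero)))) ⟩
        - (ε * ½) * sum (λ l → T (suc s) (suc l) * σ (T (suc l) zero))
          ≈⟨ *-congˡ (trans tail-sum (-‿cong (*-congˡ (trans (σ-cong T₀₀) σε≈ε)))) ⟩
        - (ε * ½) * - (Q * ε)
          ≈⟨ linear₁ (½ * Q) εε≈1 (solve 3 (λ e h q → :- (e :* h) :* :- (q :* e) := h :* q :+ h :* q :*
              (e :* e :- con (1 , 0))) refl ε ½ Q) ⟩
        ½ * Q ∎
    eq : conjugate β T ≈ₘ (λ (_ _ : Fin 1) → ε) ⊞ R
    eq zero    zero    = trans (row₀ zero) (*-identityʳ ε)
    eq zero    (suc j) = trans (row₀ (suc j)) (zeroʳ ε)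
    eq (suc i) zero    = column₀ i
    eq (suc i) (suc j) = refl

  -- The first row says that the second basis vector is y = z^λ σ(x), with x the first and λ = d +
  -- 1; then σ(y) = σ(z^λ) x determines the second row. Subtracting multiples of x from the
  -- remaining vectors clears the column of y, and the column of x then vanishes by the cocycle
  -- condition.
  peel₂ : ∀ {n} d (T : Mat (suc (suc n)) (suc (suc n))) → IsCocycle T →
          (∀ i j → Integral (z ^ suc d * T i j)) → (∀ l → T zero l ≈ z⁻¹ ^ suc d * 1ₘ (suc zero) l) →
          Σ[ β ∈ IntegralGL (suc (suc n)) ] Σ[ R ∈ Mat n n ]
            conjugate β T ≈ₘ matrix₂ 0# (z⁻¹ ^ suc d) (σ (z ^ suc d)) 0# ⊞ R
  peel₂ {n} d T cocycle T-int T₀≈ = β , R , eq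
    where
    Z = z ^ suc d
    Z⁻¹ = z⁻¹ ^ suc d
    ZZ⁻¹≈1 = z^*z⁻¹^≈1 (suc d)
    σZσZ⁻¹≈1 : σ Z * σ Z⁻¹ ≈ 1#
    σZσZ⁻¹≈1 = trans (sym (σ-* Z Z⁻¹)) (trans (σ-cong ZZ⁻¹≈1) σ-1)
    w : Vector (suc (suc n))
    w zero          = 0#
    w (suc zero)    = 0#
    w (suc (suc s)) = - σ (Z * T (suc (suc s)) (suc zero))
    w-int : ∀ l → Integral (w l)
    w-int zero          = int-0
    w-int (suc zero)    = int-0
    w-int (suc (suc s)) = int-neg (int-σ (T-int (suc (suc s)) (suc zero)))
    β : IntegralGL (suc (suc n))
    β = transvection zero w w-int refl
    T′ : Mat (suc (suc n)) (suc (suc n))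
    T′ = conjugate β T
    R : Mat n n
    R i j = T′ (suc (suc i)) (suc (suc j))
    T₁≈ : ∀ l → T (suc zero) l ≈ σ Z * 1ₘ zero l
    T₁≈ l = linear₂ (- T (suc zero) l) (σ Z) σZσZ⁻¹≈1
      (begin
        σ Z⁻¹ * T (suc zero) l
          ≈⟨ *-congˡ (1ₘ-∙ (suc zero) T l) ⟨
        σ Z⁻¹ * (1ₘ (suc zero) ∙ T) l
          ≈⟨ ∙-scale (σ Z⁻¹) (1ₘ (suc zero)) T l ⟨
        ((λ m → σ Z⁻¹ * 1ₘ (suc zero) m) ∙ T) l
          ≈⟨ ∙-cong {N = T} (λ m → trans (σ-cong (T₀≈ m)) (trans (σ-* _ _) (*-congˡ (σ-1ₘ (suc zero) m)))) ≈ₘ.refl l ⟨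
        (σᵥ (T zero) ∙ T) l
          ≈⟨ cocycle zero l ⟩
        1ₘ zero l ∎)
      (solve 4 (λ s s′ t e → t := s :* e :+ :- t :* (s :* s′ :- con (1 , 0)) :+ s :* (s′ :* t :- e)) refl
        (σ Z) (σ Z⁻¹) (T (suc zero) l) (1ₘ zero l))
    row₀ : ∀ l → T′ zero l ≈ Z⁻¹ * 1ₘ (suc zero) l
    row₀ = conjugate-unchanged β T zero (suc zero) Z⁻¹ (shear-row w (1ₘ zero) zero refl) (shear-row w
        (1ₘ zero) (suc zero) refl) T₀≈
    row₁ : ∀ l → T′ (suc zero) l ≈ σ Z * 1ₘ zero l
    row₁ = conjugate-unchanged β T (suc zero) zero (σ Z) (shear-row w (1ₘ zero) (suc zero) refl)
        (shear-row w (1ₘ zero) zero refl) T₁≈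
    column₁ : ∀ s → T′ (suc (suc s)) (suc zero) ≈ 0#
    column₁ s = begin
      T′ (suc (suc s)) (suc zero)
        ≈⟨ conjugate-transvection zero w w-int refl T (suc (suc s)) (suc zero) ⟩
      t + σ (- σ (Z * t)) * T zero (suc zero) + vw * (- 1# * 0#)
        ≈⟨ +-cong (+-congˡ (*-cong (trans (σ-neg _) (-‿cong (σ-involutive _))) (trans (T₀≈ (suc zero))
            (*-identityʳ Z⁻¹))))
             (trans (*-congˡ (zeroʳ _)) (zeroʳ vw)) ⟩
      t + - (Z * t) * Z⁻¹ + 0#
        ≈⟨ linear₁ (- t) ZZ⁻¹≈1 (solve 3 (λ t Z Y → t :+ :- (Z :* t) :* Y :+ con (0 , 0) := con (0 , 0)
            :+ :- t :* (Z :* Y :- con (1 , 0))) refl t Z Z⁻¹) ⟩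
      0# ∎
      where
      t = T (suc (suc s)) (suc zero)
      vw : Carrier
      vw = (λ j → T (suc (suc s)) j + σ (w (suc (suc s))) * T zero j) · w
    column₀ : ∀ s → T′ (suc (suc s)) zero ≈ 0#
    column₀ s = linear₂ (σ Z) (- t) orthogonal σZσZ⁻¹≈1
      (solve 3 (λ t s s′ → t := con (0 , 0) :+ s :* (t :* s′ :- con (0 , 0)) :+ :- t :* (s :* s′ :- con
          (1 , 0))) refl t (σ Z) (σ Z⁻¹))
      where
      t = T′ (suc (suc s)) zero
      σ0 : ∀ {x} → x ≈ 0# → σ x ≈ 0#
      σ0 p = trans (σ-cong p) σ-0
      -- An entry of T′ σ(T′) = 1: the column of y in σ(T′) has its only nonzero entry in the row of
      -- x, so the sum has one term.
      orthogonal : t * σ Z⁻¹ ≈ 0#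
      orthogonal = begin
        t * σ Z⁻¹
          ≈⟨ *-congˡ (σ-cong (trans (row₀ (suc zero)) (*-identityʳ Z⁻¹))) ⟨
        t * σ (T′ zero (suc zero))
          ≈⟨ +-identityʳ _ ⟨
        t * σ (T′ zero (suc zero)) + 0#
          ≈⟨ +-congˡ (sum-zero {u = λ l → T′ (suc (suc s)) (suc l) * σ (T′ (suc l) (suc zero))} (λ { zero →
              trans (*-congˡ (σ0 (trans (row₁ (suc zero)) (zeroʳ (σ Z))))) (zeroʳ _)
                                  ; (suc l) → trans (*-congˡ (σ0 (column₁ l))) (zeroʳ _) })) ⟨
        (T′ ⋆ σₘ T′) (suc (suc s)) (suc zero)
          ≈⟨ cocycle-flip T′ (conjugate-cocycle β T cocycle) (suc (suc s)) (suc zero) ⟩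
        0# ∎
    eq : T′ ≈ₘ matrix₂ 0# Z⁻¹ (σ Z) 0# ⊞ R
    eq zero          zero          = trans (row₀ zero) (zeroʳ Z⁻¹)
    eq zero          (suc zero)    = trans (row₀ (suc zero)) (*-identityʳ Z⁻¹)
    eq zero          (suc (suc j)) = trans (row₀ (suc (suc j))) (zeroʳ Z⁻¹)
    eq (suc zero)    zero          = trans (row₁ zero) (*-identityʳ (σ Z))
    eq (suc zero)    (suc zero)    = trans (row₁ (suc zero)) (zeroʳ (σ Z))
    eq (suc zero)    (suc (suc j)) = trans (row₁ (suc (suc j))) (zeroʳ (σ Z))
    eq (suc (suc i)) zero          = column₀ i
    eq (suc (suc i)) (suc zero)    = column₁ i
    eq (suc (suc i)) (suc (suc j)) = refl

  unit-resp : ∀ {x y} → x ≈ y → Unit x → Unit y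
  unit-resp e (u , u-int , p) = u , u-int , trans (*-congʳ (sym e)) p

  SolvableBelow : ℕ → Set _
  SolvableBelow n = ∀ m → m ≤ n → (R : Mat m m) → IsCocycle R → Solvable R

  -- Treats both signs at once; `extend` supplies the block that belongs to ε. The eigenvector may
  -- replace the first basis vector because its first coordinate is a unit, and then `peel₁`
  -- applies.
  solve-eigenvector : ∀ {n} ε → ε * ε ≈ 1# → σ ε ≈ ε → Integral ε →
    (∀ {R : Mat n n} {T} → T ≈ₘ (λ (_ _ : Fin 1) → ε) ⊞ R → IsCocycle T → (IsCocycle R → Solvable R) → Solvable T) →
    SolvableBelow n → (T : Mat (suc n) (suc n)) → IsCocycle T → Integralₘ T → Unit (eigenvector ε T zero) → Solvable T
  solve-eigenvector {n} ε εε≈1 σε≈ε ε-int extend ih T cocycle T-int x₀-unit =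
    let β , R , eq = peel₁ ε T′ εε≈1 σε≈ε ε-int cocycle′ T′-int row₀
    in solvable-conjugate α T (solvable-conjugate β T′ (extend {T = conjugate β T′} eq
        (conjugate-cocycle β T′ cocycle′) (ih n ℕ.≤-refl R)))
    where
    x = eigenvector ε T
    α : IntegralGL (suc n)
    α = replaceRow zero x (λ j → int-* int-½ (int-+ (int-1ₘ zero j) (int-* ε-int (T-int zero j)))) x₀-unit
    α₀≈x = replaceRow-row zero x (λ j → int-* int-½ (int-+ (int-1ₘ zero j) (int-* ε-int (T-int zero j)))) x₀-unit
    T′ = conjugate α T
    cocycle′ = conjugate-cocycle α T cocycle
    T′-int : Integralₘ T′
    T′-int = int-⋆ (int-⋆ (int-σₘ (matrix-int α)) T-int) (inverse-int α)
    row₀ : ∀ l → T′ zero l ≈ ε * 1ₘ zero l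
    row₀ = conjugate-row α T zero zero ε λ l → trans
      (∙-cong {N = T} (λ m → σ-cong (α₀≈x m)) ≈ₘ.refl l)
      (trans (eigenvector-σ ε T εε≈1 σε≈ε cocycle l) (*-congˡ (sym (α₀≈x l))))

  solve-integral : ∀ {n} → SolvableBelow n → (T : Mat (suc n) (suc n)) → IsCocycle T → Integralₘ T → Solvable T
  solve-integral ih T cocycle T-int = [ (λ p → [ (λ q → ⊥-elim (z⁻¹-nonintegral (z⁻¹-int p q))) , solve₋ ]′
      (dichotomy (- 1#) (int-neg int-1))) , solve₊ ]′
    (dichotomy 1# int-1)
    where
    dichotomy : ∀ ε → Integral ε → Nonunit (eigenvector ε T zero) ⊎ Unit (eigenvector ε T zero)
    dichotomy ε ε-int = int-dichotomy (int-* int-½ (int-+ int-1 (int-* ε-int (T-int zero zero))))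
    -- The first coordinates ½ (1 + t) and ½ (1 - t) add up to 1, so they cannot both lie in (z).
    z⁻¹-int : Nonunit (eigenvector 1# T zero) → Nonunit (eigenvector (- 1#) T zero) → Integral z⁻¹
    z⁻¹-int p q = int-resp (linear₁ z⁻¹ ½+½≈1
      (solve 3 (λ z⁻¹ h t → z⁻¹ :* (h :* (con (1 , 0) :+ con (1 , 0) :* t) :+ h :* (con (1 , 0) :+ :- con
          (1 , 0) :* t))
        := z⁻¹ :+ z⁻¹ :* (h :+ h :- con (1 , 0))) refl z⁻¹ ½ (T zero zero))) (nonunit-+ p q)
    solve₊ : Unit (eigenvector 1# T zero) → Solvable T
    solve₊ = solve-eigenvector 1# (*-identityˡ 1#) σ-1 int-1
      (solve-⊞ ⟨1⟩ (solution₁ (*-identityˡ 1#) (trans σ-1 (sym (*-identityˡ 1#))))) ih T cocycle T-int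
    solve₋ : Unit (eigenvector (- 1#) T zero) → Solvable T
    solve₋ = solve-eigenvector (- 1#) (solve 0 (:- con (1 , 0) :* :- con (1 , 0) := con (1 , 0)) refl)
      (trans (σ-neg 1#) (-‿cong σ-1)) (int-neg int-1)
      (solve-⊞ ⟨z⟩ (solution₁ z*z⁻¹≈1 (trans σz≈-z (solve 1 (λ z → :- z := :- con (1 , 0) :* z)
          refl z)))) ih T cocycle T-int

  -- For the basis vector x with index i, the vector z^λ σ(x) has a unit coordinate at an index
  -- other than i. A permutation brings the two indices to the front, and z^λ σ(x) then replaces the
  -- second basis vector, as `peel₂` requires.
  solve-nonintegral : ∀ {n} → SolvableBelow n → (T : Mat (suc n) (suc n)) → IsCocycle T → ∀ d →
    (∀ i j → Integral (z ^ suc d * T i j)) → ∀ i k → Unit (z ^ suc d * T i (punchIn i k)) → Solvable T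
  solve-nonintegral {suc n} ih T cocycle d T-int i k unit =
    let β , R , eq = peel₂ d T₂ cocycle₂ (int-conjugate Z α T₁ T₁-int) row₀
    in solvable-conjugate permute T (solvable-conjugate α T₁ (solvable-conjugate β T₂
         -- The exponent is λ + 1, as half of z^λ u - z^λ σ(u) for u = (1, z) is (0, z^{λ+1}); it
         -- exceeds 1 because λ = d + 1. Two dimensions are used up, one more than in the integral
         -- case.
         (solve-⊞ (upper (suc (suc d)) (s≤s (s≤s z≤n))) {T = conjugate β T₂} (solution₂ d) eq
             (conjugate-cocycle β T₂ cocycle₂) (ih n (ℕ.n≤1+n n) R))))
    where
    Z = z ^ suc d
    Z⁻¹ = z⁻¹ ^ suc d
    π : Permutation (suc (suc n)) (suc (suc n))
    -- Sends `zero` to `i` and `suc zero` to `punchIn i k`.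
    π = Perm.insert zero i (Perm.insert zero k Perm.id)
    permute = permutationGL π
    T₁ = conjugate permute T
    T₁-int = int-conjugate Z permute T T-int
    y : Vector (suc (suc n))
    y l = Z * T₁ zero l
    y-unit : Unit (y (suc zero))
    y-unit = unit-resp (*-congˡ (sym (trans (conjugate-permutation π T zero (suc zero))
      (reflexive (≡.cong (T i) (Perm.insert-punchIn zero i (Perm.insert zero k Perm.id) zero)))))) unit
    α : IntegralGL (suc (suc n))
    α = replaceRow (suc zero) y (T₁-int zero) y-unit
    T₂ = conjugate α T₁
    cocycle₂ = conjugate-cocycle α T₁ (conjugate-cocycle permute T cocycle)
    row₀ : ∀ l → T₂ zero l ≈ Z⁻¹ * 1ₘ (suc zero) l
    row₀ = conjugate-row α T₁ zero (suc zero) Z⁻¹ λ l → begin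
      (σᵥ (matrix α zero) ∙ T₁) l
        ≈⟨ ∙-cong {N = T₁} (λ m → trans (σ-cong (shear-row (λ l → 1ₘ l (suc zero)) (λ j → y j - 1ₘ
            (suc zero) j) zero refl m)) (σ-1ₘ zero m)) ≈ₘ.refl l ⟩
      (1ₘ zero ∙ T₁) l
        ≈⟨ 1ₘ-∙ zero T₁ l ⟩
      T₁ zero l
        ≈⟨ linear₁ (- T₁ zero l) (z^*z⁻¹^≈1 (suc d)) (solve 3 (λ t Z Y → t := Y :* (Z :* t) :+ :- t :*
            (Z :* Y :- con (1 , 0))) refl (T₁ zero l) Z Z⁻¹) ⟩
      Z⁻¹ * y l
        ≈⟨ *-congˡ (replaceRow-row (suc zero) y (T₁-int zero) y-unit l) ⟨
      Z⁻¹ * matrix α (suc zero) l ∎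

  search : ∀ {a b n} {A : Fin n → Set a} {B : Fin n → Set b} → (∀ i → A i ⊎ B i) → (∀ i → A i) ⊎ ∃[ i ] B i
  search {n = zero}  f = inj₁ λ ()
  search {n = suc n} f with f zero | search (f ∘ suc)
  ... | inj₂ b | _              = inj₂ (zero , b)
  ... | inj₁ _ | inj₂ (i , b)   = inj₂ (suc i , b)
  ... | inj₁ a | inj₁ as        = inj₁ λ { zero → a ; (suc i) → as i }

  -- Modulo z, the i-th diagonal entry of (z^λ T) σ(z^λ T) = ± z^{2λ} is
  -- the square of a unit unless another entry of row i is a unit.
  off-diagonal-unit : ∀ {n} (T : Mat (suc n) (suc n)) → IsCocycle T → ∀ d →
    (∀ i j → Integral (z ^ suc d * T i j)) → ∀ i → Unit (z ^ suc d * T i i) →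
    ∃[ k ] Unit (z ^ suc d * T i (punchIn i k))
  off-diagonal-unit {n} T cocycle d T-int i unit@(u , u-int , Ztu≈1) =
    [ (λ nonunits → ⊥-elim (nonunit-unit (diagonal nonunits) square-unit)) , (λ x → x) ]′
      (search λ k → int-dichotomy (T-int i (punchIn i k)))
    where
    Z = z ^ suc d
    y : Vector (suc n)
    y l = Z * T i l * σ (Z * T l i)
    sum-y : sum y ≈ Z * σ Z
    sum-y = begin
      sum y
        ≈⟨ sum-cong (λ l → trans (*-congˡ (σ-* _ _)) (solve 4 (λ a b c d → a :* b :* (c :* d) := a :* c :*
            (b :* d)) refl Z (T i l) (σ Z) (σ (T l i)))) ⟩
      sum (λ l → Z * σ Z * (T i l * σ (T l i)))
        ≈⟨ *-distribˡ-sum (Z * σ Z) (λ l → T i l * σ (T l i)) ⟨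
      Z * σ Z * (T ⋆ σₘ T) i i
        ≈⟨ *-congˡ (trans (cocycle-flip T cocycle i i) (1ₘ-diagonal i)) ⟩
      Z * σ Z * 1#
        ≈⟨ *-identityʳ _ ⟩
      Z * σ Z ∎
    nonunit-sum : ∀ {m} {f : Vector m} → (∀ l → Nonunit (f l)) → Nonunit (sum f)
    nonunit-sum {zero}  p = nonunit-0
    nonunit-sum {suc m} p = nonunit-+ (p zero) (nonunit-sum (p ∘ suc))
    diagonal : (∀ k → Nonunit (Z * T i (punchIn i k))) → Nonunit (y i)
    diagonal p = nonunit-resp
      (linear₂ (- 1#) 1# sum-y (sum-remove {i = i} y)
        (solve 4 (λ zz s yi r → zz :- r := yi :+ :- con (1 , 0) :* (s :- zz) :+ con (1 , 0) :* (s :- (yi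
            :+ r))) refl (Z * σ Z) (sum y) (y i) (sum (y ∘ punchIn i))))
      (nonunit-+ (nonunit-* (nonunit-z^ d) (int-σ (int-^ (suc d))))
        (nonunit-neg (nonunit-sum {f = y ∘ punchIn i} λ k → nonunit-* (p k) (int-σ (T-int (punchIn i k) i)))))
    square-unit : Unit (y i)
    square-unit = u * σ u , int-* u-int (int-σ u-int) , (begin
      Z * T i i * σ (Z * T i i) * (u * σ u)
        ≈⟨ solve 4 (λ a b c d → a :* b :* (c :* d) := a :* c :* (b :* d)) refl (Z * T i i) (σ (Z * T i i)) u (σ u) ⟩
      Z * T i i * u * (σ (Z * T i i) * σ u)
        ≈⟨ *-cong Ztu≈1 (trans (sym (σ-* _ _)) (trans (σ-cong Ztu≈1) σ-1)) ⟩
      1# * 1#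
        ≈⟨ *-identityˡ 1# ⟩
      1# ∎)

  -- Descent to the worst pole from an arbitrary bound d. If no entry of z^d T is a unit, then
  -- z^{d-1} T is integral as well; if some entry is a unit, then d is the exact order of the worst
  -- pole.
  solve-bounded : ∀ {n} → SolvableBelow n → (T : Mat (suc n) (suc n)) → IsCocycle T → ∀ d →
    (∀ i j → Integral (z ^ d * T i j)) → Solvable T
  solve-bounded ih T cocycle zero    T-int = solve-integral ih T cocycle (λ i j → int-resp (*-identityˡ _)
      (T-int i j))
  solve-bounded ih T cocycle (suc d) T-int with search (λ i → search (λ j → int-dichotomy (T-int i j)))
  ... | inj₁ nonunits = solve-bounded ih T cocycle d λ i j → int-resp
    (linear₁ (z ^ d * T i j) z*z⁻¹≈1 (solve 4 (λ z y Z t → y :* (z :* Z :* t) := Z :* t :+ Z :* t :*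
        (z :* y :- con (1 , 0))) refl z z⁻¹ (z ^ d) (T i j)))
    (nonunits i j)
  ... | inj₂ (i , j , unit) with i Fin.≟ j
  ...   | no i≢j = solve-nonintegral ih T cocycle d T-int i (punchOut i≢j)
                     (≡.subst (λ l → Unit (z ^ suc d * T i l)) (≡.sym (Fin.punchIn-punchOut i≢j)) unit)
  ...   | yes ≡.refl = let k , unit′ = off-diagonal-unit T cocycle d T-int i unit
                       in solve-nonintegral ih T cocycle d T-int i k unit′

  int-bounded-mono : ∀ {x d} e → Integral (z ^ d * x) → Integral (z ^ (e ℕ.+ d) * x)
  int-bounded-mono zero    p = p
  int-bounded-mono (suc e) p = int-resp (sym (*-assoc _ _ _)) (int-* int-z (int-bounded-mono e p))

  int-bounded-family : ∀ {n} {P : ℕ → Fin n → Set i} → (∀ {l d} e → P d l → P (e ℕ.+ d) l) →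
                       (∀ l → ∃[ d ] P d l) → ∃[ d ] ∀ l → P d l
  int-bounded-family {zero}          mono f = 0 , λ ()
  int-bounded-family {suc n} {P = P} mono f =
    let d , p = f zero
        e , q = int-bounded-family {P = λ d l → P d (suc l)} mono (f ∘ suc)
    in e ℕ.+ d , λ { zero → mono e p ; (suc l) → ≡.subst (λ m → P m (suc l)) (ℕ.+-comm d e) (mono d (q l)) }

  -- The dimension drops by one or by two, so the recursion runs on an upper bound for it.
  solvable-below : ∀ N → SolvableBelow N
  solvable-below N zero m≤N R _ = [] , record
    { a = identityGL ; C = λ () ; C⁻¹ = λ () ; C⁻¹⋆C≈1 = λ () ; C⋆C⁻¹≈1 = λ () ; aC≈B = λ () ; σC≈TC = λ () }
  solvable-below (suc N) (suc n) (s≤s n≤N) T cocycle =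
    let d , T-int = int-bounded-family {P = λ d i → ∀ j → Integral (z ^ d * T i j)} (λ e p j → int-bounded-mono e (p j))
          (λ i → int-bounded-family {P = λ d j → Integral (z ^ d * T i j)} int-bounded-mono (λ j →
              int-bounded (T i j)))
    in solve-bounded (λ m m≤n → solvable-below N m (ℕ.≤-trans m≤n n≤N)) T cocycle d T-int

  solvable : ∀ {n} (T : Mat n n) → IsCocycle T → Solvable T
  solvable {n} = solvable-below n n ℕ.≤-refl

-- Multiplicities of blocks and levels of rows

module Multiplicity {a} {A : Set a} (_≟_ : DecidableEquality A) where

  multiplicity : A → List A → ℕ
  multiplicity x []       = 0
  multiplicity x (y ∷ ys) = if does (y ≟ x) then suc (multiplicity x ys) else multiplicity x ys

  multiplicity-↭ : ∀ x {ys zs} → ys ↭ zs → multiplicity x ys ≡ multiplicity x zs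
  multiplicity-↭ x ↭.refl = ≡.refl
  multiplicity-↭ x (↭.prep y p) rewrite multiplicity-↭ x p = ≡.refl
  multiplicity-↭ x (↭.swap y z p) rewrite multiplicity-↭ x p with does (y ≟ x) | does (z ≟ x)
  ... | true  | true  = ≡.refl
  ... | true  | false = ≡.refl
  ... | false | true  = ≡.refl
  ... | false | false = ≡.refl
  multiplicity-↭ x (↭.trans p q) = ≡.trans (multiplicity-↭ x p) (multiplicity-↭ x q)

  multiplicity-head : ∀ x ys → multiplicity x (x ∷ ys) ≡ suc (multiplicity x ys)
  multiplicity-head x ys rewrite dec-true (x ≟ x) ≡.refl = ≡.refl

  extract : ∀ x ys {n} → multiplicity x ys ≡ suc n → ∃[ zs ] ys ↭ x ∷ zs
  extract x (y ∷ ys) e with y ≟ x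
  ... | yes ≡.refl = ys , ↭.refl
  ... | no _ = let zs , p = extract x ys e in y ∷ zs , ↭.trans (↭.prep y p) (↭.swap y x ↭.refl)

  ↭-from-multiplicity : ∀ xs ys → (∀ x → multiplicity x xs ≡ multiplicity x ys) → xs ↭ ys
  ↭-from-multiplicity [] []       e = ↭.refl
  ↭-from-multiplicity [] (y ∷ ys) e with () ← ≡.trans (e y) (multiplicity-head y ys)
  ↭-from-multiplicity (x ∷ xs) ys e =
    let zs , p = extract x ys (≡.trans (≡.sym (e x)) (multiplicity-head x xs))
    in ↭.trans (↭.prep x (↭-from-multiplicity xs zs λ y → cancel y zs (≡.trans (e y) (multiplicity-↭ y p))))
        (↭.↭-sym p)
    where
    cancel : ∀ y zs → multiplicity y (x ∷ xs) ≡ multiplicity y (x ∷ zs) → multiplicity y xs ≡ multiplicity y zs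
    cancel y zs e with does (x ≟ y)
    ... | true  = ℕ.suc-injective e
    ... | false = e

_≟ᵇ_ : DecidableEquality Block
⟨1⟩       ≟ᵇ ⟨1⟩       = yes ≡.refl
⟨1⟩       ≟ᵇ ⟨z⟩       = no λ ()
⟨1⟩       ≟ᵇ upper _ _ = no λ ()
⟨z⟩       ≟ᵇ ⟨1⟩       = no λ ()
⟨z⟩       ≟ᵇ ⟨z⟩       = yes ≡.refl
⟨z⟩       ≟ᵇ upper _ _ = no λ ()
upper _ _ ≟ᵇ ⟨1⟩       = no λ ()
upper _ _ ≟ᵇ ⟨z⟩       = no λ ()
upper m p ≟ᵇ upper n q = map′ (λ { ≡.refl → ≡.cong (upper m) (ℕ.≤-irrelevant p q) }) (λ { ≡.refl → ≡.refl }) (m ℕ.≟ n)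

open Multiplicity _≟ᵇ_

_≟ᵏ_ : DecidableEquality (Maybe Block)
_≟ᵏ_ = Maybe.≡-dec _≟ᵇ_

-- The level of a row of a block; nothing, for the second row of a 2 × 2
-- block, is the lowest one.
key : (b : Block) → Fin (size b) → Maybe Block
key ⟨1⟩         _       = just ⟨1⟩
key ⟨z⟩         _       = just ⟨z⟩
key b@(upper _ _) zero    = just b
key (upper _ _) (suc _) = nothing

keys : ∀ {n} → Blocks n → Fin n → Maybe Block
keys []       ()
keys (b ∷ bs) s = [ key b , keys bs ]′ (splitAt (size b) s)

count : ∀ {m} → (Fin m → Bool) → ℕ
count {zero}  p = 0
count {suc m} p = if p zero then suc (count (p ∘ suc)) else count (p ∘ suc)

-- Every block has exactly one row whose key is a `just`, namely the block itself.
count-keys : ∀ b {n} (bs : Blocks n) → count (λ s → does (keys bs s ≟ᵏ just b)) ≡ multiplicity b (toList bs)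
count-keys b []               = ≡.refl
count-keys b (⟨1⟩ ∷ bs)       rewrite count-keys b bs = ≡.refl
count-keys b (⟨z⟩ ∷ bs)       rewrite count-keys b bs = ≡.refl
count-keys b (upper n p ∷ bs) rewrite count-keys b bs = ≡.refl

count-empty : ∀ {m} (p : Fin m → Bool) → (∀ s → p s ≡ false) → count p ≡ 0
count-empty {zero}  p e = ≡.refl
count-empty {suc m} p e rewrite e zero = count-empty (p ∘ suc) (e ∘ suc)

remove : ∀ {m} → Fin m → (Fin m → Bool) → Fin m → Bool
remove s p t = if does (s Fin.≟ t) then false else p t

count-remove : ∀ {m} s (p : Fin m → Bool) → p s ≡ true → count p ≡ suc (count (remove s p))
count-remove zero    p e rewrite e = ≡.refl
count-remove (suc s) p e with p zero | count-remove s (p ∘ suc) e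
... | true  | eq = ≡.cong suc eq
... | false | eq = eq

remove-true : ∀ {m} s (p : Fin m → Bool) t → remove s p t ≡ true → ¬ s ≡ t × p t ≡ true
remove-true s p t e with s Fin.≟ t
... | no s≢t = s≢t , e

-- Vanishing k l: a morphism of lattices with σ has no unit entries from
-- rows of level k to rows of level l.
data Vanishing : Maybe Block → Maybe Block → Set where
  ⟨1⟩-⟨z⟩     : Vanishing (just ⟨1⟩) (just ⟨z⟩)
  ⟨z⟩-⟨1⟩     : Vanishing (just ⟨z⟩) (just ⟨1⟩)
  ⟨1⟩-upper   : ∀ {n p} → Vanishing (just ⟨1⟩) (just (upper n p))
  ⟨z⟩-upper   : ∀ {n p} → Vanishing (just ⟨z⟩) (just (upper n p))
  upper-upper : ∀ {m n p q} → m < n → Vanishing (just (upper m p)) (just (upper n q))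
  lowest      : ∀ {b} → Vanishing nothing (just b)

-- A path from level b through A to a level k and back through A⁻¹ is negligible modulo z unless k
-- is b, because one of its two steps vanishes.
vanishing-trichotomy : ∀ b k → k ≡ just b ⊎ Vanishing (just b) k ⊎ Vanishing k (just b)
vanishing-trichotomy b           nothing            = inj₂ (inj₂ lowest)
vanishing-trichotomy ⟨1⟩         (just ⟨1⟩)         = inj₁ ≡.refl
vanishing-trichotomy ⟨1⟩         (just ⟨z⟩)         = inj₂ (inj₁ ⟨1⟩-⟨z⟩)
vanishing-trichotomy ⟨1⟩         (just (upper _ _)) = inj₂ (inj₁ ⟨1⟩-upper)
vanishing-trichotomy ⟨z⟩         (just ⟨1⟩)         = inj₂ (inj₁ ⟨z⟩-⟨1⟩)
vanishing-trichotomy ⟨z⟩         (just ⟨z⟩)         = inj₁ ≡.refl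
vanishing-trichotomy ⟨z⟩         (just (upper _ _)) = inj₂ (inj₁ ⟨z⟩-upper)
vanishing-trichotomy (upper _ _) (just ⟨1⟩)         = inj₂ (inj₂ ⟨1⟩-upper)
vanishing-trichotomy (upper _ _) (just ⟨z⟩)         = inj₂ (inj₂ ⟨z⟩-upper)
vanishing-trichotomy (upper m p) (just (upper n q)) with ℕ.<-cmp m n
... | tri< m<n _ _    = inj₂ (inj₁ (upper-upper m<n))
... | tri≈ _ ≡.refl _ = inj₁ (≡.cong (λ r → just (upper m r)) (ℕ.≤-irrelevant q p))
... | tri> _ _ n<m    = inj₂ (inj₂ (upper-upper n<m))

-- Uniqueness: ranks modulo z

module Uniqueness {i} (K : CommutativeRing c ℓ) (conjugation : Conjugation K i) where
  open CommutativeRing K hiding (zero)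
  open Conjugation conjugation
  open RingMorphisms.IsRingHomomorphism σ-homo
    using () renaming (*-homo to σ-*; 0#-homo to σ-0; 1#-homo to σ-1)
  open Algebra.Properties.Semiring.Exp semiring using (_^_; ^-homo-*)
  open Algebra.Properties.Ring ring
  open IntegerSolver K
  open Matrices K
  open Lattices K conjugation
  open Reduction K conjugation
  open Existence K conjugation using (search; 1ₘ-diagonal)
  open IntegralGL

  1ₘ-off-diagonal : ∀ {n} {s t : Fin n} → ¬ s ≡ t → 1ₘ s t ≈ 0#
  1ₘ-off-diagonal {s = s} {t} s≢t with s Fin.≟ t
  ... | yes e = ⊥-elim (s≢t e)
  ... | no _  = refl

  -- The inequality of ranks for P Q ≡ 1 modulo z, restricted to the rows
  -- of P in p, when only the columns of P in q matter.
  rank-≤ : ∀ {m n} (p : Fin m → Bool) (q : Fin n → Bool) (P : Mat m n) (Q : Mat n m) →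
    Integralₘ P → Integralₘ Q →
    (∀ s t → p s ≡ true → p t ≡ true → Nonunit ((P ⋆ Q) s t - 1ₘ s t)) →
    (∀ s t l → p s ≡ true → p t ≡ true → q l ≡ false → Nonunit (P s l * Q l t)) →
    count p ≤ count q
  rank-≤ {m} {zero} p q P Q P-int Q-int inverse _ = ℕ.≤-reflexive (count-empty p empty)
    where
    empty : ∀ s → p s ≡ false
    empty s with p s in ps
    ... | false = ≡.refl
    -- Without columns the product is 0, so a row in `p` would put 1 into (z).
    ... | true  = ⊥-elim (nonunit-unit (nonunit-resp (trans (-‿cong (trans (+-identityˡ _) (-‿cong
        (1ₘ-diagonal s)))) (-‿involutive 1#))
                    (nonunit-neg (inverse s s ps ps))) unit-1)
  rank-≤ {m} {suc n} p q P Q P-int Q-int inverse negligible = by-cases (q zero) ≡.refl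
    where
    P′ : Mat m n
    P′ s l = P s (suc l)
    Q′ : Mat n m
    Q′ l = Q (suc l)
    drop : (∀ s t → p s ≡ true → p t ≡ true → Nonunit (P s zero * Q zero t)) → count p ≤ count (q ∘ suc)
    drop first = rank-≤ p (q ∘ suc) P′ Q′ (λ s l → P-int s (suc l)) (λ l → Q-int (suc l))
      (λ s t ps pt → nonunit-resp
        (solve 3 (λ a b d → (a :+ b) :- d :+ :- a := b :- d) refl (P s zero * Q zero t) ((P′ ⋆ Q′) s t) (1ₘ s t))
        (nonunit-+ (inverse s t ps pt) (nonunit-neg (first s t ps pt))))
      (λ s t l → negligible s t (suc l))

    eliminate : ∀ s₀ → p s₀ ≡ true → Unit (P s₀ zero) → count p ≤ suc (count (q ∘ suc))
    eliminate s₀ ps₀ (u , u-int , Pu≈1) = ℕ.≤-trans (ℕ.≤-reflexive (count-remove s₀ p ps₀)) (s≤s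
      (rank-≤ (remove s₀ p) (q ∘ suc) P″ Q′ (λ s l → int-+ (P-int s (suc l)) (int-* (x-int s) (P-int s₀
          (suc l)))) (λ l → Q-int (suc l))
        (λ s t ps pt → let _ , ps′ = remove-true s₀ p s ps ; s₀≢t , pt′ = remove-true s₀ p t pt in
          nonunit-resp (product s t s₀≢t)
            (nonunit-+ (inverse s t ps′ pt′) (nonunit-*ˡ (x-int s) (inverse s₀ t ps₀ pt′))))
        (λ s t l ps pt ql → let _ , ps′ = remove-true s₀ p s ps ; _ , pt′ = remove-true s₀ p t pt in
          nonunit-resp (solve 4 (λ a b x y → a :* b :+ x :* (y :* b) := (a :+ x :* y) :* b) refl (P s
              (suc l)) (Q (suc l) t) (x s) (P s₀ (suc l)))
            (nonunit-+ (negligible s t (suc l) ps′ pt′ ql) (nonunit-*ˡ (x-int s) (negligible s₀ t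
                (suc l) ps₀ pt′ ql))))))
      where
      x : Fin m → Carrier
      -- Adding x s times the pivot row clears the first column, which is then dropped together with
      -- the pivot row. The identity matrix is disturbed by x s times its pivot row, which vanishes
      -- in the remaining columns.
      x s = - (P s zero * u)
      x-int : ∀ s → Integral (x s)
      x-int s = int-neg (int-* (P-int s zero) u-int)
      P″ : Mat m n
      P″ s l = P s (suc l) + x s * P s₀ (suc l)
      product : ∀ s t → ¬ s₀ ≡ t → (P ⋆ Q) s t - 1ₘ s t + x s * ((P ⋆ Q) s₀ t - 1ₘ s₀ t) ≈ (P″ ⋆ Q′) s t - 1ₘ s t
      product s t s₀≢t = linear₃ (- x s) (- (P s zero * Q zero t)) (- 1#) (1ₘ-off-diagonal s₀≢t) Pu≈1
        (trans (∙-distribʳ (P′ s) (λ l → x s * P′ s₀ l) Q′ t) (+-congˡ (∙-scale (x s) (P′ s₀) Q′ t)))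
        (solve 9 (λ a b d e p₀ u A B C →
            (a :* b :+ A) :- d :+ (:- (a :* u)) :* ((p₀ :* b :+ B) :- e)
            := C :- d :+ (:- (:- (a :* u))) :* (e :- con (0 , 0)) :+ (:- (a :* b)) :* (p₀ :* u :- con (1 , 0))
              :+ (:- con (1 , 0)) :* (C :- (A :+ (:- (a :* u)) :* B)))
          refl (P s zero) (Q zero t) (1ₘ s t) (1ₘ s₀ t) (P s₀ zero) u ((P′ ⋆ Q′) s t) ((P′ ⋆ Q′) s₀ t)
              ((P″ ⋆ Q′) s t))

    pivot : ∀ s → (p s ≡ true → Nonunit (P s zero)) ⊎ (p s ≡ true × Unit (P s zero))
    pivot s with p s
    ... | false = inj₁ λ ()
    ... | true  = Sum.map (λ nonunit _ → nonunit) (≡.refl ,_) (int-dichotomy (P-int s zero))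

    by-cases : ∀ b → q zero ≡ b → count p ≤ count q
    by-cases false q₀ rewrite q₀ = drop λ s t ps pt → negligible s t zero ps pt q₀
    by-cases true  q₀ rewrite q₀ with search pivot
    ... | inj₁ nonunits = ℕ.m≤n⇒m≤1+n (drop λ s t ps pt → nonunit-* (nonunits s ps) (Q-int zero t))
    ... | inj₂ (s₀ , ps₀ , unit) = eliminate s₀ ps₀ unit

  -- From σ(1, z) = (1, - z) = (1, z) + τ n (0, z^n): σ sends the first row of the block to itself
  -- plus `τ n` times the second. The pole has order n - 1.
  τ : ℕ → Carrier
  τ n = - ((1# + 1#) * (z * z⁻¹ ^ n))

  -- This is (- 1)^n, in the form that makes σ(0, z^n) = sign n (0, z^n) immediate.
  sign : ℕ → Carrier
  sign n = σ (z ^ n) * z⁻¹ ^ n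

  sign-int : ∀ n → Integral (sign n)
  sign-int zero    = int-* (int-σ int-1) int-1
  sign-int (suc n) = int-resp eq (int-neg (sign-int n))
    where
    eq : - sign n ≈ sign (suc n)
    eq = sym (trans (*-congʳ (trans (σ-* z (z ^ n)) (*-congʳ σz≈-z)))
      (linear₁ (- (σ (z ^ n) * z⁻¹ ^ n)) z*z⁻¹≈1
        (solve 4 (λ z y s Y → (:- z :* s) :* (y :* Y) := :- (s :* Y) :+ :- (s :* Y) :* (z :* y :- con
            (1 , 0))) refl z z⁻¹ (σ (z ^ n)) (z⁻¹ ^ n))))

  cocycleBlock : (b : Block) → Mat (size b) (size b)
  cocycleBlock ⟨1⟩         = λ _ _ → 1#
  cocycleBlock ⟨z⟩         = λ _ _ → - 1#
  cocycleBlock (upper n _) = matrix₂ 1# (τ n) 0# (sign n)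

  cocycleDiagonal : ∀ {n} → Blocks n → Mat n n
  cocycleDiagonal []       = λ ()
  cocycleDiagonal (b ∷ bs) = cocycleBlock b ⊞ cocycleDiagonal bs

  σ-block : ∀ b → σₘ (block b) ≈ₘ cocycleBlock b ⋆ block b
  σ-block ⟨1⟩ zero zero = trans σ-1 (solve 0 (con (1 , 0) := con (1 , 0) :* con (1 , 0) :+ con (0 , 0)) refl)
  σ-block ⟨z⟩ zero zero = trans σz≈-z (solve 1 (λ z → :- z := (:- con (1 , 0)) :* z :+ con (0 , 0)) refl z)
  σ-block (upper n _) = ≈-matrix₂
    (trans σ-1 (solve 1 (λ t → con (1 , 0) := con (1 , 0) :* con (1 , 0) :+ (t :* con (0 , 0) :+ con
        (0 , 0))) refl (τ n)))
    (trans σz≈-z (linear₁ ((1# + 1#) * z) (z^*z⁻¹^≈1 n)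
      (solve 3 (λ z Z Y → :- z := con (1 , 0) :* z :+ (:- ((con (1 , 0) :+ con (1 , 0)) :* (z :* Y)) :* Z
          :+ con (0 , 0))
        :+ (con (1 , 0) :+ con (1 , 0)) :* z :* (Z :* Y :- con (1 , 0))) refl z (z ^ n) (z⁻¹ ^ n))))
    (trans σ-0 (solve 1 (λ s → con (0 , 0) := con (0 , 0) :* con (1 , 0) :+ (s :* con (0 , 0) :+ con
        (0 , 0))) refl (sign n)))
    (linear₁ (- σ (z ^ n)) (z^*z⁻¹^≈1 n)
      (solve 4 (λ s z Z Y → s := con (0 , 0) :* z :+ (s :* Y :* Z :+ con (0 , 0)) :+ :- s :* (Z :* Y :- con
          (1 , 0))) refl (σ (z ^ n)) z (z ^ n) (z⁻¹ ^ n)))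

  σ-blockDiagonal : ∀ {n} (bs : Blocks n) → σₘ (blockDiagonal bs) ≈ₘ cocycleDiagonal bs ⋆ blockDiagonal bs
  σ-blockDiagonal []       = λ ()
  σ-blockDiagonal (b ∷ bs) = begin
    σₘ (block b ⊞ blockDiagonal bs)
      ≈⟨ σ-⊞ (block b) (blockDiagonal bs) ⟩
    σₘ (block b) ⊞ σₘ (blockDiagonal bs)
      ≈⟨ ⊞-cong (σ-block b) (σ-blockDiagonal bs) ⟩
    (cocycleBlock b ⋆ block b) ⊞ (cocycleDiagonal bs ⋆ blockDiagonal bs)
      ≈⟨ ⊞-⋆ (cocycleBlock b) (block b) (cocycleDiagonal bs) (blockDiagonal bs) ⟨
    (cocycleBlock b ⊞ cocycleDiagonal bs) ⋆ (block b ⊞ blockDiagonal bs) ∎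
    where open ⋆-Reasoning

  nonunit-σ⁻¹ : ∀ {x} → Nonunit (σ x) → Nonunit x
  nonunit-σ⁻¹ p = nonunit-resp (σ-involutive _) (nonunit-σ p)

  -- The inverse of `τ n` is - ½ z^{n-1}, and n - 1 is at least 1.
  τ-nonunit : ∀ {n x} → 1 < n → Integral (τ n * x) → Nonunit x
  τ-nonunit {suc (suc n)} {x} (s≤s (s≤s z≤n)) p = int-resp eq (int-* (int-* (int-neg int-½) (int-^ n)) p)
    where
    Z = z ^ n
    Z⁻¹ = z⁻¹ ^ n
    eq : - ½ * Z * (τ (suc (suc n)) * x) ≈ z⁻¹ * x
    eq = linear₃ ((½ + ½) * z⁻¹ * x * Z * Z⁻¹) ((½ + ½) * z⁻¹ * x) (z⁻¹ * x) z*z⁻¹≈1 (z^*z⁻¹^≈1 n) ½+½≈1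
      (solve 6 (λ h z y Z Y x → :- h :* Z :* (:- ((con (1 , 0) :+ con (1 , 0)) :* (z :* (y :* (y :* Y)))) :* x)
        := y :* x :+ (h :+ h) :* y :* x :* Z :* Y :* (z :* y :- con (1 , 0)) :+ (h :+ h) :* y :* x :*
            (Z :* Y :- con (1 , 0))
          :+ y :* x :* (h :+ h :- con (1 , 0))) refl ½ z z⁻¹ Z Z⁻¹ x)

  -- Since τ m = τ n z^{n-m}, the worse pole can be factored out, and z^{n-m} y lies in (z).
  τ-nonunit-+ : ∀ {m n x y} → 1 < n → m < n → Integral y → Integral (τ n * x - τ m * y) → Nonunit x
  τ-nonunit-+ {m} {n} {x} {y} 1<n m<n y-int p = nonunit-resp
    (solve 2 (λ x w → x :- w :+ w := x) refl x (z ^ suc k * y))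
    (nonunit-+ (τ-nonunit 1<n (int-resp shift-τ p)) (nonunit-* (nonunit-z^ k) y-int))
    where
    k = n ℕ.∸ suc m
    n≡ : n ≡ suc k ℕ.+ m
    n≡ = ≡.trans (≡.sym (ℕ.m∸n+n≡m m<n)) (ℕ.+-suc k m)
    τ-shift : τ n * z ^ suc k ≈ τ m
    τ-shift = begin
      τ n * z ^ suc k
        ≈⟨ *-congʳ (-‿cong (*-congˡ (*-congˡ (trans (reflexive (≡.cong (z⁻¹ ^_) n≡)) (^-homo-* z⁻¹ (suc k) m))))) ⟩
      - ((1# + 1#) * (z * (z⁻¹ ^ suc k * z⁻¹ ^ m))) * z ^ suc k
        ≈⟨ linear₁ (- ((1# + 1#) * (z * z⁻¹ ^ m))) (z^*z⁻¹^≈1 (suc k))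
             (solve 4 (λ z Z Y W → :- ((con (1 , 0) :+ con (1 , 0)) :* (z :* (Y :* W))) :* Z
               := :- ((con (1 , 0) :+ con (1 , 0)) :* (z :* W)) :+ :- ((con (1 , 0) :+ con (1 , 0)) :*
                   (z :* W)) :* (Z :* Y :- con (1 , 0)))
               refl z (z ^ suc k) (z⁻¹ ^ suc k) (z⁻¹ ^ m)) ⟩
      τ m ∎
      where open Relation.Binary.Reasoning.Setoid setoid
    shift-τ : τ n * x - τ m * y ≈ τ n * (x - z ^ suc k * y)
    shift-τ = linear₁ y τ-shift
      (solve 5 (λ a b x y Z → a :* x :- b :* y := a :* (x :- Z :* y) :+ y :* (a :* Z :- b)) refl (τ n)
          (τ m) x y (z ^ suc k))

  -- The condition on A for A g′ = g H with H fixed by σ, where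
  -- σ(g) = T g and σ(g′) = T′ g′.
  Intertwines : ∀ {m n} → Mat m m → Mat n n → Mat m n → Set ℓ
  Intertwines T T′ A = σₘ A ⋆ T′ ≈ₘ T ⋆ A

  -- All poles of a cocycle block sit in its second column, whose key is `nothing`.
  column-int : ∀ c t {b} → key c t ≡ just b → ∀ s → Integral (cocycleBlock c s t)
  column-int ⟨1⟩         t       e s       = int-1
  column-int ⟨z⟩         t       e s       = int-neg int-1
  column-int (upper _ _) zero    e zero    = int-1
  column-int (upper _ _) zero    e (suc _) = int-0

  -- σ is the identity modulo z, so x is congruent to - x, and 2 is invertible.
  vanishing-sign : ∀ {x} → Integral x → σ x ≈ - x → Nonunit x
  vanishing-sign {x} x-int e = nonunit-resp
    (linear₂ (- ½) x e ½+½≈1 (solve 3 (λ h x s → h :* (x :- s) := x :+ :- h :* (s :- :- x) :+ x :* (h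
        :+ h :- con (1 , 0))) refl ½ x (σ x)))
    (nonunit-*ˡ int-½ (σ-residual x-int))

  -- Each clause reads one entry of σ(A) T′ = T A. Between the two signs it gives σ(a) = - a. For a
  -- target `upper n` the entry in the second column contains τ n σ(a), while all other terms are
  -- integral or have the milder pole τ m; so a lies in (z).
  vanishing-block : ∀ b c (A : Mat (size b) (size c)) → Integralₘ A →
    Intertwines (cocycleBlock b) (cocycleBlock c) A → ∀ s t → Vanishing (key b s) (key c t) → Nonunit (A s t)
  vanishing-block ⟨1⟩ ⟨z⟩ A A-int e zero zero v = vanishing-sign (A-int zero zero)
    (linear₁ (- 1#) (e zero zero) (solve 2 (λ a s → s := :- a :+ :- con (1 , 0) :* (s :* :- con (1 , 0)
        :+ con (0 , 0) :- (con (1 , 0) :* a :+ con (0 , 0))))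
      refl (A zero zero) (σ (A zero zero))))
  vanishing-block ⟨z⟩ ⟨1⟩ A A-int e zero zero v = vanishing-sign (A-int zero zero)
    (linear₁ 1# (e zero zero) (solve 2 (λ a s → s := :- a :+ con (1 , 0) :* (s :* con (1 , 0) :+ con
        (0 , 0) :- (:- con (1 , 0) :* a :+ con (0 , 0))))
      refl (A zero zero) (σ (A zero zero))))
  vanishing-block ⟨1⟩ (upper n 1<n) A A-int e zero zero v = nonunit-σ⁻¹ (τ-nonunit 1<n (int-resp
    (linear₁ (- 1#) (e zero (suc zero)) (solve 5 (λ s a t b σb → con (1 , 0) :* b :- σb :* s
       := t :* a :+ :- con (1 , 0) :* (a :* t :+ (σb :* s :+ con (0 , 0)) :- (con (1 , 0) :* b :+ con (0 , 0)))) refl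
       (sign n) (σ (A zero zero)) (τ n) (A zero (suc zero)) (σ (A zero (suc zero)))))
    (int-+ (int-* int-1 (A-int zero (suc zero))) (int-neg (int-* (int-σ (A-int zero (suc zero))) (sign-int n))))))
  vanishing-block ⟨z⟩ (upper n 1<n) A A-int e zero zero v = nonunit-σ⁻¹ (τ-nonunit 1<n (int-resp
    (linear₁ (- 1#) (e zero (suc zero)) (solve 5 (λ s a t b σb → :- con (1 , 0) :* b :- σb :* s
       := t :* a :+ :- con (1 , 0) :* (a :* t :+ (σb :* s :+ con (0 , 0)) :- (:- con (1 , 0) :* b :+ con
           (0 , 0)))) refl
       (sign n) (σ (A zero zero)) (τ n) (A zero (suc zero)) (σ (A zero (suc zero)))))
    (int-+ (int-* (int-neg int-1) (A-int zero (suc zero))) (int-neg (int-* (int-σ (A-int zero (suc zero)))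
        (sign-int n))))))
  vanishing-block (upper m _) (upper n 1<n) A A-int e zero zero (upper-upper m<n) = nonunit-σ⁻¹
      (τ-nonunit-+ 1<n m<n (A-int (suc zero) (suc zero)) (int-resp
    (linear₁ (- 1#) (e zero (suc zero)) (solve 7 (λ s a t b σb t′ d → con (1 , 0) :* b :- σb :* s
       := t :* a :- t′ :* d :+ :- con (1 , 0) :* (a :* t :+ (σb :* s :+ con (0 , 0)) :- (con (1 , 0) :* b :+
           (t′ :* d :+ con (0 , 0))))) refl
       (sign n) (σ (A zero zero)) (τ n) (A zero (suc zero)) (σ (A zero (suc zero))) (τ m) (A (suc zero) (suc zero))))
    (int-+ (int-* int-1 (A-int zero (suc zero))) (int-neg (int-* (int-σ (A-int zero (suc zero))) (sign-int n))))))
  -- The second row of the source block is (σ(x) - x) / τ m for its first row x. In a column with a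
  -- `just` key the image of σ(x) is integral, and division by the pole τ m lands in (z).
  vanishing-block (upper m 1<m) c A A-int e (suc zero) t v = τ-nonunit 1<m (int-resp
    (linear₁ 1# (e zero t) (solve 4 (λ a b t x → x :- a := t :* b :+ con (1 , 0) :* (x :- (con (1 , 0) :* a
        :+ (t :* b :+ con (0 , 0))))) refl
      (A zero t) (A (suc zero) t) (τ m) ((σₘ A ⋆ cocycleBlock c) zero t)))
    (int-+ (int-sum λ l → int-* (int-σ (A-int zero l)) (column-int c t (just-key v) l)) (int-neg (A-int zero t))))
    where
    just-key : ∀ {k} → Vanishing nothing k → k ≡ just (fromMaybe ⟨1⟩ k)
    just-key lowest = ≡.refl

  -- The cocycle of the target is block diagonal, so the intertwining relation holds for each block
  -- of columns of `A` separately.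
  vanishing-row : ∀ b {n} (cs : Blocks n) (A : Mat (size b) n) → Integralₘ A →
    Intertwines (cocycleBlock b) (cocycleDiagonal cs) A → ∀ s t → Vanishing (key b s) (keys cs t) → Nonunit (A s t)
  vanishing-row b [] A A-int e s ()
  vanishing-row b (c ∷ cs) A A-int e s = split {p = size c} (λ t → Vanishing (key b s) (keys (c ∷ cs) t) →
      Nonunit (A s t))
    (λ t v → vanishing-block b c (λ s t → A s (t ↑ˡ _)) (λ s t → A-int s (t ↑ˡ _))
      (λ s t → trans (sym (∙-⊞ˡ (cocycleBlock c) (cocycleDiagonal cs) (σᵥ (A s)) t)) (e s (t ↑ˡ _))) s t
      (≡.subst (λ x → Vanishing (key b s) ([ key c , keys cs ]′ x)) (Fin.splitAt-↑ˡ (size c) t _) v))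
    (λ t v → vanishing-row b cs (λ s t → A s (size c ↑ʳ t)) (λ s t → A-int s (size c ↑ʳ t))
      (λ s t → trans (sym (∙-⊞ʳ (cocycleBlock c) (cocycleDiagonal cs) (σᵥ (A s)) t)) (e s (size c ↑ʳ t))) s t
      (≡.subst (λ x → Vanishing (key b s) ([ key c , keys cs ]′ x)) (Fin.splitAt-↑ʳ (size c) _ t) v))

  vanishing : ∀ {m n} (bs : Blocks m) (cs : Blocks n) (A : Mat m n) → Integralₘ A →
    Intertwines (cocycleDiagonal bs) (cocycleDiagonal cs) A → ∀ s t → Vanishing (keys bs s) (keys cs t) →
        Nonunit (A s t)
  vanishing [] cs A A-int e ()
  vanishing (b ∷ bs) cs A A-int e = split {p = size b} (λ s → ∀ t → Vanishing (keys (b ∷ bs) s) (keys cs t) →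
      Nonunit (A s t))
    (λ s t v → vanishing-row b cs (λ s → A (s ↑ˡ _)) (λ s → A-int (s ↑ˡ _))
      (λ s t → trans (e (s ↑ˡ _) t) (⊞-∙ˡ (cocycleBlock b) (cocycleDiagonal bs) s A t)) s t
      (≡.subst (λ x → Vanishing ([ key b , keys bs ]′ x) (keys cs t)) (Fin.splitAt-↑ˡ (size b) s _) v))
    (λ s t v → vanishing bs cs (λ s → A (size b ↑ʳ s)) (λ s → A-int (size b ↑ʳ s))
      (λ s t → trans (e (size b ↑ʳ s) t) (⊞-∙ʳ (cocycleBlock b) (cocycleDiagonal bs) s A t)) s t
      (≡.subst (λ x → Vanishing ([ key b , keys bs ]′ x) (keys cs t)) (Fin.splitAt-↑ʳ (size b) _ s) v))

  -- The rank inequality is applied to the rows and columns of level b. In A A′ = 1 the other levels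
  -- contribute nothing modulo z, by `vanishing-trichotomy`; exchanging A and A′ gives the opposite
  -- inequality.
  multiplicity-≤ : ∀ {m n} (bs : Blocks m) (cs : Blocks n) (A : Mat m n) (A′ : Mat n m) →
    Integralₘ A → Integralₘ A′ → A ⋆ A′ ≈ₘ 1ₘ →
    Intertwines (cocycleDiagonal bs) (cocycleDiagonal cs) A → Intertwines (cocycleDiagonal cs)
        (cocycleDiagonal bs) A′ →
    ∀ b → multiplicity b (toList bs) ≤ multiplicity b (toList cs)
  multiplicity-≤ bs cs A A′ A-int A′-int AA′≈1 e e′ b = ≡.subst₂ _≤_ (count-keys b bs) (count-keys b cs)
    (rank-≤ (λ s → does (keys bs s ≟ᵏ just b)) (λ s → does (keys cs s ≟ᵏ just b)) A A′ A-int A′-int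
      (λ s t _ _ → nonunit-resp (sym (trans (+-congʳ (AA′≈1 s t)) (-‿inverseʳ _))) nonunit-0)
      (λ s t l ps pt ql → negligible s t l (holds (keys bs s ≟ᵏ just b) ps) (holds (keys bs t ≟ᵏ just b) pt)
          (fails (keys cs l ≟ᵏ just b) ql)))
    where
    holds : ∀ {p} {P : Set p} (P? : Dec P) → does P? ≡ true → P
    holds (yes p) _ = p
    fails : ∀ {p} {P : Set p} (P? : Dec P) → does P? ≡ false → ¬ P
    fails (no ¬p) _ = ¬p
    negligible : ∀ s t l → keys bs s ≡ just b → keys bs t ≡ just b → ¬ keys cs l ≡ just b → Nonunit (A s l * A′ l t)
    negligible s t l ks kt kl with vanishing-trichotomy b (keys cs l)
    ... | inj₁ eq       = ⊥-elim (kl eq)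
    ... | inj₂ (inj₁ v) = nonunit-* (vanishing bs cs A A-int e s l (≡.subst (λ k → Vanishing k (keys cs l))
        (≡.sym ks) v)) (A′-int l t)
    ... | inj₂ (inj₂ v) = nonunit-*ˡ (A-int s l) (vanishing cs bs A′ A′-int e′ l t (≡.subst (Vanishing
        (keys cs l)) (≡.sym kt) v))

  unique : ∀ {n} (bs cs : Blocks n) (α : IntegralGL n) (H D : Mat n n) →
    matrix α ⋆ blockDiagonal cs ≈ₘ blockDiagonal bs ⋆ H → σₘ H ≈ₘ H → blockDiagonal cs ⋆ D ≈ₘ 1ₘ →
    toList bs ↭ toList cs
  unique bs cs α H D AC≈BH σH≈H CD≈1 = ↭-from-multiplicity (toList bs) (toList cs) λ b → ℕ.≤-antisym
    (multiplicity-≤ bs cs A A⁻¹ (matrix-int α) (inverse-int α) (inverseʳ α) e e⁻¹ b)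
    (multiplicity-≤ cs bs A⁻¹ A (inverse-int α) (matrix-int α) (inverseˡ α) e⁻¹ e b)
    where
    open ⋆-Reasoning
    A = matrix α
    A⁻¹ = inverse α
    B = blockDiagonal bs
    C = blockDiagonal cs
    T = cocycleDiagonal bs
    T′ = cocycleDiagonal cs
    -- σ is applied to A C = B H, where H is fixed; the invertible factor C is cancelled afterwards.
    eC : σₘ A ⋆ T′ ⋆ C ≈ₘ T ⋆ A ⋆ C
    eC = begin
      σₘ A ⋆ T′ ⋆ C     ≈⟨ ⋆-assoc (σₘ A) T′ C ⟩
      σₘ A ⋆ (T′ ⋆ C)   ≈⟨ ⋆-cong (≈ₘ.refl {x = σₘ A}) (σ-blockDiagonal cs) ⟨
      σₘ A ⋆ σₘ C       ≈⟨ σ-⋆ A C ⟨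
      σₘ (A ⋆ C)        ≈⟨ σₘ-cong AC≈BH ⟩
      σₘ (B ⋆ H)        ≈⟨ σ-⋆ B H ⟩
      σₘ B ⋆ σₘ H       ≈⟨ ⋆-cong (σ-blockDiagonal bs) σH≈H ⟩
      T ⋆ B ⋆ H         ≈⟨ ⋆-assoc T B H ⟩
      T ⋆ (B ⋆ H)       ≈⟨ ⋆-cong (≈ₘ.refl {x = T}) AC≈BH ⟨
      T ⋆ (A ⋆ C)       ≈⟨ ⋆-assoc T A C ⟨
      T ⋆ A ⋆ C         ∎
    e : Intertwines T T′ A
    e = begin
      σₘ A ⋆ T′          ≈⟨ ⋆-cancelʳ (σₘ A ⋆ T′) CD≈1 ⟨
      σₘ A ⋆ T′ ⋆ C ⋆ D  ≈⟨ ⋆-cong eC (≈ₘ.refl {x = D}) ⟩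
      T ⋆ A ⋆ C ⋆ D      ≈⟨ ⋆-cancelʳ (T ⋆ A) CD≈1 ⟩
      T ⋆ A              ∎
    e⁻¹ : Intertwines T′ T A⁻¹
    e⁻¹ = begin
      σₘ A⁻¹ ⋆ T                    ≈⟨ ⋆-cancelʳ (σₘ A⁻¹ ⋆ T) (inverseʳ α) ⟨
      σₘ A⁻¹ ⋆ T ⋆ A ⋆ A⁻¹          ≈⟨ ⋆-cong (⋆-assoc (σₘ A⁻¹) T A) (≈ₘ.refl {x = A⁻¹}) ⟩
      σₘ A⁻¹ ⋆ (T ⋆ A) ⋆ A⁻¹        ≈⟨ ⋆-cong (⋆-cong (≈ₘ.refl {x = σₘ A⁻¹}) e) (≈ₘ.refl {x = A⁻¹}) ⟨
      σₘ A⁻¹ ⋆ (σₘ A ⋆ T′) ⋆ A⁻¹    ≈⟨ ⋆-cong (⋆-cancelˡ T′ (σ-inverse (inverseˡ α))) (≈ₘ.refl {x = A⁻¹}) ⟩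
      T′ ⋆ A⁻¹                      ∎

-- Laurent series as fractions with powers of z as denominators

-- The properties of the ring of power series (as coefficient sequences)
-- on which the arithmetic of Laurent series rests; conj is z ↦ - z.
record SeriesRing (A : Set c) ℓ : Set (c ⊔ lsuc ℓ) where
  field
    _≈_               : Rel (ℕ → A) ℓ
    _+_ _*_           : Op₂ (ℕ → A)
    -_                : Op₁ (ℕ → A)
    0# 1#             : ℕ → A
    isCommutativeRing : IsCommutativeRing _≈_ _+_ _*_ -_ 0# 1#

  commutativeRing : CommutativeRing c ℓ
  commutativeRing = record { isCommutativeRing = isCommutativeRing }

  open RingMorphisms (CommutativeRing.rawRing commutativeRing) (CommutativeRing.rawRing commutativeRing)
    using (IsRingHomomorphism)

  field
    shift        : ℕ → (ℕ → A) → ℕ → A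
    shift-cong   : ∀ d {f g} → f ≈ g → shift d f ≈ shift d g
    shift-cancel : ∀ d {f g} → shift d f ≈ shift d g → f ≈ g
    shift-0      : ∀ f → shift 0 f ≈ f
    shift-+      : ∀ d e f → shift (d ℕ.+ e) f ≈ shift d (shift e f)
    shift-*      : ∀ d f g → (shift d f * g) ≈ shift d (f * g)
    conj            : (ℕ → A) → ℕ → A
    conj-homo       : IsRingHomomorphism conj
    conj-involutive : ∀ f → conj (conj f) ≈ f
    conj-shift      : ∀ f → conj (shift 1 f) ≈ (- shift 1 (conj f))
    expand           : (ℕ → A) → ℕ → A
    expand-homo      : IsRingHomomorphism expand
    expand-injective : ∀ {f g} → expand f ≈ expand g → f ≈ g
    expand-shift     : ∀ d f → expand (shift d f) ≈ shift (2 ℕ.* d) (expand f)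
    conj-expand      : ∀ f → conj (expand f) ≈ expand f
    conj-fixed       : ∀ f → conj f ≈ f → ∃[ g ] f ≈ expand g
    ½         : ℕ → A
    ½+½≈1     : (½ + ½) ≈ 1#
    dichotomy : ∀ f → (∃[ g ] f ≈ shift 1 g) ⊎ (∃[ u ] (f * u) ≈ 1#)
    proper    : ∀ f → ¬ 1# ≈ shift 1 f
    residual  : ∀ f → ∃[ g ] (f + (- conj f)) ≈ shift 1 g

module LaurentRing {A : Set c} (S : SeriesRing A ℓ) where
  open SeriesRing S using (commutativeRing; shift; shift-cong; shift-cancel; shift-0; shift-+; shift-*)
  open CommutativeRing commutativeRing hiding (zero; isCommutativeRing)
  open Algebra.Properties.Ring ring
  open IntegerSolver commutativeRing
  open Relation.Binary.Reasoning.Setoid setoid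
  open LaurentSeries renaming (poleBound to pole)

  z^ : ℕ → Carrier
  z^ d = shift d 1#

  -- As products with z^d, shifts become visible to the solver, and the bookkeeping of poles turns
  -- into polynomial identities.
  shift≈ : ∀ d f → shift d f ≈ z^ d * f
  shift≈ d f = sym (trans (shift-* d 1# f) (shift-cong d (*-identityˡ f)))

  z^-+ : ∀ d e → z^ (d ℕ.+ e) ≈ z^ d * z^ e
  z^-+ d e = trans (shift-+ d e 1#) (shift≈ d (z^ e))

  z^-0 : z^ 0 ≈ 1#
  z^-0 = shift-0 1#

  z^-cancel : ∀ d {f g} → z^ d * f ≈ z^ d * g → f ≈ g
  z^-cancel d {f} {g} p = shift-cancel d (trans (shift≈ d f) (trans p (sym (shift≈ d g))))

  Laurent : Set c
  Laurent = LaurentSeries A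

  infix 4 _≈ᶠ_
  -- This formula and the operations below follow those of `k⸨z⸩`, so that for power series over k
  -- the two rings agree by computation.
  _≈ᶠ_ : Laurent → Laurent → Set ℓ
  x ≈ᶠ y = shift (pole y) (series x) ≈ shift (pole x) (series y)

  infixl 6 _+ᶠ_
  infixl 7 _*ᶠ_
  _+ᶠ_ _*ᶠ_ : Laurent → Laurent → Laurent
  x +ᶠ y = z^- pole x ℕ.+ pole y · (shift (pole y) (series x) + shift (pole x) (series y))
  x *ᶠ y = z^- pole x ℕ.+ pole y · (series x * series y)

  -ᶠ_ : Laurent → Laurent
  -ᶠ x = z^- pole x · (- series x)

  ι : Carrier → Laurent
  ι f = z^- 0 · f

  ≈ᶠ-intro : ∀ {d f e g D F E G} → z^ d ≈ D → f ≈ F → z^ e ≈ E → g ≈ G → E * F ≈ D * G → (z^- d · f) ≈ᶠ (z^- e · g)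
  ≈ᶠ-intro {d} {f} {e} {g} {D} {F} {E} {G} p q r s t = begin
    shift e f  ≈⟨ shift≈ e f ⟩
    z^ e * f   ≈⟨ *-cong r q ⟩
    E * F      ≈⟨ t ⟩
    D * G      ≈⟨ *-cong p s ⟨
    z^ d * g   ≈⟨ shift≈ d g ⟨
    shift d g  ∎

  ≈ᶠ-elim : ∀ {x y} → x ≈ᶠ y → z^ (pole y) * series x ≈ z^ (pole x) * series y
  ≈ᶠ-elim {x} {y} p = trans (sym (shift≈ (pole y) (series x))) (trans p (shift≈ (pole x) (series y)))

  ≈ᶠ-series : ∀ {d f g} → f ≈ g → (z^- d · f) ≈ᶠ (z^- d · g)
  ≈ᶠ-series {d} p = shift-cong d p

  +-series : ∀ x y → series (x +ᶠ y) ≈ z^ (pole y) * series x + z^ (pole x) * series y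
  +-series x y = +-cong (shift≈ (pole y) (series x)) (shift≈ (pole x) (series y))

  private
    z₃ : ∀ d e h → z^ (d ℕ.+ e ℕ.+ h) ≈ z^ d * z^ e * z^ h
    z₃ d e h = trans (z^-+ (d ℕ.+ e) h) (*-congʳ (z^-+ d e))

    z₃′ : ∀ d e h → z^ (d ℕ.+ (e ℕ.+ h)) ≈ z^ d * (z^ e * z^ h)
    z₃′ d e h = trans (z^-+ d (e ℕ.+ h)) (*-congˡ (z^-+ e h))

  isCommutativeRing : IsCommutativeRing _≈ᶠ_ _+ᶠ_ _*ᶠ_ -ᶠ_ (ι 0#) (ι 1#)
  isCommutativeRing = record
    { isRing = record
      { +-isAbelianGroup = record
        { isGroup = record
          { isMonoid = record
            { isSemigroup = record
              { isMagma = record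
                { isEquivalence = record { refl = refl ; sym = sym ; trans = λ {x} {y} {w} → transᶠ {x} {y} {w} }
                ; ∙-cong = λ {x} {x′} {y} {y′} → +-congᶠ {x} {x′} {y} {y′}
                }
              ; assoc = +-assocᶠ
              }
            ; identity = (λ x → transᶠ {ι 0# +ᶠ x} {x +ᶠ ι 0#} {x} (+-commᶠ (ι 0#) x) (+-identityʳᶠ x)) , +-identityʳᶠ
            }
          ; inverse = (λ x → transᶠ {(-ᶠ x) +ᶠ x} {x +ᶠ (-ᶠ x)} {ι 0#} (+-commᶠ (-ᶠ x) x)
              (+-inverseʳᶠ x)) , +-inverseʳᶠ
          ; ⁻¹-cong = λ {x} {y} → neg-congᶠ {x} {y}
          }
        ; comm = +-commᶠ
        }
      ; *-cong = λ {x} {x′} {y} {y′} → *-congᶠ {x} {x′} {y} {y′}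
      ; *-assoc = *-assocᶠ
      ; *-identity = (λ x → transᶠ {ι 1# *ᶠ x} {x *ᶠ ι 1#} {x} (*-commᶠ (ι 1#) x) (*-identityʳᶠ x)) , *-identityʳᶠ
      ; distrib = distribˡᶠ , λ x y w → transᶠ {(y +ᶠ w) *ᶠ x} {x *ᶠ (y +ᶠ w)} {y *ᶠ x +ᶠ w *ᶠ x} (*-commᶠ (y +ᶠ w) x)
          (transᶠ {x *ᶠ (y +ᶠ w)} {x *ᶠ y +ᶠ x *ᶠ w} {y *ᶠ x +ᶠ w *ᶠ x} (distribˡᶠ x y w)
            (+-congᶠ {x *ᶠ y} {y *ᶠ x} {x *ᶠ w} {w *ᶠ x} (*-commᶠ x y) (*-commᶠ x w)))
      }
    ; *-comm = *-commᶠ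
    }
    where
    transᶠ : ∀ {x y w} → x ≈ᶠ y → y ≈ᶠ w → x ≈ᶠ w
    -- The two cross-multiplied equations combine after multiplication by z^e, the middle
    -- denominator, which is then cancelled.
    transᶠ {z^- d · f} {z^- e · g} {z^- h · l} p q = ≈ᶠ-intro refl refl refl refl (z^-cancel e
      (linear₂ (z^ h) (z^ d) (≈ᶠ-elim {z^- d · f} {z^- e · g} p) (≈ᶠ-elim {z^- e · g} {z^- h · l} q)
        (solve 6 (λ D f E g H l → E :* (H :* f) := E :* (D :* l) :+ H :* (E :* f :- D :* g) :+ D :*
            (H :* g :- E :* l))
          refl (z^ d) f (z^ e) g (z^ h) l)))
    +-congᶠ : ∀ {x x′ y y′} → x ≈ᶠ x′ → y ≈ᶠ y′ → x +ᶠ y ≈ᶠ x′ +ᶠ y′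
    +-congᶠ {x@(z^- d · f)} {x′@(z^- d′ · f′)} {y@(z^- e · g)} {y′@(z^- e′ · g′)} p q =
      ≈ᶠ-intro (z^-+ d e) (+-series x y) (z^-+ d′ e′) (+-series x′ y′)
      (linear₂ (z^ e * z^ e′) (z^ d * z^ d′) (≈ᶠ-elim {x} {x′} p) (≈ᶠ-elim {y} {y′} q)
        (solve 8 (λ D f D′ f′ E g E′ g′ → (D′ :* E′) :* (E :* f :+ D :* g)
           := (D :* E) :* (E′ :* f′ :+ D′ :* g′) :+ E :* E′ :* (D′ :* f :- D :* f′) :+ D :* D′ :*
               (E′ :* g :- E :* g′))
          refl (z^ d) f (z^ d′) f′ (z^ e) g (z^ e′) g′))
    *-congᶠ : ∀ {x x′ y y′} → x ≈ᶠ x′ → y ≈ᶠ y′ → x *ᶠ y ≈ᶠ x′ *ᶠ y′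
    *-congᶠ {x@(z^- d · f)} {x′@(z^- d′ · f′)} {y@(z^- e · g)} {y′@(z^- e′ · g′)} p q =
      ≈ᶠ-intro (z^-+ d e) refl (z^-+ d′ e′) refl
      (linear₂ (z^ e′ * g) (z^ d * f′) (≈ᶠ-elim {x} {x′} p) (≈ᶠ-elim {y} {y′} q)
        (solve 8 (λ D f D′ f′ E g E′ g′ → (D′ :* E′) :* (f :* g)
           := (D :* E) :* (f′ :* g′) :+ E′ :* g :* (D′ :* f :- D :* f′) :+ D :* f′ :* (E′ :* g :- E :* g′))
          refl (z^ d) f (z^ d′) f′ (z^ e) g (z^ e′) g′))
    neg-congᶠ : ∀ {x y} → x ≈ᶠ y → -ᶠ x ≈ᶠ -ᶠ y
    neg-congᶠ {x@(z^- d · f)} {y@(z^- e · g)} p = ≈ᶠ-intro refl refl refl refl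
      (linear₁ (- 1#) (≈ᶠ-elim {x} {y} p)
        (solve 4 (λ D f E g → E :* (:- f) := D :* (:- g) :+ :- con (1 , 0) :* (E :* f :- D :* g)) refl
            (z^ d) f (z^ e) g))
    +-assocᶠ : ∀ x y w → (x +ᶠ y) +ᶠ w ≈ᶠ x +ᶠ (y +ᶠ w)
    +-assocᶠ x@(z^- d · f) y@(z^- e · g) w@(z^- h · l) = ≈ᶠ-intro
      (z₃ d e h) (trans (+-series (x +ᶠ y) w) (+-cong (*-congˡ (+-series x y)) (*-congʳ (z^-+ d e))))
      (z₃′ d e h) (trans (+-series x (y +ᶠ w)) (+-cong (*-congʳ (z^-+ e h)) (*-congˡ (+-series y w))))
      (solve 6 (λ D f E g H l → (D :* (E :* H)) :* (H :* (E :* f :+ D :* g) :+ D :* E :* l)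
          := (D :* E :* H) :* (E :* H :* f :+ D :* (H :* g :+ E :* l)))
        refl (z^ d) f (z^ e) g (z^ h) l)
    +-commᶠ : ∀ x y → x +ᶠ y ≈ᶠ y +ᶠ x
    +-commᶠ x@(z^- d · f) y@(z^- e · g) = ≈ᶠ-intro (z^-+ d e) (+-series x y) (z^-+ e d) (+-series y x)
      (solve 4 (λ D f E g → (E :* D) :* (E :* f :+ D :* g) := (D :* E) :* (D :* g :+ E :* f)) refl (z^ d) f (z^ e) g)
    +-identityʳᶠ : ∀ x → x +ᶠ ι 0# ≈ᶠ x
    +-identityʳᶠ x@(z^- d · f) = ≈ᶠ-intro (trans (z^-+ d 0) (*-congˡ z^-0)) (trans (+-series x (ι 0#))
        (+-congʳ (*-congʳ z^-0))) refl refl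
      (solve 2 (λ D f → D :* (con (1 , 0) :* f :+ D :* con (0 , 0)) := (D :* con (1 , 0)) :* f) refl (z^ d) f)
    +-inverseʳᶠ : ∀ x → x +ᶠ (-ᶠ x) ≈ᶠ ι 0#
    +-inverseʳᶠ x@(z^- d · f) = ≈ᶠ-intro (z^-+ d d) (+-series x (-ᶠ x)) z^-0 refl
      (solve 2 (λ D f → con (1 , 0) :* (D :* f :+ D :* (:- f)) := (D :* D) :* con (0 , 0)) refl (z^ d) f)
    *-assocᶠ : ∀ x y w → (x *ᶠ y) *ᶠ w ≈ᶠ x *ᶠ (y *ᶠ w)
    *-assocᶠ (z^- d · f) (z^- e · g) (z^- h · l) = ≈ᶠ-intro (z₃ d e h) refl (z₃′ d e h) refl
      (solve 6 (λ D f E g H l → (D :* (E :* H)) :* (f :* g :* l) := (D :* E :* H) :* (f :* (g :* l))) refl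
          (z^ d) f (z^ e) g (z^ h) l)
    *-commᶠ : ∀ x y → x *ᶠ y ≈ᶠ y *ᶠ x
    *-commᶠ (z^- d · f) (z^- e · g) = ≈ᶠ-intro (z^-+ d e) refl (z^-+ e d) refl
      (solve 4 (λ D f E g → (E :* D) :* (f :* g) := (D :* E) :* (g :* f)) refl (z^ d) f (z^ e) g)
    *-identityʳᶠ : ∀ x → x *ᶠ ι 1# ≈ᶠ x
    *-identityʳᶠ (z^- d · f) = ≈ᶠ-intro (trans (z^-+ d 0) (*-congˡ z^-0)) refl refl refl
      (solve 2 (λ D f → D :* (f :* con (1 , 0)) := (D :* con (1 , 0)) :* f) refl (z^ d) f)
    distribˡᶠ : ∀ x y w → x *ᶠ (y +ᶠ w) ≈ᶠ x *ᶠ y +ᶠ x *ᶠ w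
    distribˡᶠ x@(z^- d · f) y@(z^- e · g) w@(z^- h · l) = ≈ᶠ-intro
      (z₃′ d e h) (*-congˡ (+-series y w))
      (trans (z^-+ (d ℕ.+ e) (d ℕ.+ h)) (*-cong (z^-+ d e) (z^-+ d h)))
      (trans (+-series (x *ᶠ y) (x *ᶠ w)) (+-cong (*-congʳ (z^-+ d h)) (*-congʳ (z^-+ d e))))
      (solve 6 (λ D f E g H l → (D :* E :* (D :* H)) :* (f :* (H :* g :+ E :* l))
          := (D :* (E :* H)) :* (D :* H :* (f :* g) :+ D :* E :* (f :* l)))
        refl (z^ d) f (z^ e) g (z^ h) l)

  laurentRing : CommutativeRing c ℓ
  laurentRing = record { isCommutativeRing = isCommutativeRing }

-- The involution and the substitution on Laurent series

module LaurentConjugation {A : Set c} (S : SeriesRing A ℓ) where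
  open SeriesRing S using (commutativeRing; shift; shift-cong; shift-cancel; shift-0; shift-+;
    conj; conj-homo; conj-involutive; conj-shift; expand; expand-homo; expand-injective; expand-shift;
    conj-expand; conj-fixed; ½; ½+½≈1; dichotomy; proper; residual)
  open LaurentRing S
  open CommutativeRing commutativeRing hiding (zero; isCommutativeRing)
  open Algebra.Properties.Ring ring
  open IntegerSolver commutativeRing
  open LaurentSeries renaming (poleBound to pole)
  module F = CommutativeRing laurentRing
  private
    module conj = RingMorphisms.IsRingHomomorphism conj-homo
    module expand = RingMorphisms.IsRingHomomorphism expand-homo
  open RingMorphisms F.rawRing F.rawRing using (IsRingHomomorphism)

  sgn : ℕ → Carrier
  sgn zero    = 1#
  sgn (suc d) = - sgn d

  sgn-+ : ∀ d e → sgn (d ℕ.+ e) ≈ sgn d * sgn e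
  sgn-+ zero    e = sym (*-identityˡ _)
  sgn-+ (suc d) e = trans (-‿cong (sgn-+ d e)) (-‿distribˡ-* _ _)

  sgn-square : ∀ d → sgn d * sgn d ≈ 1#
  sgn-square zero    = *-identityˡ 1#
  sgn-square (suc d) = trans (solve 1 (λ s → :- s :* :- s := s :* s) refl (sgn d)) (sgn-square d)

  conj-sgn : ∀ d → conj (sgn d) ≈ sgn d
  conj-sgn zero    = conj.1#-homo
  conj-sgn (suc d) = trans (conj.-‿homo _) (-‿cong (conj-sgn d))

  conj-z^ : ∀ d → conj (z^ d) ≈ sgn d * z^ d
  conj-z^ zero    = trans (conj.⟦⟧-cong z^-0) (trans conj.1#-homo (trans (sym z^-0) (sym (*-identityˡ _))))
  conj-z^ (suc d) = begin
    conj (z^ (suc d))                ≈⟨ conj.⟦⟧-cong (shift-+ 1 d 1#) ⟩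
    conj (shift 1 (z^ d))            ≈⟨ conj-shift (z^ d) ⟩
    - shift 1 (conj (z^ d))          ≈⟨ -‿cong (trans (shift≈ 1 _) (*-congˡ (conj-z^ d))) ⟩
    - (z^ 1 * (sgn d * z^ d))        ≈⟨ solve 3 (λ z s Z → :- (z :* (s :* Z)) := :- s :* (z :* Z)) refl
        (z^ 1) (sgn d) (z^ d) ⟩
    - sgn d * (z^ 1 * z^ d)          ≈⟨ *-congˡ (z^-+ 1 d) ⟨
    sgn (suc d) * z^ (suc d)         ∎
    where open Relation.Binary.Reasoning.Setoid setoid

  conj-z^-* : ∀ d f → conj (z^ d * f) ≈ sgn d * z^ d * conj f
  conj-z^-* d f = trans (conj.*-homo _ _) (*-congʳ (conj-z^ d))

  σᶠ : Laurent → Laurent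
  σᶠ x = z^- pole x · (sgn (pole x) * conj (series x))

  σᶠ-homo : IsRingHomomorphism σᶠ
  σᶠ-homo = record
    { isSemiringHomomorphism = record
      { isNearSemiringHomomorphism = record
        { +-isMonoidHomomorphism = record
          { isMagmaHomomorphism = record
            { isRelHomomorphism = record { cong = λ {x} {y} → σ-cong {x} {y} }
            ; homo = σ-+
            }
          ; ε-homo = ≈ᶠ-series (trans (*-congˡ conj.0#-homo) (zeroʳ _))
          }
        ; *-homo = λ (z^- d · f) (z^- e · g) → ≈ᶠ-series (trans (*-cong (sgn-+ d e) (conj.*-homo f g))
            (solve 4 (λ a b f g → a :* b :* (f :* g) := a :* f :* (b :* g)) refl (sgn d) (sgn e) (conj f) (conj g)))
        }
      ; 1#-homo = ≈ᶠ-series (trans (*-identityˡ _) conj.1#-homo)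
      }
    ; -‿homo = λ (z^- d · f) → ≈ᶠ-series (trans (*-congˡ (conj.-‿homo f)) (sym (-‿distribʳ-* _ _)))
    }
    where
    σ-cong : ∀ {x y} → x ≈ᶠ y → σᶠ x ≈ᶠ σᶠ y
    σ-cong {x@(z^- d · f)} {y@(z^- e · g)} p = ≈ᶠ-intro refl refl refl refl
      (linear₃ (sgn d * sgn e)  (- (sgn d * z^ e * conj f)) (sgn e * z^ d * conj g)
        (trans (sym (conj-z^-* e f)) (trans (conj.⟦⟧-cong (≈ᶠ-elim {x} {y} p)) (conj-z^-* d g)))
        (sgn-square e) (sgn-square d)
        (solve 6 (λ a b D E f g → E :* (a :* f) := D :* (b :* g) :+ a :* b :* (b :* E :* f :- a :* D :* g)
            :+ :- (a :* E :* f) :* (b :* b :- con (1 , 0)) :+ b :* D :* g :* (a :* a :- con (1 , 0)))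
          refl (sgn d) (sgn e) (z^ d) (z^ e) (conj f) (conj g)))
    σ-+ : ∀ x y → σᶠ (x +ᶠ y) ≈ᶠ σᶠ x +ᶠ σᶠ y
    σ-+ x@(z^- d · f) y@(z^- e · g) = ≈ᶠ-series (trans
      (*-cong (sgn-+ d e) (trans (conj.⟦⟧-cong (+-series x y)) (trans (conj.+-homo _ _) (+-cong
          (conj-z^-* e f) (conj-z^-* d g)))))
      (trans (linear₂ (sgn d * z^ e * conj f) (sgn e * z^ d * conj g) (sgn-square e) (sgn-square d)
        (solve 6 (λ a b D E f g → a :* b :* (b :* E :* f :+ a :* D :* g) := E :* (a :* f) :+ D :* (b :* g)
            :+ a :* E :* f :* (b :* b :- con (1 , 0)) :+ b :* D :* g :* (a :* a :- con (1 , 0)))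
          refl (sgn d) (sgn e) (z^ d) (z^ e) (conj f) (conj g)))
        (sym (+-series (σᶠ x) (σᶠ y)))))

  σᶠ-involutive : ∀ x → σᶠ (σᶠ x) ≈ᶠ x
  σᶠ-involutive (z^- d · f) = ≈ᶠ-series (trans (*-congˡ (trans (conj.*-homo _ _) (*-cong (conj-sgn d)
      (conj-involutive f))))
    (linear₁ f (sgn-square d) (solve 2 (λ s f → s :* (s :* f) := f :+ f :* (s :* s :- con (1 , 0))) refl (sgn d) f)))

  expandᶠ : Laurent → Laurent
  expandᶠ x = z^- 2 ℕ.* pole x · expand (series x)

  private
    expand-z^-* : ∀ d f → z^ (2 ℕ.* d) * expand f ≈ expand (z^ d * f)
    expand-z^-* d f = sym (trans (expand.⟦⟧-cong (sym (shift≈ d f))) (trans (expand-shift d f) (shift≈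
        (2 ℕ.* d) (expand f))))

  expandᶠ-injective : ∀ {x y} → expandᶠ x ≈ᶠ expandᶠ y → x ≈ᶠ y
  expandᶠ-injective {x@(z^- d · f)} {y@(z^- e · g)} p = ≈ᶠ-intro refl refl refl refl (expand-injective
    (trans (sym (expand-z^-* e f)) (trans (≈ᶠ-elim {expandᶠ x} {expandᶠ y} p) (expand-z^-* d g))))

  expandᶠ-homo : IsRingHomomorphism expandᶠ
  expandᶠ-homo = record
    { isSemiringHomomorphism = record
      { isNearSemiringHomomorphism = record
        { +-isMonoidHomomorphism = record
          { isMagmaHomomorphism = record
            { isRelHomomorphism = record { cong = λ {x} {y} → expand-cong {x} {y} }
            ; homo = expand-+
            }
          ; ε-homo = ≈ᶠ-series expand.0#-homo
          }
        ; *-homo = λ (z^- d · f) (z^- e · g) → ≈ᶠ-intro (z2 d e) (expand.*-homo f g) (z^-+ (2 ℕ.* d)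
            (2 ℕ.* e)) refl refl
        }
      ; 1#-homo = ≈ᶠ-series expand.1#-homo
      }
    ; -‿homo = λ (z^- d · f) → ≈ᶠ-series (expand.-‿homo f)
    }
    where
    z2 : ∀ d e → z^ (2 ℕ.* (d ℕ.+ e)) ≈ z^ (2 ℕ.* d) * z^ (2 ℕ.* e)
    z2 d e = trans (reflexive (≡.cong z^ (ℕ.*-distribˡ-+ 2 d e))) (z^-+ (2 ℕ.* d) (2 ℕ.* e))
    expand-cong : ∀ {x y} → x ≈ᶠ y → expandᶠ x ≈ᶠ expandᶠ y
    expand-cong {x@(z^- d · f)} {y@(z^- e · g)} p = ≈ᶠ-intro refl refl refl refl
      (trans (expand-z^-* e f) (trans (expand.⟦⟧-cong (≈ᶠ-elim {x} {y} p)) (sym (expand-z^-* d g))))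
    expand-+ : ∀ x y → expandᶠ (x +ᶠ y) ≈ᶠ expandᶠ x +ᶠ expandᶠ y
    expand-+ x@(z^- d · f) y@(z^- e · g) = ≈ᶠ-intro (z2 d e)
      (trans (expand.⟦⟧-cong (+-series x y)) (trans (expand.+-homo _ _) (sym (+-cong (expand-z^-* e f)
          (expand-z^-* d g)))))
      (z^-+ (2 ℕ.* d) (2 ℕ.* e)) (+-series (expandᶠ x) (expandᶠ y)) refl

  σᶠ-expandᶠ : ∀ x → σᶠ (expandᶠ x) ≈ᶠ expandᶠ x
  σᶠ-expandᶠ (z^- d · f) = ≈ᶠ-series (trans (*-cong sgn-even (conj-expand f)) (*-identityˡ _))
    where
    sgn-even : sgn (2 ℕ.* d) ≈ 1#
    sgn-even = trans (reflexive (≡.cong (λ e → sgn (d ℕ.+ e)) (ℕ.+-identityʳ d))) (trans (sgn-+ d d) (sgn-square d))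

  σᶠ-fixed : ∀ x → σᶠ x ≈ᶠ x → ∃[ y ] x ≈ᶠ expandᶠ y
  σᶠ-fixed (z^- d · f) p = (z^- d · g) , (begin
    shift (2 ℕ.* d) f         ≈⟨ reflexive (≡.cong (λ e → shift (d ℕ.+ e) f) (ℕ.+-identityʳ d)) ⟩
    shift (d ℕ.+ d) f         ≈⟨ shift-+ d d f ⟩
    shift d (shift d f)       ≈⟨ shift-cong d (proj₂ fixed) ⟩
    shift d (expand g)        ∎)
    where
    open Relation.Binary.Reasoning.Setoid setoid
    fixed = conj-fixed (shift d f) (begin
      conj (shift d f)              ≈⟨ conj.⟦⟧-cong (shift≈ d f) ⟩
      conj (z^ d * f)               ≈⟨ conj-z^-* d f ⟩
      sgn d * z^ d * conj f         ≈⟨ solve 3 (λ s z f → s :* z :* f := z :* (s :* f)) refl (sgn d) (z^ d) (conj f) ⟩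
      z^ d * (sgn d * conj f)       ≈⟨ *-congˡ (shift-cancel d p) ⟩
      z^ d * f                      ≈⟨ shift≈ d f ⟨
      shift d f                     ∎)
    g = proj₁ fixed

  ι-homo : RingMorphisms.IsRingHomomorphism rawRing F.rawRing ι
  ι-homo = record
    { isSemiringHomomorphism = record
      { isNearSemiringHomomorphism = record
        { +-isMonoidHomomorphism = record
          { isMagmaHomomorphism = record
            { isRelHomomorphism = record { cong = ≈ᶠ-series }
            ; homo = λ f g → ≈ᶠ-series (sym (+-cong (shift-0 f) (shift-0 g)))
            }
          ; ε-homo = F.refl {ι 0#}
          }
        ; *-homo = λ f g → F.refl {ι (f * g)}
        }
      ; 1#-homo = F.refl {ι 1#}
      }
    ; -‿homo = λ f → F.refl {ι (- f)}
    }
  private module ι = RingMorphisms.IsRingHomomorphism ι-homo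

  ι-injective : ∀ {f g} → ι f ≈ᶠ ι g → f ≈ g
  ι-injective p = shift-cancel 0 p

  -- Carries the power series itself, so that an integral matrix yields a matrix over k[[z]] entry
  -- by entry.
  Integralᶠ : Laurent → Set _
  Integralᶠ x = ∃[ f ] x ≈ᶠ ι f

  zᶠ zᶠ⁻¹ : Laurent
  zᶠ = ι (z^ 1)
  zᶠ⁻¹ = z^- 1 · 1#

  open Algebra.Properties.Semiring.Exp F.semiring using (_^_)

  zᶠ⁻¹-shift : ∀ {x f g} → x ≈ᶠ ι f → f ≈ shift 1 g → zᶠ⁻¹ *ᶠ x ≈ᶠ ι g
  zᶠ⁻¹-shift {x} {f} {g} p q = F.trans {zᶠ⁻¹ *ᶠ x} {zᶠ⁻¹ *ᶠ ι f} {ι g} (F.*-congˡ {zᶠ⁻¹} {x} {ι f} p)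
    (trans (shift-0 _) (trans (*-identityˡ f) q))

  zᶠ^ : ∀ d → zᶠ ^ d ≈ᶠ ι (z^ d)
  zᶠ^ zero    = ≈ᶠ-series (sym z^-0)
  zᶠ^ (suc d) = F.trans {zᶠ ^ suc d} {zᶠ *ᶠ ι (z^ d)} {ι (z^ (suc d))}
    (F.*-congˡ {zᶠ} {zᶠ ^ d} {ι (z^ d)} (zᶠ^ d)) (≈ᶠ-series (sym (z^-+ 1 d)))

  laurentConjugation : Conjugation laurentRing _
  laurentConjugation = record
    { σ = σᶠ
    ; σ-homo = σᶠ-homo
    ; σ-involutive = σᶠ-involutive
    ; z = zᶠ
    ; z⁻¹ = zᶠ⁻¹
    ; z*z⁻¹≈1 = ≈ᶠ-intro refl refl z^-0 refl (solve 1 (λ z → con (1 , 0) :* (z :* con (1 , 0)) := z :* con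
        (1 , 0)) refl (z^ 1))
    ; σz≈-z = ≈ᶠ-series (trans (*-identityˡ _) (trans (conj-shift 1#) (-‿cong (shift-cong 1 conj.1#-homo))))
    ; ½ = ι ½
    ; ½+½≈1 = F.trans {ι ½ +ᶠ ι ½} {ι (½ + ½)} {ι 1#} (F.sym {ι (½ + ½)} {ι ½ +ᶠ ι ½} (ι.+-homo ½ ½))
        (≈ᶠ-series ½+½≈1)
    ; Integral = Integralᶠ
    ; int-resp = λ {x} {y} p (f , q) → f , F.trans {y} {x} {ι f} (F.sym {x} {y} p) q
    ; int-+ = λ {x} {y} (f , p) (g , q) → f + g , F.trans {x +ᶠ y} {ι f +ᶠ ι g} {ι (f + g)}
        (F.+-cong {x} {ι f} {y} {ι g} p q)
                (F.sym {ι (f + g)} {ι f +ᶠ ι g} (ι.+-homo f g))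
    ; int-* = λ {x} {y} (f , p) (g , q) → f * g , F.*-cong {x} {ι f} {y} {ι g} p q
    ; int-neg = λ {x} (f , p) → - f , F.-‿cong {x} {ι f} p
    ; int-0 = 0# , F.refl {ι 0#}
    ; int-1 = 1# , F.refl {ι 1#}
    ; int-σ = λ {x} (f , p) → 1# * conj f , RingMorphisms.IsRingHomomorphism.⟦⟧-cong σᶠ-homo {x} {ι f} p
    ; int-z = z^ 1 , F.refl {zᶠ}
    ; int-½ = ½ , F.refl {ι ½}
    ; int-dichotomy = λ {x} (f , p) → Sum.map
        (λ (g , q) → g , zᶠ⁻¹-shift {x} p q)
        (λ (u , q) → ι u , (u , F.refl {ι u}) , F.trans {x *ᶠ ι u} {ι f *ᶠ ι u} {ι 1#}
            (F.*-congʳ {ι u} {x} {ι f} p) (≈ᶠ-series q))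
        (dichotomy f)
    ; z⁻¹-nonintegral = λ (f , p) → proper f (trans (sym (shift-0 1#)) p)
    ; σ-residual = λ {x} (f , p) → let g , q = residual f in
        g , zᶠ⁻¹-shift {x F.- σᶠ x} {f + - (1# * conj f)} {g}
          (F.trans {x F.- σᶠ x} {ι f F.- σᶠ (ι f)} {ι (f + - (1# * conj f))}
            (F.+-cong {x} {ι f} { -ᶠ σᶠ x} { -ᶠ σᶠ (ι f)} p (F.-‿cong {σᶠ x} {σᶠ (ι f)}
                (RingMorphisms.IsRingHomomorphism.⟦⟧-cong σᶠ-homo {x} {ι f} p)))
            (F.sym {ι (f + - (1# * conj f))} {ι f F.- σᶠ (ι f)} (ι.+-homo f (- (1# * conj f)))))
          (trans (+-congˡ (-‿cong (*-identityˡ _))) q)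
    ; int-bounded = λ x@(z^- d · f) → d , f , F.trans {zᶠ ^ d *ᶠ x} {ι (z^ d) *ᶠ x} {ι f}
        (F.*-congʳ {x} {zᶠ ^ d} {ι (z^ d)} (zᶠ^ d)) (trans (shift-0 _) (sym (shift≈ d f)))
    }

-- From cocycles back to double cosets

module DoubleCosets {A : Set c} (S : SeriesRing A ℓ) where
  open SeriesRing S using (commutativeRing)
  open LaurentRing S using (laurentRing; ι)
  open LaurentConjugation S
  open Matrices laurentRing
  open Reduction laurentRing laurentConjugation
  open Existence laurentRing laurentConjugation using (solvable)
  open Uniqueness laurentRing laurentConjugation using (unique)
  private
    module E = MatrixMap laurentRing laurentRing expandᶠ-homo
    module I = MatrixMap commutativeRing laurentRing ι-homo
    module S = CommutativeRing commutativeRing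
    module GLᶠ {m} = GL {R = F.rawRing} {m}
    module GLˢ {m} = GL {R = S.rawRing} {m}

  InDoubleCosetᶠ : ∀ {m} → GL F.rawRing m → Mat m m → Set _
  InDoubleCosetᶠ {m} g M = Σ[ a ∈ GL S.rawRing m ] Σ[ h ∈ GL F.rawRing m ]
    M ≈ₘ I.mapₘ (GLˢ.matrix a) ⋆ GLᶠ.matrix g ⋆ E.mapₘ (GLᶠ.matrix h)

  coset-resp : ∀ {m} (g : GL F.rawRing m) M N → M ≈ₘ N → InDoubleCosetᶠ g M → InDoubleCosetᶠ g N
  coset-resp g M N M≈N (a , h , p) = a , h , ≈ₘ.trans {j = M} (≈ₘ.sym {x = M} {N} M≈N) p

  -- With T = σ(G) G⁻¹ the basis `C` of the solution satisfies σ(C) = T C just like G, so H = G⁻¹ C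
  -- is fixed by σ and comes from k((z²)). Then α G H = α C is block diagonal.
  coset-exists : ∀ {m} (g : GL F.rawRing m) → Σ[ bs ∈ Blocks m ] InDoubleCosetᶠ g (blockDiagonal bs)
  coset-exists {m} g = bs , aˢ , hᶠ , (begin
    blockDiagonal bs                     ≈⟨ aC≈B ⟨
    α ⋆ C                                ≈⟨ ⋆-cong (≈ₘ.refl {x = α}) (⋆-cancelˡ C (GLᶠ.inverseʳ g)) ⟨
    α ⋆ (G ⋆ H)                          ≈⟨ ⋆-assoc α G H ⟨
    α ⋆ G ⋆ H                            ≈⟨ ⋆-cong (⋆-cong α≈ (≈ₘ.refl {x = G})) H≈ ⟩
    I.mapₘ (GLˢ.matrix aˢ) ⋆ G ⋆ E.mapₘ (GLᶠ.matrix hᶠ) ∎)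
    where
    open ⋆-Reasoning
    G = GLᶠ.matrix g
    G⁻¹ = GLᶠ.inverse g
    T = σₘ G ⋆ G⁻¹
    cocycle : IsCocycle T
    cocycle = begin
      σₘ (σₘ G ⋆ G⁻¹) ⋆ (σₘ G ⋆ G⁻¹)
        ≈⟨ ⋆-cong (≈ₘ.trans (σ-⋆ (σₘ G) G⁻¹) (⋆-cong (σₘ-involutive G) (≈ₘ.refl {x = σₘ G⁻¹}))) (≈ₘ.refl {x = T}) ⟩
      G ⋆ σₘ G⁻¹ ⋆ (σₘ G ⋆ G⁻¹)
        ≈⟨ inverse-⋆ {A = G} {G⁻¹} {σₘ G⁻¹} {σₘ G} (GLᶠ.inverseʳ g) (σ-inverse {A = G⁻¹} {G} (GLᶠ.inverseˡ g)) ⟩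
      1ₘ ∎
    solution = solvable T cocycle
    bs = proj₁ solution
    open Solution (proj₂ solution)
    α = IntegralGL.matrix a
    α⁻¹ = IntegralGL.inverse a
    H = G⁻¹ ⋆ C
    H⁻¹ = C⁻¹ ⋆ G
    H⋆H⁻¹≈1 : H ⋆ H⁻¹ ≈ₘ 1ₘ
    H⋆H⁻¹≈1 = inverse-⋆ {A = G⁻¹} {G} {C} {C⁻¹} (GLᶠ.inverseˡ g) C⋆C⁻¹≈1
    H⁻¹⋆H≈1 : H⁻¹ ⋆ H ≈ₘ 1ₘ
    H⁻¹⋆H≈1 = inverse-⋆ {A = C⁻¹} {C} {G} {G⁻¹} C⁻¹⋆C≈1 (GLᶠ.inverseʳ g)
    σH≈H : σₘ H ≈ₘ H
    σH≈H = begin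
      σₘ (G⁻¹ ⋆ C)                  ≈⟨ σ-⋆ G⁻¹ C ⟩
      σₘ G⁻¹ ⋆ σₘ C                 ≈⟨ ⋆-cong (≈ₘ.refl {x = σₘ G⁻¹}) (≈ₘ.trans σC≈TC (⋆-assoc (σₘ G) G⁻¹ C)) ⟩
      σₘ G⁻¹ ⋆ (σₘ G ⋆ (G⁻¹ ⋆ C))   ≈⟨ ⋆-cancelˡ (G⁻¹ ⋆ C) (σ-inverse {A = G⁻¹} {G} (GLᶠ.inverseˡ g)) ⟩
      G⁻¹ ⋆ C                       ∎
    σH⁻¹≈H⁻¹ : σₘ H⁻¹ ≈ₘ H⁻¹
    σH⁻¹≈H⁻¹ = begin
      σₘ H⁻¹                  ≈⟨ ⋆-cancelʳ (σₘ H⁻¹) H⋆H⁻¹≈1 ⟨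
      σₘ H⁻¹ ⋆ H ⋆ H⁻¹        ≈⟨ ⋆-cong (⋆-cong (≈ₘ.refl {x = σₘ H⁻¹}) σH≈H) (≈ₘ.refl {x = H⁻¹}) ⟨
      σₘ H⁻¹ ⋆ σₘ H ⋆ H⁻¹     ≈⟨ ⋆-cong (σ-inverse {A = H⁻¹} {H} H⁻¹⋆H≈1) (≈ₘ.refl {x = H⁻¹}) ⟩
      1ₘ ⋆ H⁻¹                ≈⟨ ⋆-identityˡ H⁻¹ ⟩
      H⁻¹                     ∎
    h h⁻¹ : Mat m m
    h i j = proj₁ (σᶠ-fixed (H i j) (σH≈H i j))
    h⁻¹ i j = proj₁ (σᶠ-fixed (H⁻¹ i j) (σH⁻¹≈H⁻¹ i j))
    H≈ : H ≈ₘ E.mapₘ h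
    H≈ i j = proj₂ (σᶠ-fixed (H i j) (σH≈H i j))
    H⁻¹≈ : H⁻¹ ≈ₘ E.mapₘ h⁻¹
    H⁻¹≈ i j = proj₂ (σᶠ-fixed (H⁻¹ i j) (σH⁻¹≈H⁻¹ i j))
    hᶠ : GL F.rawRing m
    hᶠ = record
      { matrix = h
      ; inverse = h⁻¹
      ; inverseˡ = E.reflect-inverse (λ {x} {y} → expandᶠ-injective {x} {y}) h⁻¹ h H⁻¹≈ H≈ H⁻¹⋆H≈1
      ; inverseʳ = E.reflect-inverse (λ {x} {y} → expandᶠ-injective {x} {y}) h h⁻¹ H≈ H⁻¹≈ H⋆H⁻¹≈1
      }
    aₛ aₛ⁻¹ : Matrices.Mat commutativeRing m m
    aₛ i j = proj₁ (IntegralGL.matrix-int a i j)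
    aₛ⁻¹ i j = proj₁ (IntegralGL.inverse-int a i j)
    α≈ : α ≈ₘ I.mapₘ aₛ
    α≈ i j = proj₂ (IntegralGL.matrix-int a i j)
    α⁻¹≈ : α⁻¹ ≈ₘ I.mapₘ aₛ⁻¹
    α⁻¹≈ i j = proj₂ (IntegralGL.inverse-int a i j)
    aˢ : GL S.rawRing m
    aˢ = record
      { matrix = aₛ
      ; inverse = aₛ⁻¹
      ; inverseˡ = I.reflect-inverse ι-injective aₛ⁻¹ aₛ α⁻¹≈ α≈ (IntegralGL.inverseˡ a)
      ; inverseʳ = I.reflect-inverse ι-injective aₛ aₛ⁻¹ α≈ α⁻¹≈ (IntegralGL.inverseʳ a)
      }

  integralGL : ∀ {m} → GL S.rawRing m → IntegralGL m
  integralGL a = record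
    { matrix = I.mapₘ (GLˢ.matrix a)
    ; inverse = I.mapₘ (GLˢ.inverse a)
    ; matrix-int = λ i j → GLˢ.matrix a i j , F.refl {ι (GLˢ.matrix a i j)}
    ; inverse-int = λ i j → GLˢ.inverse a i j , F.refl {ι (GLˢ.inverse a i j)}
    ; inverseˡ = I.map-inverse {A = GLˢ.inverse a} {GLˢ.matrix a} (GLˢ.inverseˡ a)
    ; inverseʳ = I.map-inverse {A = GLˢ.matrix a} {GLˢ.inverse a} (GLˢ.inverseʳ a)
    }

  inverseGL : ∀ {m} → IntegralGL m → IntegralGL m
  inverseGL α = record
    { matrix = inverse ; inverse = matrix ; matrix-int = inverse-int ; inverse-int = matrix-int
    ; inverseˡ = inverseʳ ; inverseʳ = inverseˡ }
    where open IntegralGL α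

  -- From B = a g h and C = a′ g h′ the matrix g is eliminated: (a a′⁻¹) C = B (h⁻¹ h′), which is
  -- the input of `unique`.
  coset-unique : ∀ {m} (g : GL F.rawRing m) (bs cs : Blocks m) →
    InDoubleCosetᶠ g (blockDiagonal bs) → InDoubleCosetᶠ g (blockDiagonal cs) → toList bs ↭ toList cs
  coset-unique {m} g bs cs (a , h , B≈agh) (a′ , h′ , C≈a′gh′) =
    unique bs cs (integralGL a ∘GL inverseGL (integralGL a′)) (L⁻¹ ⋆ L′) (L′⁻¹ ⋆ (G⁻¹ ⋆ α′⁻¹)) AC≈BH σH≈H CD≈1
    where
    open ⋆-Reasoning
    G = GLᶠ.matrix g
    G⁻¹ = GLᶠ.inverse g
    α = I.mapₘ (GLˢ.matrix a)
    α′ = I.mapₘ (GLˢ.matrix a′)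
    α′⁻¹ = I.mapₘ (GLˢ.inverse a′)
    L = E.mapₘ (GLᶠ.matrix h)
    L⁻¹ = E.mapₘ (GLᶠ.inverse h)
    L′ = E.mapₘ (GLᶠ.matrix h′)
    L′⁻¹ = E.mapₘ (GLᶠ.inverse h′)
    B = blockDiagonal bs
    C = blockDiagonal cs
    AC≈BH : α ⋆ α′⁻¹ ⋆ C ≈ₘ B ⋆ (L⁻¹ ⋆ L′)
    AC≈BH = begin
      α ⋆ α′⁻¹ ⋆ C                      ≈⟨ ⋆-assoc α α′⁻¹ C ⟩
      α ⋆ (α′⁻¹ ⋆ C)                    ≈⟨ ⋆-cong (≈ₘ.refl {x = α}) (⋆-cong (≈ₘ.refl {x = α′⁻¹})
          (≈ₘ.trans C≈a′gh′ (⋆-assoc α′ G L′))) ⟩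
      α ⋆ (α′⁻¹ ⋆ (α′ ⋆ (G ⋆ L′)))      ≈⟨ ⋆-cong (≈ₘ.refl {x = α}) (⋆-cancelˡ (G ⋆ L′)
          (I.map-inverse {A = GLˢ.inverse a′} {GLˢ.matrix a′} (GLˢ.inverseˡ a′))) ⟩
      α ⋆ (G ⋆ L′)                      ≈⟨ ⋆-assoc α G L′ ⟨
      α ⋆ G ⋆ L′                        ≈⟨ ⋆-cong (⋆-cancelʳ (α ⋆ G)
          (E.map-inverse {A = GLᶠ.matrix h} {GLᶠ.inverse h} (GLᶠ.inverseʳ h))) (≈ₘ.refl {x = L′}) ⟨
      α ⋆ G ⋆ L ⋆ L⁻¹ ⋆ L′              ≈⟨ ⋆-cong (⋆-cong B≈agh (≈ₘ.refl {x = L⁻¹})) (≈ₘ.refl {x = L′}) ⟨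
      B ⋆ L⁻¹ ⋆ L′                      ≈⟨ ⋆-assoc B L⁻¹ L′ ⟩
      B ⋆ (L⁻¹ ⋆ L′)                    ∎
    σ-fixed : ∀ (M : Mat m m) → σₘ (E.mapₘ M) ≈ₘ E.mapₘ M
    σ-fixed M i j = σᶠ-expandᶠ (M i j)
    σH≈H : σₘ (L⁻¹ ⋆ L′) ≈ₘ L⁻¹ ⋆ L′
    σH≈H = ≈ₘ.trans (σ-⋆ L⁻¹ L′) (⋆-cong (σ-fixed (GLᶠ.inverse h)) (σ-fixed (GLᶠ.matrix h′)))
    CD≈1 : C ⋆ (L′⁻¹ ⋆ (G⁻¹ ⋆ α′⁻¹)) ≈ₘ 1ₘ
    CD≈1 = ≈ₘ.trans (⋆-cong C≈a′gh′ (≈ₘ.refl {x = L′⁻¹ ⋆ (G⁻¹ ⋆ α′⁻¹)}))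
      (inverse-⋆ {A = α′ ⋆ G} {G⁻¹ ⋆ α′⁻¹} {L′} {L′⁻¹}
        (inverse-⋆ {A = α′} {α′⁻¹} {G} {G⁻¹} (I.map-inverse {A = GLˢ.matrix a′} {GLˢ.inverse a′}
            (GLˢ.inverseʳ a′)) (GLᶠ.inverseʳ g))
        (E.map-inverse {A = GLᶠ.matrix h′} {GLᶠ.inverse h′} (GLᶠ.inverseʳ h′)))

-- Formal power series

module FormalSeries (k : CommutativeRing c ℓ) where
  open CommutativeRing k hiding (zero; isCommutativeRing)
  open Algebra.Properties.Ring ring
  open IntegerSolver k
  open Matrices k using (sum-cong; sum-zero; ∑-distrib-+; *-distribˡ-sum)
  open PowerSeries k
  open Relation.Binary.Reasoning.Setoid setoid
  private module P = RawRing k⟦z⟧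

  Series : Set c
  Series = ℕ → Carrier

  infixl 7 _⊛_
  infixl 6 _⊹_
  _⊛_ _⊹_ : Series → Series → Series
  _⊛_ = P._*_
  _⊹_ = P._+_

  tail : Series → Series
  tail f n = f (suc n)

  -- (f ⊛ g) (suc n) is definitionally f 0 * g (suc n) + (tail f ⊛ g) n,
  -- so that tail (f ⊛ g) is f 0 · tail g ⊹ tail f ⊛ g.
  infixr 8 _·_
  _·_ : Carrier → Series → Series
  (x · f) n = x * f n

  ⊛-cong : ∀ {f f′ g g′} → f P.≈ f′ → g P.≈ g′ → f ⊛ g P.≈ f′ ⊛ g′
  ⊛-cong p q n = sum-cong {suc n} λ i → *-cong (p (toℕ i)) (q (n ℕ.∸ toℕ i))

  ⊛-distribʳ : ∀ h f g → (f ⊹ g) ⊛ h P.≈ (f ⊛ h) ⊹ (g ⊛ h)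
  ⊛-distribʳ h f g n = trans
    (sum-cong {suc n} (λ i → distribʳ (h (n ℕ.∸ toℕ i)) (f (toℕ i)) (g (toℕ i))))
    (∑-distrib-+ {suc n} (λ i → f (toℕ i) * h (n ℕ.∸ toℕ i)) (λ i → g (toℕ i) * h (n ℕ.∸ toℕ i)))

  ·-⊛ : ∀ x f g → (x · f) ⊛ g P.≈ x · (f ⊛ g)
  ·-⊛ x f g n = trans
    (sum-cong {suc n} (λ i → *-assoc x (f (toℕ i)) (g (n ℕ.∸ toℕ i))))
    (sym (*-distribˡ-sum {suc n} x (λ i → f (toℕ i) * g (n ℕ.∸ toℕ i))))

  ⊛-zeroˡ : ∀ f → P.0# ⊛ f P.≈ P.0#
  ⊛-zeroˡ f n = sum-zero {suc n} λ i → zeroˡ (f (n ℕ.∸ toℕ i))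

  tail-⊛ : ∀ f g h → tail (f ⊛ g) ⊛ h P.≈ (f 0 · (tail g ⊛ h)) ⊹ ((tail f ⊛ g) ⊛ h)
  tail-⊛ f g h n = trans (⊛-distribʳ h (f 0 · tail g) (tail f ⊛ g) n) (+-congʳ (·-⊛ (f 0) (tail g) h n))

  -- Multiplication unfolds along the first factor by definition; commutativity compares this with
  -- the recursion along the second factor.
  ⊛-sucʳ : ∀ n f g → (f ⊛ g) (suc n) ≈ f (suc n) * g 0 + (f ⊛ tail g) n
  ⊛-sucʳ zero    f g = solve 4 (λ a b c d → a :* b :+ (c :* d :+ con (0 , 0)) := c :* d :+ (a :* b :+ con (0 , 0)))
    refl (f 0) (g 1) (f 1) (g 0)
  ⊛-sucʳ (suc n) f g = trans (+-congˡ (⊛-sucʳ n (tail f) g))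
    (solve 3 (λ a b c → a :+ (b :+ c) := b :+ (a :+ c)) refl
      (f 0 * g (suc (suc n))) (f (suc (suc n)) * g 0) ((tail f ⊛ tail g) n))

  ⊛-comm : ∀ f g → f ⊛ g P.≈ g ⊛ f
  ⊛-comm f g zero    = +-congʳ (*-comm (f 0) (g 0))
  ⊛-comm f g (suc n) = trans (+-cong (*-comm (f 0) (g (suc n))) (⊛-comm (tail f) g n)) (sym (⊛-sucʳ n g f))

  ⊛-assoc : ∀ f g h → (f ⊛ g) ⊛ h P.≈ f ⊛ (g ⊛ h)
  ⊛-assoc f g h zero    = solve 3 (λ a b c → (a :* b :+ con (0 , 0)) :* c :+ con (0 , 0) := a :* (b :* c
      :+ con (0 , 0)) :+ con (0 , 0))
    refl (f 0) (g 0) (h 0)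
  ⊛-assoc f g h (suc n) = begin
    (f 0 * g 0 + 0#) * h (suc n) + (tail (f ⊛ g) ⊛ h) n
      ≈⟨ +-congˡ (trans (tail-⊛ f g h n) (+-congˡ (⊛-assoc (tail f) g h n))) ⟩
    (f 0 * g 0 + 0#) * h (suc n) + (f 0 * (tail g ⊛ h) n + (tail f ⊛ (g ⊛ h)) n)
      ≈⟨ solve 5 (λ a b c d e → (a :* b :+ con (0 , 0)) :* c :+ (a :* d :+ e) := a :* (b :* c :+ d) :+ e)
           refl (f 0) (g 0) (h (suc n)) ((tail g ⊛ h) n) ((tail f ⊛ (g ⊛ h)) n) ⟩
    f 0 * (g 0 * h (suc n) + (tail g ⊛ h) n) + (tail f ⊛ (g ⊛ h)) n ∎

  ⊛-identityˡ : ∀ f → P.1# ⊛ f P.≈ f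
  ⊛-identityˡ f zero    = trans (+-identityʳ _) (*-identityˡ (f 0))
  ⊛-identityˡ f (suc n) = trans (+-cong (*-identityˡ (f (suc n))) (⊛-zeroˡ f n)) (+-identityʳ _)

  isCommutativeRing : IsCommutativeRing P._≈_ P._+_ P._*_ P.-_ P.0# P.1#
  isCommutativeRing = record
    { isRing = record
      { +-isAbelianGroup = record
        { isGroup = record
          { isMonoid = record
            { isSemigroup = record
              { isMagma = record
                { isEquivalence = record { refl = λ _ → refl ; sym = λ p n → sym (p n) ; trans = λ p q n →
                    trans (p n) (q n) }
                ; ∙-cong = λ p q n → +-cong (p n) (q n)
                }
              ; assoc = λ f g h n → +-assoc (f n) (g n) (h n)
              }
            ; identity = (λ f n → +-identityˡ (f n)) , λ f n → +-identityʳ (f n)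
            }
          ; inverse = (λ f n → -‿inverseˡ (f n)) , λ f n → -‿inverseʳ (f n)
          ; ⁻¹-cong = λ p n → -‿cong (p n)
          }
        ; comm = λ f g n → +-comm (f n) (g n)
        }
      ; *-cong = ⊛-cong
      ; *-assoc = ⊛-assoc
      ; *-identity = ⊛-identityˡ , λ f n → trans (⊛-comm f P.1# n) (⊛-identityˡ f n)
      ; distrib = (λ f g h n → trans (⊛-comm f (g ⊹ h) n) (trans (⊛-distribʳ f g h n) (+-cong (⊛-comm g f n)
          (⊛-comm h f n)))) , ⊛-distribʳ
      }
    ; *-comm = ⊛-comm
    }

  commutativeRing : CommutativeRing c ℓ
  commutativeRing = record { isCommutativeRing = isCommutativeRing }

  open RingMorphisms k⟦z⟧ k⟦z⟧ using (IsRingHomomorphism)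

  ringHomomorphism : ∀ φ → (∀ {f g} → f P.≈ g → φ f P.≈ φ g) → (∀ f g → φ (f ⊹ g) P.≈ φ f ⊹ φ g) →
    (∀ f g → φ (f ⊛ g) P.≈ φ f ⊛ φ g) → φ P.0# P.≈ P.0# → φ P.1# P.≈ P.1# → (∀ f → φ (P.- f) P.≈ P.- φ f) →
        IsRingHomomorphism φ
  ringHomomorphism φ φ-cong φ-+ φ-* φ-0 φ-1 φ-neg = record
    { isSemiringHomomorphism = record
      { isNearSemiringHomomorphism = record
        { +-isMonoidHomomorphism = record
          { isMagmaHomomorphism = record { isRelHomomorphism = record { cong = φ-cong } ; homo = φ-+ }
          ; ε-homo = φ-0
          }
        ; *-homo = φ-*
        }
      ; 1#-homo = φ-1
      }
    ; -‿homo = φ-neg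
    }

  shift-cong : ∀ d {f g} → f P.≈ g → shift d f P.≈ shift d g
  shift-cong zero    p n       = p n
  shift-cong (suc d) p zero    = refl
  shift-cong (suc d) p (suc n) = shift-cong d p n

  shift-cancel : ∀ d {f g} → shift d f P.≈ shift d g → f P.≈ g
  shift-cancel zero    p n = p n
  shift-cancel (suc d) p   = shift-cancel d (λ n → p (suc n))

  shift-+ : ∀ d e f → shift (d ℕ.+ e) f P.≈ shift d (shift e f)
  shift-+ zero    e f n       = refl
  shift-+ (suc d) e f zero    = refl
  shift-+ (suc d) e f (suc n) = shift-+ d e f n

  shift-* : ∀ d f g → shift d f ⊛ g P.≈ shift d (f ⊛ g)
  shift-* zero    f g n       = refl
  shift-* (suc d) f g zero    = trans (+-identityʳ _) (zeroˡ _)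
  shift-* (suc d) f g (suc n) = trans (+-congʳ (zeroˡ _)) (trans (+-identityˡ _) (shift-* d f g n))

  -- conj f = f(- z)
  conj : Series → Series
  conj f zero    = f zero
  conj f (suc n) = - conj (tail f) n

  conj-cong : ∀ {f g} → f P.≈ g → conj f P.≈ conj g
  conj-cong p zero    = p zero
  conj-cong p (suc n) = -‿cong (conj-cong (p ∘ suc) n)

  conj-+ : ∀ f g → conj (f ⊹ g) P.≈ conj f ⊹ conj g
  conj-+ f g zero    = refl
  conj-+ f g (suc n) = trans (-‿cong (conj-+ (tail f) (tail g) n)) (solve 2 (λ a b → :- (a :+ b) := :- a
      :+ :- b) refl _ _)

  conj-· : ∀ x f → conj (x · f) P.≈ x · conj f
  conj-· x f zero    = refl
  conj-· x f (suc n) = trans (-‿cong (conj-· x (tail f) n)) (-‿distribʳ-* x _)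

  conj-neg : ∀ f → conj (P.- f) P.≈ P.- conj f
  conj-neg f zero    = refl
  conj-neg f (suc n) = -‿cong (conj-neg (tail f) n)

  conj-0 : conj P.0# P.≈ P.0#
  conj-0 zero    = refl
  conj-0 (suc n) = trans (-‿cong (conj-0 n)) -0#≈0#

  neg-⊛ : ∀ f g → (P.- f) ⊛ g P.≈ P.- (f ⊛ g)
  neg-⊛ f g n = sym (Algebra.Properties.Ring.-‿distribˡ-* (CommutativeRing.ring commutativeRing) f g n)

  conj-⊛ : ∀ f g → conj (f ⊛ g) P.≈ conj f ⊛ conj g
  conj-⊛ f g zero    = refl
  conj-⊛ f g (suc n) = begin
    - conj ((f 0 · tail g) ⊹ (tail f ⊛ g)) n
      ≈⟨ -‿cong (trans (conj-+ (f 0 · tail g) (tail f ⊛ g) n) (+-cong (conj-· (f 0) (tail g) n) (conj-⊛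
          (tail f) g n))) ⟩
    - (f 0 * conj (tail g) n + (conj (tail f) ⊛ conj g) n)
      ≈⟨ solve 3 (λ a b x → :- (a :* b :+ x) := a :* (:- b) :+ :- x) refl (f 0) (conj (tail g) n) ((conj
          (tail f) ⊛ conj g) n) ⟩
    f 0 * conj g (suc n) + - (conj (tail f) ⊛ conj g) n
      ≈⟨ +-congˡ (neg-⊛ (conj (tail f)) (conj g) n) ⟨
    f 0 * conj g (suc n) + ((P.- conj (tail f)) ⊛ conj g) n ∎

  conj-involutive : ∀ f → conj (conj f) P.≈ f
  conj-involutive f zero    = refl
  conj-involutive f (suc n) = trans (-‿cong (trans (conj-neg (conj (tail f)) n) (-‿cong (conj-involutive
      (tail f) n)))) (-‿involutive _)

  conj-homo : IsRingHomomorphism conj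
  conj-homo = ringHomomorphism conj conj-cong conj-+ conj-⊛ conj-0
    (λ { zero → refl ; (suc n) → trans (-‿cong (conj-0 n)) -0#≈0# }) conj-neg

  conj-shift : ∀ f → conj (shift 1 f) P.≈ P.- shift 1 (conj f)
  conj-shift f zero    = sym -0#≈0#
  conj-shift f (suc n) = refl

  expand-cong : ∀ {f g} → f P.≈ g → expand f P.≈ expand g
  expand-cong p zero          = p zero
  expand-cong p (suc zero)    = refl
  expand-cong p (suc (suc n)) = expand-cong (p ∘ suc) n

  expand-+ : ∀ f g → expand (f ⊹ g) P.≈ expand f ⊹ expand g
  expand-+ f g zero          = refl
  expand-+ f g (suc zero)    = sym (+-identityʳ 0#)
  expand-+ f g (suc (suc n)) = expand-+ (tail f) (tail g) n

  expand-· : ∀ x f → expand (x · f) P.≈ x · expand f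
  expand-· x f zero          = refl
  expand-· x f (suc zero)    = sym (zeroʳ x)
  expand-· x f (suc (suc n)) = expand-· x (tail f) n

  expand-neg : ∀ f → expand (P.- f) P.≈ P.- expand f
  expand-neg f zero          = refl
  expand-neg f (suc zero)    = sym -0#≈0#
  expand-neg f (suc (suc n)) = expand-neg (tail f) n

  expand-0 : expand P.0# P.≈ P.0#
  expand-0 zero          = refl
  expand-0 (suc zero)    = refl
  expand-0 (suc (suc n)) = expand-0 n

  expand-1 : expand P.1# P.≈ P.1#
  expand-1 zero          = refl
  expand-1 (suc zero)    = refl
  expand-1 (suc (suc n)) = expand-0 n

  expand-⊛ : ∀ f g → expand (f ⊛ g) P.≈ expand f ⊛ expand g
  expand-⊛ f g zero          = refl
  expand-⊛ f g (suc zero)    = solve 2 (λ a b → con (0 , 0) := a :* con (0 , 0) :+ (con (0 , 0) :* b :+ con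
      (0 , 0))) refl (f 0) (g 0)
  expand-⊛ f g (suc (suc n)) = begin
    expand ((f 0 · tail g) ⊹ (tail f ⊛ g)) n
      ≈⟨ trans (expand-+ (f 0 · tail g) (tail f ⊛ g) n) (+-cong (expand-· (f 0) (tail g) n) (expand-⊛ (tail f) g n)) ⟩
    f 0 * expand (tail g) n + (expand (tail f) ⊛ expand g) n
      ≈⟨ solve 3 (λ a b x → a :+ b := a :+ (con (0 , 0) :* x :+ b)) refl _ _ (expand g (suc n)) ⟩
    f 0 * expand (tail g) n + (0# * expand g (suc n) + (expand (tail f) ⊛ expand g) n) ∎

  expand-homo : IsRingHomomorphism expand
  expand-homo = ringHomomorphism expand expand-cong expand-+ expand-⊛ expand-0 expand-1 expand-neg

  -- A left inverse of `expand`; it also provides the witness when a series fixed by `conj` is to be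
  -- written in z².
  even : Series → Series
  even f zero    = f zero
  even f (suc n) = even (tail (tail f)) n

  even-cong : ∀ {f g} → f P.≈ g → even f P.≈ even g
  even-cong p zero    = p zero
  even-cong p (suc n) = even-cong (λ m → p (suc (suc m))) n

  even-expand : ∀ f → even (expand f) P.≈ f
  even-expand f zero    = refl
  even-expand f (suc n) = even-expand (tail f) n

  expand-injective : ∀ {f g} → expand f P.≈ expand g → f P.≈ g
  expand-injective {f} {g} p n = trans (sym (even-expand f n)) (trans (even-cong p n) (even-expand g n))

  expand-shift : ∀ d f → expand (shift d f) P.≈ shift (2 ℕ.* d) (expand f)
  expand-shift zero    f n = refl
  expand-shift (suc d) f n = trans (step n) (reflexive (≡.cong (λ e → shift e (expand f) n) (≡.sym (ℕ.*-suc 2 d))))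
    where
    step : expand (shift (suc d) f) P.≈ shift (2 ℕ.+ 2 ℕ.* d) (expand f)
    step zero          = refl
    step (suc zero)    = refl
    step (suc (suc n)) = expand-shift d f n

  conj-expand : ∀ f → conj (expand f) P.≈ expand f
  conj-expand f zero          = refl
  conj-expand f (suc zero)    = -0#≈0#
  conj-expand f (suc (suc n)) = trans (-‿involutive _) (conj-expand (tail f) n)

  -- The odd coefficients of a fixed series equal their own negatives.
  expand-even : ∀ f → (∀ n → conj f n ≈ f n) → (∀ {x} → - x ≈ x → x ≈ 0#) → f P.≈ expand (even f)
  expand-even f p torsion-free zero          = refl
  expand-even f p torsion-free (suc zero)    = torsion-free (p 1)
  expand-even f p torsion-free (suc (suc n)) =
    expand-even (tail (tail f)) (λ m → trans (sym (-‿involutive _)) (p (suc (suc m)))) torsion-free n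

  -- long division of r by a series with leading coefficient u⁻¹
  quotient : Series → Carrier → Series → Series
  quotient f u r zero    = u * r 0
  quotient f u r (suc n) = quotient f u (tail (r ⊹ P.- ((u * r 0) · f))) n

  quotient-⊛ : ∀ f u → f 0 * u ≈ 1# → ∀ r → quotient f u r ⊛ f P.≈ r
  quotient-⊛ f u f₀u≈1 r zero    = linear₁ (r 0) f₀u≈1
    (solve 3 (λ f u r → u :* r :* f :+ con (0 , 0) := r :+ r :* (f :* u :- con (1 , 0))) refl (f 0) u (r 0))
  quotient-⊛ f u f₀u≈1 r (suc n) = trans (+-congˡ (quotient-⊛ f u f₀u≈1 (tail (r ⊹ P.- ((u * r 0) · f))) n))
    (solve 2 (λ a b → a :+ (b :+ :- a) := b) refl (u * r 0 * f (suc n)) (r (suc n)))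

  constant : Carrier → Series
  constant x zero    = x
  constant x (suc _) = 0#

  shift-tail : ∀ f → f 0 ≈ 0# → f P.≈ shift 1 (tail f)
  shift-tail f p zero    = p
  shift-tail f p (suc n) = refl

  seriesRing : IsField k → (∀ x → Dec (x ≈ 0#)) → ∀ ½ → ½ + ½ ≈ 1# → SeriesRing Carrier ℓ
  seriesRing field-k zero? ½ ½+½≈1 = record
    { isCommutativeRing = isCommutativeRing
    ; shift = shift
    ; shift-cong = shift-cong
    ; shift-cancel = shift-cancel
    ; shift-0 = λ f n → refl
    ; shift-+ = shift-+
    ; shift-* = shift-*
    ; conj = conj
    ; conj-homo = conj-homo
    ; conj-involutive = conj-involutive
    ; conj-shift = conj-shift
    ; expand = expand
    ; expand-homo = expand-homo
    ; expand-injective = expand-injective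
    ; expand-shift = expand-shift
    ; conj-expand = conj-expand
    ; conj-fixed = λ f p → even f , expand-even f p λ {x} -x≈x → linear₂ (- x) (- ½) ½+½≈1 -x≈x
        (solve 2 (λ h x → x := con (0 , 0) :+ :- x :* (h :+ h :- con (1 , 0)) :+ :- h :* (:- x :- x)) refl ½ x)
    ; ½ = constant ½
    ; ½+½≈1 = λ { zero → ½+½≈1 ; (suc n) → +-identityʳ 0# }
    ; dichotomy = dichotomy
    ; proper = λ f p → IsField.1≉0 field-k (p 0)
    ; residual = λ f → tail (f ⊹ P.- conj f) , shift-tail (f ⊹ P.- conj f) (-‿inverseʳ (f 0))
    }
    where
    dichotomy : ∀ f → (∃[ g ] f P.≈ shift 1 g) ⊎ (∃[ u ] f ⊛ u P.≈ P.1#)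
    dichotomy f with zero? (f 0)
    ... | yes f₀≈0 = inj₁ (tail f , shift-tail f f₀≈0)
    ... | no f₀≉0  = let u , f₀u≈1 = IsField.inverse field-k (f 0) f₀≉0 in
      inj₂ (quotient f u P.1# , λ n → trans (⊛-comm f (quotient f u P.1#) n) (quotient-⊛ f u f₀u≈1 P.1# n))

-- The finite field, and the theorem

-- Elements are compared through their numbers in `Fin n`; this is the source of the dichotomy for
-- power series.
finite⇒zero? : (k : CommutativeRing c ℓ) → IsFinite k → let open CommutativeRing k in ∀ x → Dec (x ≈ 0#)
finite⇒zero? k (n , enumeration) x = map′
  (λ e → trans (sym (strictlyInverseʳ x)) (trans (reflexive (≡.cong from e)) (strictlyInverseʳ 0#))) to-cong
  (to x Fin.≟ to 0#)
  where
  open CommutativeRing k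
  open Inverse enumeration

-- If 1 + 1 vanished, the multiples of 1 would depend on parity alone, and as 1 is not 0 this is
-- characteristic two. Decidability turns the negated hypothesis into an inverse of 1 + 1.
characteristic≢2⇒½ : (k : CommutativeRing c ℓ) → IsField k → IsFinite k → ¬ HasCharacteristic k 2 →
  let open CommutativeRing k in ∃[ ½ ] ½ + ½ ≈ 1#
characteristic≢2⇒½ k field-k finite char≢2 with finite⇒zero? k finite (CommutativeRing._+_ k
    (CommutativeRing.1# k) (CommutativeRing.1# k))
... | no 2≉0  = let ½ , 2½≈1 = IsField.inverse field-k _ 2≉0 in
  ½ , trans (sym (trans (distribʳ ½ 1# 1#) (+-cong (*-identityˡ ½) (*-identityˡ ½)))) 2½≈1
  where open CommutativeRing k
... | yes 2≈0 = ⊥-elim (char≢2 λ n → mk⇔ (even n) (λ { (divides q ≡.refl) → vanishes q }))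
  where
  open CommutativeRing k
  open Algebra.Definitions.RawMonoid +-rawMonoid using () renaming (_×_ to _×#_)
  step : ∀ n → suc (suc n) ×# 1# ≈ n ×# 1#
  step n = trans (sym (+-assoc 1# 1# _)) (trans (+-congʳ 2≈0) (+-identityˡ _))
  even : ∀ n → n ×# 1# ≈ 0# → 2 ∣ n
  even zero          e = divides 0 ≡.refl
  even (suc zero)    e = ⊥-elim (IsField.1≉0 field-k (trans (sym (+-identityʳ 1#)) e))
  even (suc (suc n)) e with divides q ≡.refl ← even n (trans (sym (step n)) e) = divides (suc q) ≡.refl
  vanishes : ∀ q → (q ℕ.* 2) ×# 1# ≈ 0#
  vanishes zero    = refl
  vanishes (suc q) = trans (step (q ℕ.* 2)) (vanishes q)

theorem2p1 : ∀ {c ℓ} (k : CommutativeRing c ℓ) → IsField k → IsFinite k → ¬ HasCharacteristic k 2 →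
    let open Laurent k
        open BlockMatrices k in
    ∀ (m : ℕ) → m ≥ 1 → (g : GL k⸨z⸩ m) →
    (Σ[ bs ∈ Blocks m ] InDoubleCoset g (blockDiagonal bs)) ×
    (∀ (bs bs′ : Blocks m) → InDoubleCoset g (blockDiagonal bs) → InDoubleCoset g (blockDiagonal bs′) →
      toList bs ↭ toList bs′)
theorem2p1 k field-k finite char≢2 m m≥1 g =
  (let bs , coset = coset-exists g in
    bs , coset-resp g (R.blockDiagonal bs) (blockDiagonal bs)
        (≈ₘ.sym {x = blockDiagonal bs} {R.blockDiagonal bs} (blockDiagonal≈ bs)) coset) ,
  λ bs bs′ coset coset′ → coset-unique g bs bs′
    (coset-resp g (blockDiagonal bs) (R.blockDiagonal bs) (blockDiagonal≈ bs) coset)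
    (coset-resp g (blockDiagonal bs′) (R.blockDiagonal bs′) (blockDiagonal≈ bs′) coset′)
  where
  half = characteristic≢2⇒½ k field-k finite char≢2
  S = FormalSeries.seriesRing k field-k (finite⇒zero? k finite) (proj₁ half) (proj₂ half)
  K = LaurentRing.laurentRing S
  conjugation = LaurentConjugation.laurentConjugation S
  module K = CommutativeRing K
  open DoubleCosets S
  open Matrices K
  module R = Reduction K conjugation
  open BlockMatrices k
  -- `R.block` is built with `matrix₂`, so the entries agree by computation after matching on the
  -- row and the column.
  block≈ : ∀ b → block b ≈ₘ R.block b
  block≈ ⟨1⟩         i       j       = K.refl {R.block ⟨1⟩ i j}
  block≈ ⟨z⟩         i       j       = K.refl {R.block ⟨z⟩ i j}
  block≈ (upper n p) zero    zero    = K.refl {R.block (upper n p) zero zero}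
  block≈ (upper n p) zero    (suc j) = K.refl {R.block (upper n p) zero (suc j)}
  block≈ (upper n p) (suc i) zero    = K.refl {R.block (upper n p) (suc i) zero}
  block≈ (upper n p) (suc i) (suc j) = K.refl {R.block (upper n p) (suc i) (suc j)}
  blockDiagonal≈ : ∀ {n} (bs : Blocks n) → blockDiagonal bs ≈ₘ R.blockDiagonal bs
  blockDiagonal≈ []       = λ ()
  blockDiagonal≈ (b ∷ bs) = ⊞-cong (block≈ b) (blockDiagonal≈ bs)
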